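{- Let $p$ be a prime with $p\equiv 3\pmod 4$. Then for $M=(3p-1)/4$ and also for $M=p-1$, $$\sum_{k=0}^{M}(-1)^k(8k+1)\frac{(\frac14)_k^3}{k!^3}\equiv 3p(-1)^{(3p-1)/4}+\frac{27p^3}{16}E_{p-3}\left(\tfrac14\right)\pmod{p^4}.$$
   Context: $(x)_k=x(x+1)\cdots(x+k-1)$ is the Pochhammer symbol, with $(x)_0=1$. The Euler polynomials $E_n(x)$ are defined by $\sum_{n\ge 0}E_n(x)\frac{t^n}{n!}=\frac{2e^{xt}}{e^t+1}$. A congruence modulo $p^4$ between rational numbers whose denominators are prime to $p$ means that the difference lies in $p^4\mathbb{Z}_p$, where $\mathbb{Z}_p$ is the ring of $p$-adic integers. -}

module Defs where

open import Data.Fin.Base using (Fin; toℕ; zero; suc)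
open import Data.Integer.Base as ℤ using (ℤ; +_)
open import Data.Integer.Divisibility.Signed using (_∣_; divides; ∣n⇒∣m*n; ∣m⇒∣m*n; ∣m∣n⇒∣m+n)
open import Data.Integer.Tactic.RingSolver using (solve-∀)
open import Data.Nat.Base as ℕ using (ℕ; zero; suc; _∸_; _!)
open import Data.Nat.Properties using (_!≢0)
open import Data.Product.Base using (∃-syntax)
open import Data.Rational.Base
open import Data.Rational.Properties
open import Data.Vec.Base using (Vec; []; _∷_; head; lookup)
open import Relation.Binary.PropositionalEquality

open import Algebra.Definitions.RawSemiring +-*-rawSemiring public using (_^_; sum)

fromℕ : ℕ → ℚ
fromℕ n = + n / 1

infix 9 _!⁻¹
_!⁻¹ : ℕ → ℚ
k !⁻¹ = (+ 1 / (k !)) {{k !≢0}}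

∑< : ℕ → (ℕ → ℚ) → ℚ
∑< n f = sum {n} (λ i → f (toℕ i))

∑≤ : ℕ → (ℕ → ℚ) → ℚ
∑≤ n f = ∑< (suc n) f

pochhammer : ℚ → ℕ → ℚ
pochhammer x zero    = 1ℚ
pochhammer x (suc k) = pochhammer x k * (x + fromℕ k)

-- Formal power series in t over ℚ: f n is the coefficient of tⁿ.

Series : Set
Series = ℕ → ℚ

constant : ℚ → Series
constant c zero    = c
constant c (suc _) = 0ℚ

infixl 6 _⊕_
infixl 7 _⊛_ _⊘_

_⊕_ : Series → Series → Series
(f ⊕ g) n = f n + g n

_⊛_ : Series → Series → Series
(f ⊛ g) n = ∑≤ n (λ i → f i * g (n ∸ i))

-- e^{xt}
exp : ℚ → Series
exp x n = x ^ n * n !⁻¹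

-- The first n coefficients of f / g, highest first: h_{n-1}, …, h₀, where
-- h_n = (f_n − Σ_{i<n} g_{i+1} h_{n-1-i}) / g₀ (cf. ⊛-⊘ below).
quotientCoeffs : (f g : Series) .{{_ : NonZero (g 0)}} → ∀ n → Vec ℚ n
quotientCoeffs f g zero    = []
quotientCoeffs f g (suc n) = (f n - sum (λ i → g (suc (toℕ i)) * lookup hs i)) ÷ g 0 ∷ hs
  where
  hs : Vec ℚ n
  hs = quotientCoeffs f g n

_⊘_ : (f g : Series) .{{_ : NonZero (g 0)}} → Series
(f ⊘ g) n = head (quotientCoeffs f g (suc n))

private
  sum-cong : ∀ {n} {u v : Fin n → ℚ} → (∀ i → u i ≡ v i) → sum u ≡ sum v
  sum-cong {zero}  eq = refl
  sum-cong {suc n} eq = cong₂ _+_ (eq zero) (sum-cong (λ i → eq (suc i)))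

  lookup-quotientCoeffs : ∀ f g .{{_ : NonZero (g 0)}} n (i : Fin n) →
                          lookup (quotientCoeffs f g n) i ≡ (f ⊘ g) (n ∸ suc (toℕ i))
  lookup-quotientCoeffs f g (suc n) zero    = refl
  lookup-quotientCoeffs f g (suc n) (suc i) = lookup-quotientCoeffs f g n i

⊛-⊘ : ∀ f g .{{_ : NonZero (g 0)}} n → (g ⊛ (f ⊘ g)) n ≡ f n
⊛-⊘ f g n = begin
  g 0 * ((f n - s) ÷ g 0) + ∑< n (λ i → g (suc i) * (f ⊘ g) (n ∸ suc i))
    ≡⟨ cong₂ _+_ cancel (sum-cong {n} (λ i → cong (g (suc (toℕ i)) *_) (sym (lookup-quotientCoeffs f g n i)))) ⟩
  (f n - s) + s
    ≡⟨ +-assoc (f n) (- s) s ⟩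
  f n + (- s + s)
    ≡⟨ cong (λ x → f n + x) (+-inverseˡ s) ⟩
  f n + 0ℚ
    ≡⟨ +-identityʳ (f n) ⟩
  f n ∎
  where
  open ≡-Reasoning
  s : ℚ
  s = sum (λ i → g (suc (toℕ i)) * lookup (quotientCoeffs f g n) i)
  cancel : g 0 * ((f n - s) ÷ g 0) ≡ f n - s
  cancel = begin
    g 0 * ((f n - s) * 1/ g 0)  ≡⟨ *-comm (g 0) _ ⟩
    (f n - s) * 1/ g 0 * g 0    ≡⟨ *-assoc (f n - s) (1/ g 0) (g 0) ⟩
    (f n - s) * (1/ g 0 * g 0)  ≡⟨ cong ((f n - s) *_) (*-inverseˡ (g 0)) ⟩
    (f n - s) * 1ℚ              ≡⟨ *-identityʳ _ ⟩
    f n - s                     ∎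

-- The value E_n(x): n! times the coefficient of tⁿ in 2e^{xt} / (e^t + 1).
Euler : ℕ → ℚ → ℚ
Euler n x = fromℕ (n !) * ((constant (fromℕ 2) ⊛ exp x) ⊘ (exp 1ℚ ⊕ constant 1ℚ)) n

-- The p-adic integers as lim ℤ/pⁿ; residues n is a representative mod pⁿ.

record ℤₚ (p : ℕ) : Set where
  field
    residues : ℕ → ℤ
    coherent : ∀ n → + (p ℕ.^ n) ∣ residues (suc n) ℤ.- residues n

open ℤₚ

infix 4 _≈ₚ_
infixl 7 _*ₚ_

_≈ₚ_ : ∀ {p} → ℤₚ p → ℤₚ p → Set
_≈ₚ_ {p} x y = ∀ n → + (p ℕ.^ n) ∣ residues x n ℤ.- residues y n

fromℤ : ∀ {p} → ℤ → ℤₚ p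
fromℤ a .residues n = a
fromℤ a .coherent n = divides (+ 0) (a-a≡0 a)
  where
  a-a≡0 : ∀ a → a ℤ.- a ≡ + 0
  a-a≡0 = solve-∀

_*ₚ_ : ∀ {p} → ℤₚ p → ℤₚ p → ℤₚ p
(x *ₚ y) .residues n = residues x n ℤ.* residues y n
(x *ₚ y) .coherent n =
  subst (_ ∣_) (split (residues x (suc n)) (residues x n) (residues y (suc n)) (residues y n))
    (∣m∣n⇒∣m+n (∣n⇒∣m*n (residues x (suc n)) (coherent y n))
               (∣m⇒∣m*n (residues y n) (coherent x n)))
  where
  split : ∀ a′ a b′ b → a′ ℤ.* (b′ ℤ.- b) ℤ.+ (a′ ℤ.- a) ℤ.* b ≡ a′ ℤ.* b′ ℤ.- a ℤ.* b
  split = solve-∀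

-- x ∈ pᵐℤₚ for rational x = a/b: in the fraction field of ℤₚ, a/b = pᵐz
-- says that b(pᵐz) = a holds in ℤₚ.
_∈_^_ℤₚ : ℚ → ℕ → ℕ → Set
x ∈ p ^ m ℤₚ = ∃[ z ] fromℤ (↧ x) *ₚ (fromℤ (+ (p ℕ.^ m)) *ₚ z) ≈ₚ fromℤ {p} (↥ x)

infix 4 _≡_[mod_^_]
_≡_[mod_^_] : ℚ → ℚ → ℕ → ℕ → Set
x ≡ y [mod p ^ m ] = (x - y) ∈ p ^ m ℤₚ

{-# OPTIONS --safe #-}
module Submission where

-- Put τ = 3p/4 and n = (3p−1)/4 = τ − ¼. Replacing (¼)ₖ³/k!³ by the product of
-- (¼−ζτ)ₖ/(1+ζτ)ₖ over the cube roots of unity ζ changes the summands only by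
-- multiples of τ³; modulo p the coefficient of τ³ is antisymmetric under
-- k ↔ n − k, so the sum over k ≤ n is unchanged modulo p⁴. The new series
-- terminates at n, and Whipple's transformation turns it into 3p Σⱼ Vⱼ with
-- Vⱼ = ∏_{i≤j} (i−1−n)(i−½−n)/(i²−τi+τ²). Dropping the summand τ² from the
-- denominators gives a Chu–Vandermonde sum, equal to (−1)ⁿ. Modulo p³ the effect
-- of τ² is the same as in Fₙ(z) = Σⱼ ∏_{i≤j} (i−1−n)(i+n)/(i²+z) at z = τ²,
-- and (n²+z)(Fₙ + Fₙ₋₁) = 2z yields Fₙ = (−1)ⁿ + 2z Σₖ (−1)ⁿ⁻ᵏ/(k²+z).
-- By Fermat, Σ (−1)ᵏ/k² ≡ Σ (−1)ᵏ k^{p−3}, and this alternating power sum is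
-- half of (−1)ⁿ E_{p−3}(−n) ≡ (−1)ⁿ E_{p−3}(¼) modulo p.
-- The terms with n < k < p are divisible by p³ and cancel in the pairs
-- k ↔ n + p − k modulo p⁴.

open import Algebra.Bundles using (CommutativeRing; RawRing)
open import Algebra.Core using (Op₁; Op₂)
open import Algebra.Structures using (IsCommutativeRing)
import Algebra.Properties.Ring as RingProperties
import Algebra.Properties.Semiring.Mult as SemiringMult
import Algebra.Properties.Semiring.Exp as SemiringExp
import Algebra.Solver.Ring as RingSolver
open import Algebra.Solver.Ring.AlmostCommutativeRing using (fromCommutativeRing; _-Raw-AlmostCommutative⟶_)
open import Data.Empty.Irrelevant using (⊥-elim)
open import Data.Fin.Base as Fin using (Fin; toℕ)
import Data.Fin.Properties as Fin
open import Data.Integer.Base as ℤ using (ℤ; +_; -[1+_]; _⊖_; ∣_∣)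
open import Data.Integer.Divisibility.Signed as ℤ using (divides; ∣n⇒∣m*n; ∣m⇒∣m*n)
import Data.Integer.Properties as ℤ
import Data.Integer.Tactic.RingSolver as ℤSolver
open import Data.Maybe.Base as Maybe using (Maybe)
open import Data.Nat.Base as ℕ using (ℕ; zero; suc; _∸_; _!; s≤s; z<s; s<s)
open import Data.Nat.Coprimality as ℕ using (Coprime; coprime-divisor; coprime-Bézout)
import Data.Nat.Divisibility as ℕ
open import Data.Nat.DivMod as ℕ using (_%_)
open import Data.Nat.GCD using (module Bézout)
open import Data.Nat.Primality using (Prime; euclidsLemma; prime⇒irreducible; prime⇒nonTrivial)
import Data.Nat.Properties as ℕ
import Data.Nat.Tactic.RingSolver as ℕSolver
open import Data.Product.Base using (∃; _,_; _×_; proj₁; proj₂)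
open import Data.Rational.Base as ℚ using (ℚ; mkℚ; 0ℚ; 1ℚ; ↥_; ↧_; ↧ₙ_; fromℚᵘ; _/_)
import Data.Rational.Properties as ℚ
open import Data.Rational.Unnormalised.Base as ℚᵘ using (mkℚᵘ; *≡*)
import Data.Rational.Unnormalised.Properties as ℚᵘ
open import Data.Sum.Base using (_⊎_; inj₁; inj₂)
open import Data.Vec.Base using (lookup)
open import Relation.Binary.PropositionalEquality hiding (J; [_])
open import Relation.Nullary.Decidable using (yes; no; dec⇒maybe)
open import Relation.Nullary.Negation.Core using (¬_; contradiction)

-- Why τ = n + ¼: the parameters ¼ - ζτ and 1 + ζτ are well poised partners, as 1 + ¼ - (¼ - ζτ) = 1
-- + ζτ, and for ζ = 1 the upper one is -n, which ends the series. The other two enter only through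
-- their sum `σ` and product `π`, so no root of unity has to exist. Whipple's prefactor 4τ = 3p
-- supplies one power of p, so Σ `V` is needed only modulo p³. Both perturbation steps have one
-- shape: a term moves by a multiple of `d` (p³ for `T`, p² for `V`), and the cofactor of `d`
-- matters only modulo p. So the family may be exchanged for a simpler one with the same cofactor
-- modulo p, either exactly symmetric or exactly summable. `SameJet` expresses this exchange. The
-- core argument holds in every commutative ring in which 1, ..., p-1 and all 1 + pz are units, for
-- every function `E` with the difference equation of E_{p-3} that respects congruence modulo p.
-- Only afterwards is the ring taken to be the localization of ℤ at p. In such generality p may be a
-- zero divisor, so cofactors are carried as data and never obtained by division.

record Ring≡ : Set₁ where
  infixl 6 _+_
  infixl 7 _*_
  infix  8 -_
  field
    Carrier           : Set
    _+_ _*_           : Op₂ Carrier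
    -_                : Op₁ Carrier
    0# 1#             : Carrier
    isCommutativeRing : IsCommutativeRing _≡_ _+_ _*_ -_ 0# 1#

-- Finite sums and products in a commutative ring.

module RingLemmas (𝑹 : Ring≡) where

  open Ring≡ 𝑹 public renaming (Carrier to R)
  open IsCommutativeRing isCommutativeRing public
    using (+-comm; +-assoc; +-identityˡ; +-identityʳ; *-comm; *-assoc; *-identityˡ; *-identityʳ; zeroˡ; zeroʳ; -‿inverseʳ)

  commutativeRing : CommutativeRing _ _
  commutativeRing = record { isCommutativeRing = isCommutativeRing }

  open CommutativeRing commutativeRing using (ring; semiring)
  open SemiringMult semiring using (×-homo-+; ×1-homo-*) renaming (_×_ to _·_)
  open SemiringExp semiring public using (_^_)
  open RingProperties ring using (-‿+-comm; -‿distribˡ-*; -‿distribʳ-*; -‿involutive; -0#≈0#)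

  ι : ℕ → R
  ι n = n · 1#

  ι-+ : ∀ m n → ι (m ℕ.+ n) ≡ ι m + ι n
  ι-+ = ×-homo-+ 1#

  ι-* : ∀ m n → ι (m ℕ.* n) ≡ ι m * ι n
  ι-* = ×1-homo-*

  private
    -- Coefficient map of the ring solver: equality of integer coefficients is decidable, whereas
    -- equality in `R` need not be.
    ιℤ : ℤ → R
    ιℤ (+ n)    = ι n
    ιℤ -[1+ n ] = - ι (suc n)

    ιℤ-neg : ∀ i → ιℤ (ℤ.- i) ≡ - ιℤ i
    ιℤ-neg (+ zero)  = sym -0#≈0#
    ιℤ-neg (+ suc n) = refl
    ιℤ-neg -[1+ n ]  = sym (-‿involutive _)

    ιℤ-⊖ : ∀ m n → ιℤ (m ⊖ n) ≡ ι m + - ι n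
    ιℤ-⊖ m       zero    = sym (trans (cong (λ z → ι m + z) -0#≈0#) (+-identityʳ _))
    ιℤ-⊖ zero    (suc n) = sym (+-identityˡ _)
    ιℤ-⊖ (suc m) (suc n) = begin
      ιℤ (suc m ⊖ suc n)           ≡⟨ cong ιℤ (ℤ.[1+m]⊖[1+n]≡m⊖n m n) ⟩
      ιℤ (m ⊖ n)                   ≡⟨ ιℤ-⊖ m n ⟩
      ι m + - ι n                  ≡⟨ cong (_+ - ι n) (sym (+-identityˡ (ι m))) ⟩
      0# + ι m + - ι n             ≡⟨ cong (λ z → z + ι m + - ι n) (sym (-‿inverseʳ 1#)) ⟩
      1# + - 1# + ι m + - ι n      ≡⟨ cong (_+ - ι n) (trans (+-assoc _ _ _) (trans (cong (λ z → 1# + z) (+-comm _ _)) (sym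
          (+-assoc _ _ _)))) ⟩
      1# + ι m + - 1# + - ι n      ≡⟨ +-assoc _ _ _ ⟩
      1# + ι m + (- 1# + - ι n)    ≡⟨ cong (λ z → 1# + ι m + z) (-‿+-comm _ _) ⟩
      ι (suc m) + - ι (suc n)      ∎
      where open ≡-Reasoning

    ιℤ-+ : ∀ i j → ιℤ (i ℤ.+ j) ≡ ιℤ i + ιℤ j
    ιℤ-+ (+ m)    (+ n)    = ι-+ m n
    ιℤ-+ (+ m)    -[1+ n ] = ιℤ-⊖ m (suc n)
    ιℤ-+ -[1+ m ] (+ n)    = trans (ιℤ-⊖ n (suc m)) (+-comm _ _)
    ιℤ-+ -[1+ m ] -[1+ n ] = begin
      - ι (suc (suc (m ℕ.+ n)))       ≡⟨ cong (λ k → - ι (suc k)) (sym (ℕ.+-suc m n)) ⟩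
      - ι (suc m ℕ.+ suc n)           ≡⟨ cong -_ (ι-+ (suc m) (suc n)) ⟩
      - (ι (suc m) + ι (suc n))       ≡⟨ sym (-‿+-comm _ _) ⟩
      - ι (suc m) + - ι (suc n)       ∎
      where open ≡-Reasoning

    ιℤ-◃ : ∀ m n → ιℤ (ℤ.- (+ m) ℤ.* + n) ≡ - ι m * ι n
    ιℤ-◃ m n = begin
      ιℤ (ℤ.- (+ m) ℤ.* + n)   ≡⟨ cong ιℤ (sym (ℤ.neg-distribˡ-* (+ m) (+ n))) ⟩
      ιℤ (ℤ.- (+ m ℤ.* + n))   ≡⟨ ιℤ-neg (+ m ℤ.* + n) ⟩
      - ιℤ (+ m ℤ.* + n)       ≡⟨ cong (λ z → - ιℤ z) (sym (ℤ.pos-* m n)) ⟩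
      - ι (m ℕ.* n)            ≡⟨ cong -_ (ι-* m n) ⟩
      - (ι m * ι n)            ≡⟨ -‿distribˡ-* _ _ ⟩
      - ι m * ι n              ∎
      where open ≡-Reasoning

    ιℤ-* : ∀ i j → ιℤ (i ℤ.* j) ≡ ιℤ i * ιℤ j
    ιℤ-* (+ m)    (+ n)    = trans (cong ιℤ (sym (ℤ.pos-* m n))) (ι-* m n)
    ιℤ-* (+ m)    -[1+ n ] = trans (cong ιℤ (ℤ.*-comm (+ m) -[1+ n ])) (trans (ιℤ-◃ (suc n) m) (*-comm _ _))
    ιℤ-* -[1+ m ] (+ n)    = ιℤ-◃ (suc m) n
    ιℤ-* -[1+ m ] -[1+ n ] = begin
      ι (suc m ℕ.* suc n)         ≡⟨ ι-* (suc m) (suc n) ⟩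
      ι (suc m) * ι (suc n)       ≡⟨ sym (-‿involutive _) ⟩
      - - (ι (suc m) * ι (suc n)) ≡⟨ cong -_ (-‿distribʳ-* _ _) ⟩
      - (ι (suc m) * - ι (suc n)) ≡⟨ -‿distribˡ-* _ _ ⟩
      - ι (suc m) * - ι (suc n)   ∎
      where open ≡-Reasoning

    ℤ-rawRing : RawRing _ _
    ℤ-rawRing = record { Carrier = ℤ ; _≈_ = _≡_ ; _+_ = ℤ._+_ ; _*_ = ℤ._*_ ; -_ = ℤ.-_ ; 0# = + 0 ; 1# = + 1 }

    ιℤ-morphism : ℤ-rawRing -Raw-AlmostCommutative⟶ fromCommutativeRing commutativeRing
    ιℤ-morphism = record
      { ⟦_⟧    = ιℤ
      ; +-homo = ιℤ-+
      ; *-homo = ιℤ-*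
      ; -‿homo = ιℤ-neg
      ; 0-homo = refl
      ; 1-homo = +-identityʳ 1#
      }

    ιℤ-≟ : ∀ i j → Maybe (ιℤ i ≡ ιℤ j)
    ιℤ-≟ i j = Maybe.map (cong ιℤ) (dec⇒maybe (i ℤ.≟ j))

  open RingSolver ℤ-rawRing (fromCommutativeRing commutativeRing) ιℤ-morphism
    ιℤ-≟ public using (Polynomial; solve; _:=_; _:+_; _:*_; _:-_; :-_; _:^_; con)

  :# : ∀ {n} → ℕ → Polynomial n
  :# n = con (+ n)

  -- ι 1 is 1# + 0#, whereas this evaluates to 1#.
  :1 : ∀ {n} → Polynomial n
  :1 = :# 0 :^ 0

  -- x ≡ y because x − y is a linear combination of the hypotheses a − b.
  combination₁ : ∀ {x y a b} c → a ≡ b → x + - y ≡ c * (a + - b) → x ≡ y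
  combination₁ {x} {y} {a} c refl eq = begin
    x               ≡⟨ solve 2 (λ x y → x := x :- y :+ y) refl x y ⟩
    x + - y + y     ≡⟨ cong (_+ y) eq ⟩
    c * (a + - a) + y ≡⟨ solve 3 (λ c a y → c :* (a :- a) :+ y := y) refl c a y ⟩
    y               ∎
    where open ≡-Reasoning

  combination₂ : ∀ {x y a b a′ b′} c c′ → a ≡ b → a′ ≡ b′ → x + - y ≡ c * (a + - b) + c′ * (a′ + - b′) → x ≡ y
  combination₂ {a = a} {a′ = a′} c c′ refl refl eq =
    combination₁ c (refl {x = a}) (trans eq (solve 4 (λ c c′ a a′ → c :* (a :- a) :+ c′ :* (a′ :- a′) := c :*
        (a :- a)) refl c c′ a a′))

  combination₃ : ∀ {x y a b a′ b′ a″ b″} c c′ c″ → a ≡ b → a′ ≡ b′ → a″ ≡ b″ →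
          x + - y ≡ c * (a + - b) + c′ * (a′ + - b′) + c″ * (a″ + - b″) → x ≡ y
  combination₃ {a = a} {a′ = a′} {a″ = a″} c c′ c″ refl refl refl eq =
    combination₁ c (refl {x = a}) (trans eq (solve 6 (λ c c′ c″ a a′ a″ → c :* (a :- a) :+ c′ :* (a′ :- a′) :+ c″ :*
        (a″ :- a″) := c :* (a :- a)) refl c c′ c″ a a′ a″))

  ∑ : ℕ → (ℕ → R) → R
  ∑ zero    f = 0#
  ∑ (suc n) f = f 0 + ∑ n (λ i → f (suc i))

  ∏ : ℕ → (ℕ → R) → R
  ∏ zero    f = 1#
  ∏ (suc n) f = ∏ n f * f n

  ∑-cong : ∀ n {f g} → (∀ i → i ℕ.< n → f i ≡ g i) → ∑ n f ≡ ∑ n g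
  ∑-cong zero    eq = refl
  ∑-cong (suc n) eq = cong₂ _+_ (eq 0 z<s) (∑-cong n (λ i i<n → eq (suc i) (s<s i<n)))

  ∑-snoc : ∀ n f → ∑ (suc n) f ≡ ∑ n f + f n
  ∑-snoc zero    f = +-comm _ _
  ∑-snoc (suc n) f = trans (cong (λ z → f 0 + z) (∑-snoc n (λ i → f (suc i)))) (sym (+-assoc _ _ _))

  ∑-+ : ∀ n f g → ∑ n (λ i → f i + g i) ≡ ∑ n f + ∑ n g
  ∑-+ zero    f g = sym (+-identityˡ 0#)
  ∑-+ (suc n) f g = trans (cong (λ z → f 0 + g 0 + z) (∑-+ n _ _))
    (solve 4 (λ a b c d → (a :+ b) :+ (c :+ d) := (a :+ c) :+ (b :+ d)) refl _ _ _ _)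

  ∑-*ˡ : ∀ n c f → ∑ n (λ i → c * f i) ≡ c * ∑ n f
  ∑-*ˡ zero    c f = sym (zeroʳ c)
  ∑-*ˡ (suc n) c f = trans (cong (λ z → c * f 0 + z) (∑-*ˡ n c _))
    (solve 3 (λ a b c → a :* b :+ a :* c := a :* (b :+ c)) refl _ _ _)

  ∑-neg : ∀ n f → ∑ n (λ i → - f i) ≡ - ∑ n f
  ∑-neg zero    f = solve 0 (:# 0 := :- :# 0) refl
  ∑-neg (suc n) f = trans (cong (λ z → - f 0 + z) (∑-neg n _)) (solve 2 (λ a b → :- a :- b := :- (a :+ b)) refl _ _)

  ∑-zero : ∀ n {f} → (∀ i → i ℕ.< n → f i ≡ 0#) → ∑ n f ≡ 0#
  ∑-zero zero    eq = refl
  ∑-zero (suc n) eq = trans (cong₂ _+_ (eq 0 z<s) (∑-zero n (λ i i<n → eq (suc i) (s<s i<n)))) (+-identityˡ 0#)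

  ∑-split : ∀ m n f → ∑ (m ℕ.+ n) f ≡ ∑ m f + ∑ n (λ i → f (m ℕ.+ i))
  ∑-split zero    n f = sym (+-identityˡ _)
  ∑-split (suc m) n f = trans (cong (λ z → f 0 + z) (∑-split m n (λ i → f (suc i)))) (sym (+-assoc _ _ _))

  ∑-reverse : ∀ n f → ∑ n f ≡ ∑ n (λ i → f (n ∸ suc i))
  ∑-reverse zero    f = refl
  ∑-reverse (suc n) f = trans (∑-snoc n f) (trans (+-comm _ _) (cong (λ z → f n + z) (∑-reverse n f)))

  ∑-telescope : ∀ n f → ∑ n (λ k → f k + - f (suc k)) ≡ f 0 + - f n
  ∑-telescope zero    f = solve 1 (λ x → :# 0 := x :- x) refl _
  ∑-telescope (suc n) f = trans (cong (λ z → f 0 + - f 1 + z) (∑-telescope n (λ i → f (suc i))))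
    (solve 3 (λ x y z → x :- y :+ (y :- z) := x :- z) refl _ _ _)

  ∏-cong : ∀ n {f g} → (∀ i → i ℕ.< n → f i ≡ g i) → ∏ n f ≡ ∏ n g
  ∏-cong zero    eq = refl
  ∏-cong (suc n) eq = cong₂ _*_ (∏-cong n (λ i i<n → eq i (ℕ.m<n⇒m<1+n i<n))) (eq n ℕ.≤-refl)

  ∏-cons : ∀ n f → ∏ (suc n) f ≡ f 0 * ∏ n (λ i → f (suc i))
  ∏-cons zero    f = *-comm _ _
  ∏-cons (suc n) f = trans (cong (_* f (suc n)) (∏-cons n f)) (*-assoc _ _ _)

  ∏-* : ∀ n f g → ∏ n (λ i → f i * g i) ≡ ∏ n f * ∏ n g
  ∏-* zero    f g = sym (*-identityˡ 1#)
  ∏-* (suc n) f g = trans (cong (_* (f n * g n)) (∏-* n f g))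
    (solve 4 (λ a b c d → (a :* b) :* (c :* d) := (a :* c) :* (b :* d)) refl _ _ _ _)

  ∏-split : ∀ m n f → ∏ (m ℕ.+ n) f ≡ ∏ m f * ∏ n (λ i → f (m ℕ.+ i))
  ∏-split m zero    f = trans (cong (λ k → ∏ k f) (ℕ.+-identityʳ m)) (sym (*-identityʳ _))
  ∏-split m (suc n) f = trans (cong (λ k → ∏ k f) (ℕ.+-suc m n))
    (trans (cong (_* f (m ℕ.+ n)) (∏-split m n f)) (*-assoc _ _ _))

  ∏-reverse-top : ∀ k l f → ∏ l f * ∏ k (λ i → f (k ℕ.+ l ∸ suc i)) ≡ ∏ (k ℕ.+ l) f
  ∏-reverse-top zero    l f = *-identityʳ _
  ∏-reverse-top (suc k) l f = trans (cong (λ z → ∏ l f * z) (∏-cons k (λ i → f (k ℕ.+ l ∸ i))))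
    (trans (solve 3 (λ a b c → a :* (b :* c) := (a :* c) :* b) refl _ _ _)
      (cong (_* f (k ℕ.+ l)) (∏-reverse-top k l f)))

  ∏-one : ∀ n {f} → (∀ i → i ℕ.< n → f i ≡ 1#) → ∏ n f ≡ 1#
  ∏-one zero    eq = refl
  ∏-one (suc n) eq = trans (cong₂ _*_ (∏-one n (λ i i<n → eq i (ℕ.m<n⇒m<1+n i<n))) (eq n ℕ.≤-refl)) (*-identityˡ 1#)

  ∏-inverse : ∀ n {u v} → (∀ i → i ℕ.< n → u i * v i ≡ 1#) → ∏ n u * ∏ n v ≡ 1#
  ∏-inverse n eq = trans (sym (∏-* n _ _)) (∏-one n eq)

  *-cancelˡ-unit : ∀ {u v x y} → u * v ≡ 1# → u * x ≡ u * y → x ≡ y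
  *-cancelˡ-unit {u} {v} {x} {y} uv eq = combination₂ (y + - x) v uv eq
    (solve 4 (λ u v x y → x :- y := (y :- x) :* (u :* v :- :1) :+ v :* (u :* x :- u :* y)) refl u v x y)

  sgn : ℕ → R
  sgn zero    = 1#
  sgn (suc n) = - sgn n

  sgn-square : ∀ n → sgn n * sgn n ≡ 1#
  sgn-square zero    = *-identityˡ 1#
  sgn-square (suc n) = trans (solve 1 (λ x → :- x :* :- x := x :* x) refl _) (sgn-square n)

  -- For u i = i + 1 these are the binomial coefficients.

  module _ (u v : ℕ → R) (N : ℕ) (uv : ∀ i → i ℕ.< N → u i * v i ≡ 1#) where

    gbinomial : ℕ → R
    gbinomial k = ∏ k (λ i → u (N ∸ suc i) * v i)

    -- As for N!/(k! l!): multiplied by the unit `∏ k u * ∏ l u`, either side becomes `∏ N u`.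
    gbinomial-symmetric : ∀ k l → k ℕ.+ l ≡ N → gbinomial k ≡ gbinomial l
    gbinomial-symmetric k l k+l≡N = *-cancelˡ-unit units
      (trans (clear k l k+l≡N) (trans (sym (clear l k (trans (ℕ.+-comm l k) k+l≡N))) (cong (_* gbinomial l) (*-comm _ _))))
      where
      inv : ∀ k → k ℕ.≤ N → ∏ k u * ∏ k v ≡ 1#
      inv k k≤N = ∏-inverse k (λ i i<k → uv i (ℕ.<-≤-trans i<k k≤N))
      k≤N : k ℕ.≤ N
      k≤N = subst (k ℕ.≤_) k+l≡N (ℕ.m≤m+n k l)
      l≤N : l ℕ.≤ N
      l≤N = subst (l ℕ.≤_) k+l≡N (ℕ.m≤n+m l k)
      units : (∏ k u * ∏ l u) * (∏ k v * ∏ l v) ≡ 1#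
      units = trans (solve 4 (λ a b c d → (a :* b) :* (c :* d) := (a :* c) :* (b :* d)) refl _ _ _ _)
        (trans (cong₂ _*_ (inv k k≤N) (inv l l≤N)) (*-identityˡ 1#))
      clear : ∀ k l → k ℕ.+ l ≡ N → (∏ k u * ∏ l u) * gbinomial k ≡ ∏ N u
      clear k l refl = begin
        (∏ k u * ∏ l u) * gbinomial k
          ≡⟨ cong (λ z → (∏ k u * ∏ l u) * z) (∏-* k _ _) ⟩
        (∏ k u * ∏ l u) * (∏ k (λ i → u (N ∸ suc i)) * ∏ k v)
          ≡⟨ solve 4 (λ a b c d → (a :* b) :* (c :* d) := (a :* d) :* (b :* c)) refl _ _ _ _ ⟩
        (∏ k u * ∏ k v) * (∏ l u * ∏ k (λ i → u (N ∸ suc i)))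
          ≡⟨ cong₂ _*_ (inv k (ℕ.m≤m+n k l)) (∏-reverse-top k l u) ⟩
        1# * ∏ N u
          ≡⟨ *-identityˡ _ ⟩
        ∏ N u ∎
        where open ≡-Reasoning

  -- For k + l = N the factor 2k - N = k - l changes sign under k ↔ l, so the sum equals its own
  -- negative, and 2 is a unit.
  antisymmetric-∑ : ∀ {½} → ι 2 * ½ ≡ 1# → ∀ N (f : ℕ → R) → (∀ k l → k ℕ.+ l ≡ N → f k ≡ f l) →
                    ∑ (suc N) (λ k → (ι 2 * ι k + - ι N) * f k) ≡ 0#
  antisymmetric-∑ half N f symm = *-cancelˡ-unit half (trans double (sym (zeroʳ _)))
    where
    g : ℕ → R
    g k = (ι 2 * ι k + - ι N) * f k
    S : R
    S = ∑ (suc N) g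
    cancel : ∀ i → i ℕ.< suc N → g i + g (N ∸ i) ≡ 0#
    cancel i (s≤s i≤N) = begin
      (ι 2 * ι i + - ι N) * f i + (ι 2 * ι (N ∸ i) + - ι N) * f (N ∸ i)
        ≡⟨ cong₂ (λ x y → (ι 2 * ι i + - x) * f i + (ι 2 * ι (N ∸ i) + - x) * y)
             (trans (cong ι (sym i+l≡N)) (ι-+ i (N ∸ i))) (symm (N ∸ i) i (trans (ℕ.+-comm (N ∸ i) i) i+l≡N)) ⟩
      (ι 2 * ι i + - (ι i + ι (N ∸ i))) * f i + (ι 2 * ι (N ∸ i) + - (ι i + ι (N ∸ i))) * f i
        ≡⟨ solve 3 (λ i l f → (:# 2 :* i :- (i :+ l)) :* f :+ (:# 2 :* l :- (i :+ l)) :* f := :# 0) refl (ι i) (ι (N ∸ i)) (f i) ⟩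
      0# ∎
      where
      open ≡-Reasoning
      i+l≡N : i ℕ.+ (N ∸ i) ≡ N
      i+l≡N = ℕ.m+[n∸m]≡n i≤N
    double : ι 2 * S ≡ 0#
    double = begin
      ι 2 * S     ≡⟨ solve 1 (λ s → :# 2 :* s := s :+ s) refl S ⟩
      S + S       ≡⟨ cong (λ z → S + z) (∑-reverse (suc N) g) ⟩
      S + ∑ (suc N) (λ k → g (N ∸ k)) ≡⟨ sym (∑-+ (suc N) g (λ k → g (N ∸ k))) ⟩
      ∑ (suc N) (λ k → g k + g (N ∸ k)) ≡⟨ ∑-zero (suc N) cancel ⟩
      0# ∎
      where open ≡-Reasoning

-- Exact summations: Whipple, Chu-Vandermonde, and a deformed Legendre sum.

module IdentityLemmas (𝑹 : Ring≡) where
  open RingLemmas 𝑹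

  -- Abel summation. The upper boundary term `G (suc n) * Q n` vanishes in the application, where
  -- `G` terminates.
  ∑-by-parts : ∀ n (G Q : ℕ → R) → ∑ (suc n) (λ k → (G k + - G (suc k)) * Q k) + G (suc n) * Q n
             ≡ G 0 * Q 0 + ∑ n (λ k → G (suc k) * (Q (suc k) + - Q k))
  ∑-by-parts zero    G Q = solve 3 (λ a b q → (a :- b) :* q :+ :# 0 :+ b :* q := a :* q :+ :# 0) refl _ _ _
  ∑-by-parts (suc n) G Q = begin
    (G 0 + - G 1) * Q 0 + X + G (suc (suc n)) * Q (suc n)
      ≡⟨ solve 5 (λ a b q x y → (a :- b) :* q :+ x :+ y := (a :- b) :* q :+ (x :+ y)) refl (G 0) (G 1) (Q 0) X _ ⟩
    (G 0 + - G 1) * Q 0 + (X + G (suc (suc n)) * Q (suc n))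
      ≡⟨ cong (λ z → (G 0 + - G 1) * Q 0 + z) (∑-by-parts n (λ k → G (suc k)) (λ k → Q (suc k))) ⟩
    (G 0 + - G 1) * Q 0 + (G 1 * Q 1 + Y)
      ≡⟨ solve 5 (λ a b q r y → (a :- b) :* q :+ (b :* r :+ y) := a :* q :+ (b :* (r :- q) :+ y)) refl (G 0) (G 1) (Q 0) (Q 1) Y ⟩
    G 0 * Q 0 + (G 1 * (Q 1 + - Q 0) + Y) ∎
    where
    open ≡-Reasoning
    X Y : R
    X = ∑ (suc n) (λ k → (G (suc k) + - G (suc (suc k))) * Q (suc k))
    Y = ∑ n (λ k → G (suc (suc k)) * (Q (suc (suc k)) + - Q (suc k)))

  -- With b + c = σ and bc = π, this is Whipple's transformation of the very
  -- well poised ₆F₅(−1) with parameters a, b, c, 1, −n into a terminating ₃F₂(1).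
  -- I i and J i are the inverses of (1+a−b+i)(1+a−c+i) and of 1+a+n+i.
  module _ (σ π : R) where

    whipple-denominator : R → R
    whipple-denominator x = x * x + - (σ * x) + π

    module _ (n : ℕ) (a : R) (I J : ℕ → R) where

      whipple-weight whipple-quotient whipple-term : ℕ → R
      whipple-weight   k = ∏ k (λ i → (ι n + - ι i) * J i)
      whipple-quotient k = ∏ k (λ i → (ι i * ι i + σ * ι i + π) * I i)
      whipple-term     k = ∏ k (λ i → (ι i + - ι n) * (1# + a + - σ + ι i) * I i)

    whipple : ∀ n a (I J : ℕ → R) →
      (∀ i → i ℕ.< n → whipple-denominator (1# + a + ι i) * I i ≡ 1#) →
      (∀ i → i ℕ.< n → (1# + a + ι n + ι i) * J i ≡ 1#) →
      ∑ (suc n) (λ k → (a + ι 2 * ι k) * (whipple-weight n a I J k * whipple-quotient n a I J k))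
      ≡ (a + ι n) * ∑ (suc n) (whipple-term n a I J)
    whipple zero a I J DI KJ = solve 1 (λ a → (a :+ :# 2 :* :# 0) :* (:1 :* :1) :+ :# 0 := (a :+ :# 0) :* (:1 :+ :# 0)) refl a
    -- Induction by summation by parts. The well poised factor times `ω` is the difference of `G`,
    -- and the differences of `Q` produce the factor 1 + a + 2k. What remains is the same sum for
    -- `n` and `1# + a`, with `I` shifted; `J` stays, because 1 + a + (n + 1) = 1 + (1 + a) + n.
    whipple (suc n) a I J DI KJ = begin
      ∑ (suc (suc n)) (λ k → (a + ι 2 * ι k) * (ω k * Q k))
        ≡⟨ ∑-cong (suc (suc n)) gosper ⟩
      ∑ (suc (suc n)) (λ k → (G k + - G (suc k)) * Q k)
        ≡⟨ combination₂ 1# (- Q (suc n)) (∑-by-parts (suc n) G Q) G-end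
             (solve 5 (λ s e q r t → s :- (r :+ t) := :1 :* (s :+ e :* q :- (r :+ t)) :+ :- q :* (e :- :# 0)) refl
                (∑ (suc (suc n)) (λ k → (G k + - G (suc k)) * Q k)) (G (suc (suc n))) (Q (suc n)) (G 0 * Q 0)
                (∑ (suc n) (λ k → G (suc k) * (Q (suc k) + - Q k)))) ⟩
      G 0 * Q 0 + ∑ (suc n) (λ k → G (suc k) * (Q (suc k) + - Q k))
        ≡⟨ cong (λ z → G 0 * Q 0 + z) (trans (∑-cong (suc n) step) (∑-*ˡ (suc n) c (λ k → (1# + a + ι 2 * ι k) *
            (ω′ k * Q′ k)))) ⟩
      G 0 * Q 0 + c * ∑ (suc n) (λ k → (1# + a + ι 2 * ι k) * (ω′ k * Q′ k))
        ≡⟨ cong (λ z → G 0 * Q 0 + c * z) (whipple n (1# + a) (λ i → I (suc i)) J DI′ KJ′) ⟩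
      G 0 * Q 0 + c * ((1# + a + ι n) * ∑ (suc n) V′)
        ≡⟨ solve 4 (λ a n c s → (a :+ (:1 :+ n) :+ :# 0) :* :1 :* :1 :+ c :* ((:1 :+ a :+ n) :* s) := (a :+ (:1 :+ n)) :*
            (:1 :+ c :* s)) refl a (ι n) c (∑ (suc n) V′) ⟩
      (a + ι (suc n)) * (1# + c * ∑ (suc n) V′)
        ≡⟨ cong (λ z → (a + ι (suc n)) * (1# + z)) (trans (sym (∑-*ˡ (suc n) c V′)) (∑-cong (suc n) V-shift)) ⟩
      (a + ι (suc n)) * ∑ (suc (suc n)) V ∎
      where
      open ≡-Reasoning
      ω Q V ω′ Q′ V′ G : ℕ → R
      ω = whipple-weight (suc n) a I J
      Q = whipple-quotient (suc n) a I J
      V = whipple-term (suc n) a I J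
      ω′ = whipple-weight n (1# + a) (λ i → I (suc i)) J
      Q′ = whipple-quotient n (1# + a) (λ i → I (suc i)) J
      V′ = whipple-term n (1# + a) (λ i → I (suc i)) J
      G k = (a + ι (suc n) + ι k) * ω k
      c : R
      c = - (ι (suc n) * (1# + a + - σ) * I 0)

      DI′ : ∀ i → i ℕ.< n → whipple-denominator (1# + (1# + a) + ι i) * I (suc i) ≡ 1#
      DI′ i i<n = trans (cong (λ x → whipple-denominator x * I (suc i)) (solve 2 (λ a i → :1 :+ (:1 :+ a) :+ i := :1 :+ a :+
          (:1 :+ i)) refl a (ι i)))
        (DI (suc i) (s<s i<n))
      KJ′ : ∀ i → i ℕ.< n → (1# + (1# + a) + ι n + ι i) * J i ≡ 1#
      KJ′ i i<n = trans (cong (_* J i) (solve 3 (λ a n i → :1 :+ (:1 :+ a) :+ n :+ i := :1 :+ a :+ (:1 :+ n) :+ i) refl a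
          (ι n) (ι i)))
        (KJ i (ℕ.m<n⇒m<1+n i<n))

      ω-stop : ω (suc (suc n)) ≡ 0#
      ω-stop = solve 3 (λ w n j → w :* ((:1 :+ n :- (:1 :+ n)) :* j) := :# 0) refl (ω (suc n)) (ι n) (J (suc n))
      G-end : G (suc (suc n)) ≡ 0#
      G-end = trans (cong ((a + ι (suc n) + ι (suc (suc n))) *_) ω-stop) (zeroʳ _)

      G-suc : ∀ k → k ℕ.< suc n → G (suc k) ≡ ω k * (ι (suc n) + - ι k)
      G-suc k k<n = combination₁ (ω k * (ι (suc n) + - ι k)) (KJ k k<n)
        (solve 5 (λ a n k w j → (a :+ n :+ (:1 :+ k)) :* (w :* ((n :- k) :* j)) :- w :* (n :- k)
                               := w :* (n :- k) :* ((:1 :+ a :+ n :+ k) :* j :- :1)) refl a (ι (suc n)) (ι k) (ω k) (J k))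

      gosper : ∀ k → k ℕ.< suc (suc n) → (a + ι 2 * ι k) * (ω k * Q k) ≡ (G k + - G (suc k)) * Q k
      gosper k (s≤s k≤1+n) with ℕ.m≤n⇒m<n∨m≡n k≤1+n
      ... | inj₁ k<n = trans
        (solve 5 (λ a n k w q → (a :+ :# 2 :* k) :* (w :* q) := ((a :+ n :+ k) :* w :- w :* (n :- k)) :* q) refl a (ι
            (suc n)) (ι k) (ω k) (Q k))
        (cong (λ z → (G k + - z) * Q k) (sym (G-suc k k<n)))
      ... | inj₂ refl = trans
        (solve 4 (λ a n w q → (a :+ :# 2 :* n) :* (w :* q) := ((a :+ n :+ n) :* w :- :# 0) :* q) refl a (ι (suc n)) (ω k) (Q k))
        (cong (λ z → (G k + - z) * Q k) (sym G-end))

      ω-shift : ∀ k → ω k * (ι (suc n) + - ι k) ≡ ι (suc n) * ω′ k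
      ω-shift zero    = solve 1 (λ n → :1 :* (n :- :# 0) := n :* :1) refl (ι (suc n))
      ω-shift (suc k) = trans
        (solve 4 (λ n k w j → w :* ((:1 :+ n :- k) :* j) :* (:1 :+ n :- (:1 :+ k)) := w :* (:1 :+ n :- k) :*
            ((n :- k) :* j)) refl (ι n) (ι k) (ω k) (J k))
        (trans (cong (_* ((ι n + - ι k) * J k)) (ω-shift k)) (*-assoc _ _ _))
      Q-shift : ∀ k → Q k * I k ≡ I 0 * Q′ k
      Q-shift zero    = *-comm _ _
      Q-shift (suc k) = trans
        (solve 4 (λ q b i j → q :* (b :* i) :* j := q :* i :* (b :* j)) refl (Q k) _ (I k) (I (suc k)))
        (trans (cong (_* ((ι k * ι k + σ * ι k + π) * I (suc k))) (Q-shift k)) (*-assoc _ _ _))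

      step : ∀ k → k ℕ.< suc n → G (suc k) * (Q (suc k) + - Q k) ≡ c * ((1# + a + ι 2 * ι k) * (ω′ k * Q′ k))
      step k k<n = begin
        G (suc k) * (Q (suc k) + - Q k)
          -- With x = 1 + a + k, the numerator of the quotient minus its denominator is (k² + σk +
          -- π) - (x² - σx + π) = -(1 + a - σ)(x + k), and x + k is the well poised factor for 1 +
          -- a.
          ≡⟨ cong₂ _*_ (G-suc k k<n) (combination₁ (Q k) (DI k k<n)
               (solve 6 (λ a k σ π q i → q :* ((k :* k :+ σ :* k :+ π) :* i) :- q :- (:- (q :* i) :* (:1 :+ a :- σ) :*
                   (:1 :+ a :+ :# 2 :* k))
                  := q :* (((:1 :+ a :+ k) :* (:1 :+ a :+ k) :- σ :* (:1 :+ a :+ k) :+ π) :* i :- :1)) refl a (ι k) σ π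
                      (Q k) (I k))) ⟩
        ω k * (ι (suc n) + - ι k) * (- (Q k * I k) * (1# + a + - σ) * (1# + a + ι 2 * ι k))
          ≡⟨ cong₂ (λ x y → x * (- y * (1# + a + - σ) * (1# + a + ι 2 * ι k))) (ω-shift k) (Q-shift k) ⟩
        ι (suc n) * ω′ k * (- (I 0 * Q′ k) * (1# + a + - σ) * (1# + a + ι 2 * ι k))
          ≡⟨ solve 6 (λ n w i q s t → n :* w :* (:- (i :* q) :* s :* t) := :- (n :* s :* i) :* (t :* (w :* q))) refl (ι
              (suc n)) (ω′ k) (I 0) (Q′ k) (1# + a + - σ) (1# + a + ι 2 * ι k) ⟩
        c * ((1# + a + ι 2 * ι k) * (ω′ k * Q′ k)) ∎

      V-shift : ∀ j → j ℕ.< suc n → c * V′ j ≡ V (suc j)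
      V-shift j _ = sym (trans (∏-cons j _) (cong₂ _*_
        (solve 4 (λ n a σ i → (:# 0 :- n) :* (:1 :+ a :- σ :+ :# 0) :* i := :- (n :* (:1 :+ a :- σ) :* i)) refl (ι
            (suc n)) a σ (I 0))
        (∏-cong j (λ i _ → cong (_* I (suc i)) (solve 4 (λ n a σ i → (:1 :+ i :- (:1 :+ n)) :* (:1 :+ a :- σ :+
            (:1 :+ i)) := (i :- n) :* (:1 :+ (:1 :+ a) :- σ :+ i)) refl (ι n) a σ (ι i))))))

  -- With `r i` = 1/(i+1) this is (-n)_j/j!, the binomial coefficient of n over j with sign (-1)^j;
  -- hence the minus sign in its Pascal rule.
  falling-ratio : (ℕ → R) → ℕ → ℕ → R
  falling-ratio r n j = ∏ j (λ i → (ι i + - ι n) * r i)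

  falling-ratio-pascal : ∀ {r n j} → ι (suc j) * r j ≡ 1# →
    falling-ratio r (suc n) (suc j) ≡ falling-ratio r n (suc j) + - falling-ratio r n j
  falling-ratio-pascal {r} {n} {j} unit = combination₁ (- falling-ratio r n j) unit (begin
    falling-ratio r (suc n) (suc j) + - (falling-ratio r n j * ((ι j + - ι n) * r j) + - falling-ratio r n j)
      ≡⟨ cong (λ z → z + - (falling-ratio r n j * ((ι j + - ι n) * r j) + - falling-ratio r n j)) (shift j) ⟩
    - ι (suc n) * falling-ratio r n j * r j + - (falling-ratio r n j * ((ι j + - ι n) * r j) + - falling-ratio r n j)
      ≡⟨ solve 4 (λ n j k r → :- (:1 :+ n) :* k :* r :- (k :* ((j :- n) :* r) :- k) := :- k :* ((:1 :+ j) :* r :- :1)) refl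
          (ι n) (ι j) (falling-ratio r n j) (r j) ⟩
    - falling-ratio r n j * (ι (suc j) * r j + - 1#) ∎)
    where
    open ≡-Reasoning
    shift : ∀ j → falling-ratio r (suc n) (suc j) ≡ - ι (suc n) * falling-ratio r n j * r j
    shift zero    = solve 2 (λ n r → :1 :* ((:# 0 :- (:1 :+ n)) :* r) := :- (:1 :+ n) :* :1 :* r) refl (ι n) (r 0)
    shift (suc j) = trans (cong (_* ((ι (suc j) + - ι (suc n)) * r (suc j))) (shift j))
      (solve 5 (λ n j k r s → :- (:1 :+ n) :* k :* r :* ((:1 :+ j :- (:1 :+ n)) :* s) := :- (:1 :+ n) :* (k :*
          ((j :- n) :* r)) :* s) refl (ι n) (ι j) (falling-ratio r n j) (r j) (r (suc j)))

  -- Pascal's rule splits the sum for n + 1 into the sums for n at (b, c) and at (b + 1, c + 1).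
  -- Since c - b is the same in both, their values share the product of `X`, and the rest is an
  -- identity between the `e`'s.
  chu-vandermonde : ∀ n b c {r e : ℕ → R} →
    (∀ i → i ℕ.< n → ι (suc i) * r i ≡ 1#) → (∀ i → i ℕ.< n → (c + ι i) * e i ≡ 1#) →
    ∑ (suc n) (λ j → falling-ratio r n j * ∏ j (λ i → (b + ι i) * e i)) ≡ ∏ n (λ i → (c + - b + ι i) * e i)
  chu-vandermonde zero    b c runit eunit = solve 0 (:1 :* :1 :+ :# 0 := :1) refl
  chu-vandermonde (suc n) b c {r} {e} runit eunit = begin
    1# * 1# + ∑ (suc n) (λ j → κ (suc n) (suc j) * β (suc j))
      ≡⟨ cong (λ z → 1# * 1# + z) (∑-cong (suc n) split) ⟩
    1# * 1# + ∑ (suc n) (λ j → κ n (suc j) * β (suc j) + - (b * e 0) * (κ n j * β′ j))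
      ≡⟨ trans (cong (λ z → 1# * 1# + z) (∑-+ (suc n) (λ j → κ n (suc j) * β (suc j)) (λ j → - (b * e 0) * (κ n j * β′ j))))
          (sym (+-assoc _ _ _)) ⟩
    ∑ (suc (suc n)) (λ j → κ n j * β j) + ∑ (suc n) (λ j → - (b * e 0) * (κ n j * β′ j))
      ≡⟨ cong₂ _+_ (trans (∑-snoc (suc n) (λ j → κ n j * β j)) (trans (cong (λ z → ∑ (suc n)
          (λ j → κ n j * β j) + z) vanish) (+-identityʳ _))) (∑-*ˡ (suc n) (- (b * e 0)) (λ j → κ n j * β′ j)) ⟩
    ∑ (suc n) (λ j → κ n j * β j) + - (b * e 0) * ∑ (suc n) (λ j → κ n j * β′ j)
      ≡⟨ cong₂ (λ x y → x + - (b * e 0) * y)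
           (chu-vandermonde n b c (λ i i<n → runit i (ℕ.m<n⇒m<1+n i<n)) (λ i i<n → eunit i (ℕ.m<n⇒m<1+n i<n)))
           (trans (chu-vandermonde n (1# + b) (1# + c) (λ i i<n → runit i (ℕ.m<n⇒m<1+n i<n))
                    (λ i i<n → trans (cong (_* e (suc i)) (solve 2 (λ c i → :1 :+ c :+ i := c :+ (:1 :+ i)) refl c (ι i)))
                        (eunit (suc i) (s<s i<n))))
                  (∏-cong n (λ i _ → cong (_* e (suc i)) (solve 3 (λ b c i → :1 :+ c :-
                      (:1 :+ b) :+ i := c :- b :+ i) refl b c (ι i))))) ⟩
    ∏ n (λ i → X i * e i) + - (b * e 0) * ∏ n (λ i → X i * e (suc i))
      ≡⟨ cong₂ (λ x y → x + - (b * e 0) * y) (∏-* n X e) (∏-* n X (λ i → e (suc i))) ⟩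
    ∏ n X * ∏ n e + - (b * e 0) * (∏ n X * ∏ n (λ i → e (suc i)))
      ≡⟨ combination₂ (∏ n X * ∏ n e) (b * ∏ n X) (sym (eunit n ℕ.≤-refl)) (∏-cons n e)
           (solve 8 (λ b c n x E e₀ E′ eₙ → (x :* E :+ :- (b :* e₀) :* (x :* E′)) :- (x :* E) :* ((c :- b :+ n) :* eₙ)
              := x :* E :* (:1 :- (c :+ n) :* eₙ) :+ b :* x :* (E :* eₙ :- e₀ :* E′)) refl b c (ι n) (∏ n X) (∏ n e) (e 0)
                  (∏ n (λ i → e (suc i))) (e n)) ⟩
    (∏ n X * ∏ n e) * (X n * e n)
      ≡⟨ cong (_* (X n * e n)) (sym (∏-* n X e)) ⟩
    ∏ (suc n) (λ i → X i * e i) ∎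
    where
    open ≡-Reasoning
    κ : ℕ → ℕ → R
    κ = falling-ratio r
    β β′ X : ℕ → R
    β  j = ∏ j (λ i → (b + ι i) * e i)
    β′ j = ∏ j (λ i → (1# + b + ι i) * e (suc i))
    X i = c + - b + ι i
    vanish : κ n (suc n) * β (suc n) ≡ 0#
    vanish = solve 4 (λ k n r β → k :* ((n :- n) :* r) :* β := :# 0) refl (κ n n) (ι n) (r n) (β (suc n))
    β-shift : ∀ j → β (suc j) ≡ b * e 0 * β′ j
    β-shift j = trans (∏-cons j (λ i → (b + ι i) * e i)) (cong₂ _*_ (cong (_* e 0) (+-identityʳ b))
      (∏-cong j (λ i _ → cong (_* e (suc i)) (solve 2 (λ b i → b :+ (:1 :+ i) := :1 :+ b :+ i) refl b (ι i)))))
    split : ∀ j → j ℕ.< suc n → κ (suc n) (suc j) * β (suc j) ≡ κ n (suc j) * β (suc j) + - (b * e 0) * (κ n j * β′ j)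
    split j j<n = trans (cong (_* β (suc j)) (falling-ratio-pascal {r} {n} {j} (runit j j<n)))
      (combination₁ (- κ n j) (β-shift j) (solve 5 (λ k′ k β be β′ → (k′ :- k) :* β :- (k′ :* β :+ :- be :*
          (k :* β′)) := :- k :* (β :- be :* β′)) refl (κ n (suc j)) (κ n j) (β (suc j)) (b * e 0) (β′ j)))

  -- The last summand always has sign +. With `w i` = φ(i+1) this is the sum of (-1)^(n-k) φ(k) over
  -- 1 ≤ k ≤ n.
  alternating-sum : ℕ → (ℕ → R) → R
  alternating-sum zero    w = 0#
  alternating-sum (suc n) w = - alternating-sum n w + w n

  -- At z = 0 the terms are those of the Legendre polynomial value Pₙ(−1).
  module _ (z : R) (w : ℕ → R) where

    legendre-term : ℕ → ℕ → R
    legendre-term n j = ∏ j (λ i → (ι i + - ι n) * (1# + ι n + ι i) * w i)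

    legendre-sum : ℕ → R
    legendre-sum n = ∑ (suc n) (legendre-term n)

    -- With N = m + 1, the terms for N and for m are `g j` times (N + j)/N and (N - j)/N, so they
    -- add up to 2 `g j`. The sum of `g` telescopes through `h`, and only h₀ = z survives.
    legendre-sum-step : ∀ m {r} → ι (suc m) * r ≡ 1# → (∀ i → i ℕ.≤ m → (ι (suc i) * ι (suc i) + z) * w i ≡ 1#) →
      legendre-sum (suc m) ≡ - legendre-sum m + ι 2 * z * w m
    legendre-sum-step m {r} unit wunit =
      combination₃ (legendre-sum (suc m) + legendre-sum m) ((N * N + z) * w m) (ι 2 * w m) (sym (wunit m ℕ.≤-refl)) sum-f sum-g
        (solve 6 (λ n z w f f′ g → f :- (:- f′ :+ :# 2 :* z :* w)
          := (f :+ f′) :* (:1 :- (n :* n :+ z) :* w) :+ (n :* n :+ z) :* w :* (f :+ f′ :- :# 2 :* g) :+ :# 2 :* w :*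
              ((n :* n :+ z) :* g :- z))
          refl N z (w m) (legendre-sum (suc m)) (legendre-sum m) (∑ (suc (suc m)) g))
      where
      open ≡-Reasoning
      N : R
      N = ι (suc m)
      f f′ g h : ℕ → R
      f  = legendre-term (suc m)
      f′ = legendre-term m
      g j = ∏ j (λ i → (ι i * ι i + - (N * N)) * w i)
      h j = g j * (ι j * ι j + z)
      f-g : ∀ j → N * f j ≡ g j * (N + ι j)
      f-g zero    = solve 1 (λ n → n :* :1 := :1 :* (n :+ :# 0)) refl N
      f-g (suc j) = combination₁ ((ι j + - N) * (1# + N + ι j) * w j) (f-g j)
        (solve 5 (λ n j f g w → n :* (f :* ((j :- n) :* (:1 :+ n :+ j) :* w)) :- (g :* ((j :* j :- n :* n) :* w)) :* (n :+
            (:1 :+ j))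
          := (j :- n) :* (:1 :+ n :+ j) :* w :* (n :* f :- g :* (n :+ j))) refl N (ι j) (f j) (g j) (w j))
      f′-g : ∀ j → N * f′ j ≡ g j * (N + - ι j)
      f′-g zero    = solve 1 (λ n → n :* :1 := :1 :* (n :- :# 0)) refl N
      f′-g (suc j) = combination₁ ((ι j + - ι m) * (1# + ι m + ι j) * w j) (f′-g j)
        (solve 5 (λ m j f g w → (:1 :+ m) :* (f :* ((j :- m) :* (:1 :+ m :+ j) :* w)) :- (g :* ((j :* j :- (:1 :+ m) :*
            (:1 :+ m)) :* w)) :* (:1 :+ m :- (:1 :+ j))
          := (j :- m) :* (:1 :+ m :+ j) :* w :* ((:1 :+ m) :* f :- g :* (:1 :+ m :- j))) refl (ι m) (ι j) (f′ j) (g j) (w j))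
      f+f′ : ∀ j → f j + f′ j ≡ ι 2 * g j
      f+f′ j = *-cancelˡ-unit unit (combination₂ 1# 1# (f-g j) (f′-g j)
        (solve 5 (λ n j f f′ g → n :* (f :+ f′) :- n :* (:# 2 :* g) := :1 :* (n :* f :- g :* (n :+ j)) :+ :1 :*
            (n :* f′ :- g :* (n :- j))) refl N (ι j) (f j) (f′ j) (g j)))
      sum-f : legendre-sum (suc m) + legendre-sum m ≡ ι 2 * ∑ (suc (suc m)) g
      sum-f = begin
        ∑ (suc (suc m)) f + ∑ (suc m) f′
          ≡⟨ cong (λ y → ∑ (suc (suc m)) f + y) (sym (trans (∑-snoc (suc m) f′) (trans (cong (λ y → ∑ (suc m) f′ + y)
               (solve 4 (λ k m n w → k :* ((m :- m) :* n :* w) := :# 0) refl (f′ m) (ι m) (1# + ι m + ι m) (w m)))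
                   (+-identityʳ _)))) ⟩
        ∑ (suc (suc m)) f + ∑ (suc (suc m)) f′
          ≡⟨ sym (∑-+ (suc (suc m)) f f′) ⟩
        ∑ (suc (suc m)) (λ j → f j + f′ j)
          ≡⟨ trans (∑-cong (suc (suc m)) (λ j _ → f+f′ j)) (∑-*ˡ (suc (suc m)) (ι 2) g) ⟩
        ι 2 * ∑ (suc (suc m)) g ∎
      gosper : ∀ j → j ℕ.< suc m → (N * N + z) * g j ≡ h j + - h (suc j)
      gosper j (s≤s j≤m) = combination₁ (g j * (ι j * ι j + - (N * N))) (wunit j j≤m)
        (solve 5 (λ n j g z w → (n :* n :+ z) :* g :- (g :* (j :* j :+ z) :- g :* ((j :* j :- n :* n) :* w) :* ((:1 :+ j) :*
            (:1 :+ j) :+ z))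
          := g :* (j :* j :- n :* n) :* (((:1 :+ j) :* (:1 :+ j) :+ z) :* w :- :1)) refl N (ι j) (g j) z (w j))
      sum-g : (N * N + z) * ∑ (suc (suc m)) g ≡ z
      sum-g = begin
        (N * N + z) * ∑ (suc (suc m)) g
          -- The term j = N is kept apart: telescoping past it would need an inverse `w (suc m)`, on
          -- which nothing is assumed. It cancels against the end `h (suc m)`.
          ≡⟨ cong ((N * N + z) *_) (∑-snoc (suc m) g) ⟩
        (N * N + z) * (∑ (suc m) g + g (suc m))
          ≡⟨ solve 3 (λ a b c → a :* (b :+ c) := a :* b :+ c :* a) refl _ _ _ ⟩
        (N * N + z) * ∑ (suc m) g + h (suc m)
          ≡⟨ cong (_+ h (suc m)) (trans (sym (∑-*ˡ (suc m) (N * N + z) g)) (trans (∑-cong (suc m) gosper) (∑-telescope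
              (suc m) h))) ⟩
        h 0 + - h (suc m) + h (suc m)
          ≡⟨ solve 2 (λ z x → :1 :* (:# 0 :* :# 0 :+ z) :- x :+ x := z) refl z (h (suc m)) ⟩
        z ∎

    legendre-sum-closed : ∀ n {r : ℕ → R} → (∀ i → i ℕ.< n → ι (suc i) * r i ≡ 1#) →
      (∀ i → i ℕ.< n → (ι (suc i) * ι (suc i) + z) * w i ≡ 1#) →
      legendre-sum n ≡ sgn n + ι 2 * z * alternating-sum n w
    legendre-sum-closed zero    runit wunit = solve 1 (λ z → :1 :+ :# 0 := :1 :+ :# 2 :* z :* :# 0) refl z
    legendre-sum-closed (suc n) {r} runit wunit = trans
      (legendre-sum-step n {r n} (runit n ℕ.≤-refl) (λ i i≤n → wunit i (s≤s i≤n)))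
      (trans (cong (λ x → - x + ι 2 * z * w n)
               (legendre-sum-closed n {r} (λ i i<n → runit i (ℕ.m<n⇒m<1+n i<n)) (λ i i<n → wunit i (ℕ.m<n⇒m<1+n i<n))))
        (solve 4 (λ s z a w → :- (s :+ :# 2 :* z :* a) :+ :# 2 :* z :* w := :- s :+ :# 2 :* z :* (:- a :+ w)) refl (sgn n) z
            (alternating-sum n w) (w n)))

-- Congruences with explicit quotients, and 1-jets.

module CongruenceLemmas (𝑹 : Ring≡) where
  open RingLemmas 𝑹
  open IdentityLemmas 𝑹 using (alternating-sum)

  infix  4 _≈_[_]
  infixr 4 _,_
  record _≈_[_] (x y d : R) : Set where
    constructor _,_
    field
      quotient : R
      equation : x ≡ y + d * quotient

  ≡⇒≈ : ∀ {x y d} → x ≡ y → x ≈ y [ d ]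
  ≡⇒≈ {x} {d = d} refl = 0# , solve 2 (λ x d → x := x :+ d :* :# 0) refl x d

  ≈-refl : ∀ {x d} → x ≈ x [ d ]
  ≈-refl = ≡⇒≈ refl

  ≈-sym : ∀ {x y d} → x ≈ y [ d ] → y ≈ x [ d ]
  ≈-sym {y = y} {d} (z , refl) = - z , solve 3 (λ y d z → y := y :+ d :* z :+ d :* :- z) refl y d z

  ≈-trans : ∀ {x y z d} → x ≈ y [ d ] → y ≈ z [ d ] → x ≈ z [ d ]
  ≈-trans {z = z} {d} (u , refl) (v , refl) = v + u , solve 4 (λ z d u v → z :+ d :* v :+ d :* u := z :+ d :*
      (v :+ u)) refl z d u v

  ≈-+ : ∀ {x y x′ y′ d} → x ≈ y [ d ] → x′ ≈ y′ [ d ] → x + x′ ≈ y + y′ [ d ]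
  ≈-+ {y = y} {y′ = y′} {d} (u , refl) (v , refl) = u + v ,
    solve 5 (λ y y′ d u v → y :+ d :* u :+ (y′ :+ d :* v) := y :+ y′ :+ d :* (u :+ v)) refl y y′ d u v

  ≈-neg : ∀ {x y d} → x ≈ y [ d ] → - x ≈ - y [ d ]
  ≈-neg {y = y} {d} (u , refl) = - u , solve 3 (λ y d u → :- (y :+ d :* u) := :- y :+ d :* :- u) refl y d u

  ≈-* : ∀ {x y x′ y′ d} → x ≈ y [ d ] → x′ ≈ y′ [ d ] → x * x′ ≈ y * y′ [ d ]
  ≈-* {y = y} {y′ = y′} {d} (u , refl) (v , refl) = u * (y′ + d * v) + y * v ,
    solve 5 (λ y y′ d u v → (y :+ d :* u) :* (y′ :+ d :* v) := y :* y′ :+ d :* (u :* (y′ :+ d :* v) :+ y :* v)) refl y y′ d u v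

  ≈-*ˡ : ∀ c {x y d} → x ≈ y [ d ] → c * x ≈ c * y [ d ]
  ≈-*ˡ c = ≈-* ≈-refl

  ≈-scale : ∀ c {x y d} → x ≈ y [ d ] → c * x ≈ c * y [ c * d ]
  ≈-scale c {y = y} {d} (u , refl) = u , solve 4 (λ c y d u → c :* (y :+ d :* u) := c :* y :+ c :* d :* u) refl c y d u

  ≈-weaken : ∀ {x y} d e → x ≈ y [ d * e ] → x ≈ y [ e ]
  ≈-weaken d e  (u , eq) = d * u , trans eq (solve 4 (λ y d e u → y :+ d :* e :* u := y :+ e :* (d :* u)) refl _ d e u)

  multiple : ∀ {d} z → d * z ≈ 0# [ d ]
  multiple z = z , sym (+-identityˡ _)

  ≈-^ : ∀ {x y d} k → x ≈ y [ d ] → x ^ k ≈ y ^ k [ d ]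
  ≈-^ zero    x≈y = ≈-refl
  ≈-^ (suc k) x≈y = ≈-* x≈y (≈-^ k x≈y)

  ≈-∑ : ∀ n {f g d} → (∀ i → i ℕ.< n → f i ≈ g i [ d ]) → ∑ n f ≈ ∑ n g [ d ]
  ≈-∑ zero    eq = ≈-refl
  ≈-∑ (suc n) eq = ≈-+ (eq 0 z<s) (≈-∑ n (λ i i<n → eq (suc i) (s<s i<n)))

  ≈-∏ : ∀ n {f g d} → (∀ i → i ℕ.< n → f i ≈ g i [ d ]) → ∏ n f ≈ ∏ n g [ d ]
  ≈-∏ zero    eq = ≈-refl
  ≈-∏ (suc n) eq = ≈-* (≈-∏ n (λ i i<n → eq i (ℕ.m<n⇒m<1+n i<n))) (eq n ℕ.≤-refl)

  ≈-alternating-sum : ∀ n {f g d} → (∀ i → i ℕ.< n → f i ≈ g i [ d ]) → alternating-sum n f ≈ alternating-sum n g [ d ]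
  ≈-alternating-sum zero    eq = ≈-refl
  ≈-alternating-sum (suc n) eq = ≈-+ (≈-neg (≈-alternating-sum n (λ i i<n → eq i (ℕ.m<n⇒m<1+n i<n)))) (eq n ℕ.≤-refl)

  ≈-cancelˡ-unit : ∀ {u v x y d} → u * v ≡ 1# → u * x ≈ u * y [ d ] → x ≈ y [ d ]
  ≈-cancelˡ-unit {u} {v} {x} {y} {d} uv (z , eq) = v * z , combination₂ (- x + y) v uv eq
    (solve 6 (λ u v x y d z → x :- (y :+ d :* (v :* z)) := (:- x :+ y) :* (u :* v :- :1) :+ v :* (u :* x :-
        (u :* y :+ d :* z))) refl u v x y d z)

  inverse-difference : ∀ {u x v y} → u * x ≡ 1# → v * y ≡ 1# → x ≡ y + (v + - u) * (x * y)
  inverse-difference {u} {x} {v} {y} ux vy = combination₂ (y) (- x) ux vy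
    (solve 4 (λ u x v y → x :- (y :+ (v :- u) :* (x :* y)) := y :* (u :* x :- :1) :+ :- x :* (v :* y :- :1)) refl u x v y)

  ≈-inverse : ∀ {u x v y d} → u * x ≡ 1# → v * y ≡ 1# → u ≈ v [ d ] → x ≈ y [ d ]
  ≈-inverse {u} {x} {v} {y} {d} ux vy (z , refl) = - z * (x * y) , trans (inverse-difference ux vy)
    (solve 5 (λ x y v d z → y :+ (v :- (v :+ d :* z)) :* (x :* y) := y :+ d :* (:- z :* (x :* y))) refl x y v d z)

  -- x and x₀ agree modulo d, so do y and y₀, and the pairs (x₀ , (x − x₀)/d)
  -- and (y₀ , (y − y₀)/d) agree modulo P: equality of 1-jets over R/P.
  record SameJet (d P x x₀ y y₀ : R) : Set where
    constructor jet
    field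
      {a b c} : R
      base    : x₀ ≡ y₀ + P * b
      left    : x ≡ x₀ + d * a
      right   : y ≡ y₀ + d * (a + P * c)

  module _ {d P : R} where

    jet-refl : ∀ {x x₀} → x ≈ x₀ [ d ] → SameJet d P x x₀ x x₀
    jet-refl {x₀ = x₀} (a , refl) = jet {b = 0#} {c = 0#} (solve 2 (λ x P → x := x :+ P :* :# 0) refl x₀ P) refl
      (solve 4 (λ x d a P → x :+ d :* a := x :+ d :* (a :+ P :* :# 0)) refl x₀ d a P)

    jet-const : ∀ {x y} → x ≈ y [ P ] → SameJet d P x x y y
    jet-const {x} {y} (b , x≡) = jet {a = 0#} {c = 0#} x≡ (solve 2 (λ x d → x := x :+ d :* :# 0) refl x d)
      (solve 3 (λ y d P → y := y :+ d :* (:# 0 :+ P :* :# 0)) refl y d P)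

    jet-* : ∀ {x x₀ y y₀ x′ x₀′ y′ y₀′} → SameJet d P x x₀ y y₀ → SameJet d P x′ x₀′ y′ y₀′ →
            SameJet d P (x * x′) (x₀ * x₀′) (y * y′) (y₀ * y₀′)
    jet-* {y₀ = y₀} {y₀′ = y₀′} (jet {a} {b} {c} refl refl refl) (jet {a′} {b′} {c′} refl refl refl) = jet
      {a = (y₀ + P * b) * a′ + (y₀′ + P * b′) * a + d * a * a′}
      {b = y₀ * b′ + b * y₀′ + P * b * b′}
      -- The first-order part `a` is formed with the bases x₀ = y₀ + P b of the left pair; the
      -- correction -(b a′ + b′ a) exchanges them for the bases of the right pair.
      {c = y₀ * c′ + y₀′ * c + d * (c * a′ + a * c′ + P * c * c′) + - (b * a′ + b′ * a)}
      (solve 5 (λ P y y′ b b′ → (y :+ P :* b) :* (y′ :+ P :* b′) := y :* y′ :+ P :*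
          (y :* b′ :+ b :* y′ :+ P :* b :* b′)) refl P y₀ y₀′ b b′)
      (solve 5 (λ d x x′ a a′ → (x :+ d :* a) :* (x′ :+ d :* a′) := x :* x′ :+ d :*
          (x :* a′ :+ x′ :* a :+ d :* a :* a′)) refl d (y₀ + P * b) (y₀′ + P * b′) a a′)
      (solve 10 (λ d P y y′ a a′ b b′ c c′ → (y :+ d :* (a :+ P :* c)) :* (y′ :+ d :* (a′ :+ P :* c′))
        := y :* y′ :+ d :* ((y :+ P :* b) :* a′ :+ (y′ :+ P :* b′) :* a :+ d :* a :* a′
            :+ P :* (y :* c′ :+ y′ :* c :+ d :* (c :* a′ :+ a :* c′ :+ P :* c :* c′) :-
                (b :* a′ :+ b′ :* a)))) refl d P y₀ y₀′ a a′ b b′ c c′)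

    jet-∏ : ∀ n {x x₀ y y₀ : ℕ → R} → (∀ i → i ℕ.< n → SameJet d P (x i) (x₀ i) (y i) (y₀ i)) →
            SameJet d P (∏ n x) (∏ n x₀) (∏ n y) (∏ n y₀)
    jet-∏ zero    eq = jet-const ≈-refl
    jet-∏ (suc n) eq = jet-* (jet-∏ n (λ i i<n → eq i (ℕ.m<n⇒m<1+n i<n))) (eq n ℕ.≤-refl)

    -- Every witness comes from 1/u - 1/v = (v - u)/(uv), applied to the pairs (u, u₀), (u₀, v₀),
    -- (v, v₀) and (u, v); no cancellation of `d` or `P` takes place.
    jet-inverse : ∀ {u u₀ v v₀ x x₀ y y₀} → u * x ≡ 1# → u₀ * x₀ ≡ 1# → v * y ≡ 1# → v₀ * y₀ ≡ 1# →
                  SameJet d P u u₀ v v₀ → SameJet d P x x₀ y y₀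
    jet-inverse {v₀ = v₀} {x} {x₀} {y} {y₀} ux u₀x₀ vy v₀y₀ (jet {a} {b} {c} refl refl refl) = jet
      {a = - (x * x₀ * a)} {b = - (x₀ * y₀ * b)}
      {c = - (y * y₀ * c) + - (a * (x * x₀ * y₀ * b + y₀ * x * y * (b + - (d * c))))}
      (trans h₁ (solve 5 (λ v P b x₀ y₀ → y₀ :+ (v :- (v :+ P :* b)) :* (x₀ :* y₀) := y₀ :+ P :* :-
          (x₀ :* y₀ :* b)) refl v₀ P b x₀ y₀))
      (trans (inverse-difference ux u₀x₀) (solve 5 (λ u d a x x₀ → x₀ :+ (u :- (u :+ d :* a)) :* (x :* x₀) := x₀ :+ d :* :-
          (x :* x₀ :* a)) refl (v₀ + P * b) d a x x₀))
      (combination₃ 1# (d * a * x) (d * a * y₀) (inverse-difference vy v₀y₀) h₁ (inverse-difference ux vy)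
        (solve 10 (λ d P v a b c x x₀ y y₀ →
          y :- (y₀ :+ d :* (:- (x :* x₀ :* a) :+ P :* (:- (y :* y₀ :* c) :- a :* (x :* x₀ :* y₀ :* b :+ y₀ :* x :* y :*
              (b :- d :* c)))))
          := :1 :* (y :- (y₀ :+ (v :- (v :+ d :* (a :+ P :* c))) :* (y :* y₀)))
             :+ d :* a :* x :* (x₀ :- (y₀ :+ (v :- (v :+ P :* b)) :* (x₀ :* y₀)))
             :+ d :* a :* y₀ :* (x :- (y :+ (v :+ d :* (a :+ P :* c) :- (v :+ P :* b :+ d :* a)) :* (x :* y))))
          refl d P v₀ a b c x x₀ y y₀))
      where
      h₁ : x₀ ≡ y₀ + (v₀ + - (v₀ + P * b)) * (x₀ * y₀)
      h₁ = inverse-difference u₀x₀ v₀y₀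

    -- Here a power of p is gained: both differences are multiples of `d`, and their cofactors agree
    -- modulo `P`.
    jet-difference : ∀ {x x₀ y y₀} → SameJet d P x x₀ y y₀ → x + - x₀ ≈ y + - y₀ [ d * P ]
    jet-difference {y₀ = y₀} (jet {a} {b} {c} refl refl refl) = - c ,
      solve 6 (λ d P y a b c → y :+ P :* b :+ d :* a :- (y :+ P :* b) := y :+ d :*
          (a :+ P :* c) :- y :+ d :* P :* :- c) refl d P y₀ a b c

    jet-right : ∀ {x x₀ y y₀} → SameJet d P x x₀ y y₀ → y ≈ y₀ [ d ]
    jet-right (jet {a} {b} {c} _ _ r) = a + P * c , r

  sgn-even : ∀ m → sgn (m ℕ.+ m) ≡ 1#
  sgn-even zero    = refl
  sgn-even (suc m) = trans (cong (λ k → - sgn k) (ℕ.+-suc m m))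
    (trans (solve 1 (λ x → :- :- x := x) refl _) (sgn-even m))

  alternating-sum-cons : ∀ n w → alternating-sum (suc n) w ≡ sgn n * w 0 + alternating-sum n (λ k → w (suc k))
  alternating-sum-cons zero    w = solve 1 (λ w → :- :# 0 :+ w := :1 :* w :+ :# 0) refl (w 0)
  alternating-sum-cons (suc n) w = trans (cong (λ x → - x + w (suc n)) (alternating-sum-cons n w))
    (solve 4 (λ s w a v → :- (s :* w :+ a) :+ v := :- s :* w :+ (:- a :+ v)) refl (sgn n) (w 0) (alternating-sum n (λ k → w
        (suc k))) (w (suc n)))

  alternating-sum-reverse : ∀ n w → alternating-sum n (λ k → w (n ∸ suc k)) ≡ - (sgn n * alternating-sum n w)
  alternating-sum-reverse zero    w = solve 0 (:# 0 := :- (:1 :* :# 0)) refl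
  alternating-sum-reverse (suc n) w = begin
    alternating-sum (suc n) (λ k → w (n ∸ k))
      ≡⟨ alternating-sum-cons n (λ k → w (n ∸ k)) ⟩
    sgn n * w n + alternating-sum n (λ k → w (n ∸ suc k))
      ≡⟨ cong (λ x → sgn n * w n + x) (alternating-sum-reverse n w) ⟩
    sgn n * w n + - (sgn n * alternating-sum n w)
      ≡⟨ solve 3 (λ s w a → s :* w :- s :* a := :- (:- s :* (:- a :+ w))) refl (sgn n) (w n) (alternating-sum n w) ⟩
    - (sgn (suc n) * alternating-sum (suc n) w) ∎
    where open ≡-Reasoning

-- Binomial coefficients and Fermat's little theorem.

module FermatLemmas (𝑹 : Ring≡) where
  open RingLemmas 𝑹
  open CongruenceLemmas 𝑹

  binomial : ℕ → ℕ → R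
  binomial n       zero    = 1#
  binomial zero    (suc k) = 0#
  binomial (suc n) (suc k) = binomial n k + binomial n (suc k)

  -- Serves twice: for the divisibility of the middle binomial coefficients by p, and for their
  -- expression by factorials.
  binomial-absorb : ∀ n k → ι (suc k) * binomial (suc n) (suc k) ≡ ι (suc n) * binomial n k
  binomial-absorb zero    zero    = solve 0 ((:1 :+ :# 0) :* (:1 :+ :# 0) := (:1 :+ :# 0) :* :1) refl
  binomial-absorb zero    (suc k) = solve 1 (λ k → k :* (:# 0 :+ :# 0) := (:1 :+ :# 0) :* :# 0) refl _
  binomial-absorb (suc n) zero    = combination₁ 1# (binomial-absorb n zero)
    (solve 2 (λ n b → (:1 :+ :# 0) :* (:1 :+ b) :- (:1 :+ (:1 :+ n)) :* :1 := :1 :* ((:1 :+ :# 0) :* b :-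
        (:1 :+ n) :* :1)) refl (ι n) (binomial (suc n) 1))
  binomial-absorb (suc n) (suc k) = combination₂ 1# 1# (binomial-absorb n k) (binomial-absorb n (suc k))
    (solve 5 (λ n k x y b → (:1 :+ (:1 :+ k)) :* (x :+ y :+ b) :- (:1 :+ (:1 :+ n)) :* (x :+ y)
      := :1 :* ((:1 :+ k) :* (x :+ y) :- (:1 :+ n) :* x) :+ :1 :* ((:1 :+ (:1 :+ k)) :* b :- (:1 :+ n) :* y))
      refl (ι n) (ι k) (binomial n k) (binomial n (suc k)) (binomial (suc n) (suc (suc k))))

  binomial-zero : ∀ n k → n ℕ.< k → binomial n k ≡ 0#
  binomial-zero zero    (suc k) _         = refl
  binomial-zero (suc n) (suc k) (s<s n<k) =
    trans (cong₂ _+_ (binomial-zero n k n<k) (binomial-zero n (suc k) (ℕ.m<n⇒m<1+n n<k))) (+-identityˡ 0#)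

  binomial-diagonal : ∀ n → binomial n n ≡ 1#
  binomial-diagonal zero    = refl
  binomial-diagonal (suc n) = trans (cong₂ _+_ (binomial-diagonal n) (binomial-zero n (suc n) ℕ.≤-refl)) (+-identityʳ 1#)

  binomial-theorem : ∀ x n → (1# + x) ^ n ≡ ∑ (suc n) (λ k → binomial n k * x ^ k)
  binomial-theorem x zero    = solve 0 (:1 := :1 :* :1 :+ :# 0) refl
  binomial-theorem x (suc n) = begin
    (1# + x) * (1# + x) ^ n
      ≡⟨ cong ((1# + x) *_) (binomial-theorem x n) ⟩
    (1# + x) * S
      ≡⟨ solve 2 (λ x s → (:1 :+ x) :* s := x :* s :+ s) refl x S ⟩
    x * S + S
      ≡⟨ cong₂ _+_ (sym (∑-*ˡ (suc n) x g)) extend ⟩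
    ∑ (suc n) (λ k → x * g k) + (g 0 + ∑ (suc n) (λ k → g (suc k)))
      ≡⟨ solve 3 (λ a b c → a :+ (b :+ c) := b :+ (a :+ c)) refl _ _ _ ⟩
    g 0 + (∑ (suc n) (λ k → x * g k) + ∑ (suc n) (λ k → g (suc k)))
      ≡⟨ cong₂ _+_ refl (trans (sym (∑-+ (suc n) (λ k → x * g k) (λ k → g (suc k)))) (∑-cong (suc n) (λ k _ →
           solve 4 (λ x y b c → x :* (b :* y) :+ c :* (x :* y) := (b :+ c) :* (x :* y)) refl x (x ^ k) (binomial n k)
               (binomial n (suc k))))) ⟩
    ∑ (suc (suc n)) (λ k → binomial (suc n) k * x ^ k) ∎
    where
    open ≡-Reasoning
    g : ℕ → R
    g k = binomial n k * x ^ k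
    S : R
    S = ∑ (suc n) g
    extend : S ≡ ∑ (suc (suc n)) g
    extend = sym (trans (∑-snoc (suc n) g)
      (trans (cong (λ b → S + b * x ^ suc n) (binomial-zero n (suc n) ℕ.≤-refl)) (solve 2
          (λ s y → s :+ :# 0 :* y := s) refl S (x ^ suc n))))

  module _ (p′ : ℕ) (r : ℕ → R) (runit : ∀ i → i ℕ.< p′ → ι (suc i) * r i ≡ 1#) where

    -- By absorption, (k+1) times a middle coefficient is a multiple of p, and k + 1 is a unit.
    -- Primality is present only in the form that 1, ..., p-1 are units.
    frobenius : ∀ x → (1# + x) ^ suc p′ ≈ 1# + x ^ suc p′ [ ι (suc p′) ]
    frobenius x = ≈-trans (≡⇒≈ (trans (binomial-theorem x (suc p′)) (cong (λ z → 1# * 1# + z) (∑-snoc p′ (λ k → binomial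
        (suc p′) (suc k) * x ^ suc k)))))
      (≈-trans (≈-+ ≈-refl (≈-+ (≈-∑ p′ middle) (≡⇒≈ (cong (_* x ^ suc p′) (binomial-diagonal (suc p′))))))
        (≡⇒≈ (trans (cong (λ z → 1# * 1# + (z + 1# * x ^ suc p′)) (∑-zero p′ (λ _ _ → refl)))
          (solve 1 (λ y → :1 :* :1 :+ (:# 0 :+ :1 :* y) := :1 :+ y) refl (x ^ suc p′)))))
      where
      middle : ∀ k → k ℕ.< p′ → binomial (suc p′) (suc k) * x ^ suc k ≈ 0# [ ι (suc p′) ]
      middle k k<p = ≈-trans (≈-* {y = 0#} (≈-cancelˡ-unit (runit k k<p)
        (≈-trans (≡⇒≈ (binomial-absorb p′ k)) (≈-trans (multiple (binomial p′ k)) (≡⇒≈ (sym (zeroʳ _)))))) ≈-refl) (≡⇒≈ (zeroˡ _))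

    fermat : ∀ a → ι a ^ suc p′ ≈ ι a [ ι (suc p′) ]
    fermat zero    = ≡⇒≈ (zeroˡ _)
    fermat (suc a) = ≈-trans (frobenius (ι a)) (≈-+ ≈-refl (fermat a))

    fermat-unit : ∀ i → i ℕ.< p′ → ι (suc i) ^ p′ ≈ 1# [ ι (suc p′) ]
    fermat-unit i i<p = ≈-cancelˡ-unit (runit i i<p) (≈-trans (fermat (suc i)) (≡⇒≈ (sym (*-identityʳ _))))

-- The difference equation of the Euler polynomials, from power series.

module ExponentialLemmas (𝑹 : Ring≡) where
  open RingLemmas 𝑹
  open FermatLemmas 𝑹

  module _ (r f : ℕ → R) (r-unit : ∀ k → ι (suc k) * r k ≡ 1#) (f-zero : f 0 ≡ 1#) (f-suc : ∀ k → ι (suc k) * f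
      (suc k) ≡ f k) where

    binomial-factorials : ∀ k l → binomial (k ℕ.+ l) k * f (k ℕ.+ l) ≡ f k * f l
    binomial-factorials zero    l = cong (_* f l) (sym f-zero)
    binomial-factorials (suc k) l = *-cancelˡ-unit (r-unit k) (begin
      ι (suc k) * (binomial (suc (k ℕ.+ l)) (suc k) * f (suc (k ℕ.+ l)))
        ≡⟨ sym (*-assoc _ _ _) ⟩
      ι (suc k) * binomial (suc (k ℕ.+ l)) (suc k) * f (suc (k ℕ.+ l))
        ≡⟨ cong (_* f (suc (k ℕ.+ l))) (binomial-absorb (k ℕ.+ l) k) ⟩
      ι (suc (k ℕ.+ l)) * binomial (k ℕ.+ l) k * f (suc (k ℕ.+ l))
        ≡⟨ solve 3 (λ a b c → a :* b :* c := b :* (a :* c)) refl _ _ _ ⟩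
      binomial (k ℕ.+ l) k * (ι (suc (k ℕ.+ l)) * f (suc (k ℕ.+ l)))
        ≡⟨ cong (binomial (k ℕ.+ l) k *_) (f-suc (k ℕ.+ l)) ⟩
      binomial (k ℕ.+ l) k * f (k ℕ.+ l)
        ≡⟨ binomial-factorials k l ⟩
      f k * f l
        ≡⟨ cong (_* f l) (sym (f-suc k)) ⟩
      ι (suc k) * f (suc k) * f l
        ≡⟨ *-assoc _ _ _ ⟩
      ι (suc k) * (f (suc k) * f l) ∎)
      where open ≡-Reasoning

    -- The coefficient of tⁿ in e^t e^{xt} = e^{(1+x)t}, with `f k` in the role of 1/k!.
    exp-shift : ∀ x n → ∑ (suc n) (λ i → f i * (x ^ (n ∸ i) * f (n ∸ i))) ≡ (1# + x) ^ n * f n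
    exp-shift x n = sym (begin
      (1# + x) ^ n * f n
        ≡⟨ trans (*-comm _ _) (cong (f n *_) (binomial-theorem x n)) ⟩
      f n * ∑ (suc n) (λ k → binomial n k * x ^ k)
        ≡⟨ sym (∑-*ˡ (suc n) (f n) (λ k → binomial n k * x ^ k)) ⟩
      ∑ (suc n) (λ k → f n * (binomial n k * x ^ k))
        ≡⟨ ∑-cong (suc n) (λ { k (s≤s k≤n) → termwise k k≤n }) ⟩
      ∑ (suc n) (λ k → f (n ∸ k) * (x ^ k * f k))
        ≡⟨ ∑-reverse (suc n) (λ k → f (n ∸ k) * (x ^ k * f k)) ⟩
      ∑ (suc n) (λ i → f (n ∸ (n ∸ i)) * (x ^ (n ∸ i) * f (n ∸ i)))
        ≡⟨ ∑-cong (suc n) (λ { i (s≤s i≤n) → cong (λ j → f j * (x ^ (n ∸ i) * f (n ∸ i))) (ℕ.m∸[m∸n]≡n i≤n) }) ⟩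
      ∑ (suc n) (λ i → f i * (x ^ (n ∸ i) * f (n ∸ i))) ∎)
      where
      open ≡-Reasoning
      termwise : ∀ k → k ℕ.≤ n → f n * (binomial n k * x ^ k) ≡ f (n ∸ k) * (x ^ k * f k)
      termwise k k≤n = trans (solve 3 (λ a b c → a :* (b :* c) := b :* a :* c) refl (f n) (binomial n k) (x ^ k))
        (trans (cong (_* x ^ k) (subst (λ m → binomial m k * f m ≡ f k * f (n ∸ k)) (ℕ.m+[n∸m]≡n k≤n) (binomial-factorials k
            (n ∸ k))))
          (solve 3 (λ a b c → a :* b :* c := b :* (c :* a)) refl (f k) (f (n ∸ k)) (x ^ k)))

    unit-series : ℕ → R
    unit-series zero    = 1#
    unit-series (suc n) = 0#

    -- `h` and `h′` are 2e^{xt}/(e^t + 1) and 2e^{(1+x)t}/(e^t + 1). The series h′ + h - 2e^{xt} is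
    -- annihilated by e^t + 1, whose constant coefficient 2 is a unit, so it vanishes.
    euler-shift : ∀ x (h h′ : ℕ → R) →
      (∀ n → ∑ (suc n) (λ i → (f i + unit-series i) * h  (n ∸ i)) ≡ ι 2 * (x ^ n * f n)) →
      (∀ n → ∑ (suc n) (λ i → (f i + unit-series i) * h′ (n ∸ i)) ≡ ι 2 * ((1# + x) ^ n * f n)) →
      ∀ n → h′ n + h n ≡ ι 2 * (x ^ n * f n)
    euler-shift x h h′ H H′ n = combination₁ 1# (vanish (suc n) n ℕ.≤-refl)
      (solve 3 (λ a b c → a :+ b :- c := :1 :* (a :+ b :- c :- :# 0)) refl (h′ n) (h n) (ι 2 * e n))
      where
      g e d : ℕ → R
      g i = f i + unit-series i
      e i = x ^ i * f i
      d i = h′ i + h i + - (ι 2 * e i)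

      unit-convolution : ∀ n → ∑ (suc n) (λ i → unit-series i * e (n ∸ i)) ≡ e n
      unit-convolution n = trans (cong (λ y → 1# * e n + y) (∑-zero n (λ i _ → zeroˡ _)))
        (solve 1 (λ x → :1 :* x :+ :# 0 := x) refl (e n))

      e-convolution : ∀ n → ∑ (suc n) (λ i → g i * e (n ∸ i)) ≡ (1# + x) ^ n * f n + e n
      e-convolution n = trans (∑-cong (suc n) (λ i _ → solve 3 (λ a b c → (a :+ b) :* c := a :* c :+ b :* c) refl (f i)
          (unit-series i) (e (n ∸ i))))
        (trans (∑-+ (suc n) (λ i → f i * e (n ∸ i)) (λ i → unit-series i * e (n ∸ i))) (cong₂ _+_ (exp-shift x n)
            (unit-convolution n)))

      d-convolution : ∀ n → ∑ (suc n) (λ i → g i * d (n ∸ i)) ≡ 0#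
      d-convolution n = begin
        ∑ (suc n) (λ i → g i * d (n ∸ i))
          ≡⟨ ∑-cong (suc n) (λ i _ → solve 4 (λ g a b c → g :* (a :+ b :- :# 2 :* c) := g :* a :+ g :* b :+ :- :# 2 :*
              (g :* c)) refl (g i) (h′ (n ∸ i)) (h (n ∸ i)) (e (n ∸ i))) ⟩
        ∑ (suc n) (λ i → g i * h′ (n ∸ i) + g i * h (n ∸ i) + - ι 2 * (g i * e (n ∸ i)))
          ≡⟨ trans (∑-+ (suc n) (λ i → g i * h′ (n ∸ i) + g i * h (n ∸ i)) (λ i → - ι 2 * (g i * e (n ∸ i))))
               (cong₂ _+_ (∑-+ (suc n) (λ i → g i * h′ (n ∸ i)) (λ i → g i * h (n ∸ i))) (∑-*ˡ (suc n) (- ι 2)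
                   (λ i → g i * e (n ∸ i)))) ⟩
        ∑ (suc n) (λ i → g i * h′ (n ∸ i)) + ∑ (suc n) (λ i → g i * h (n ∸ i)) + - ι 2 * ∑ (suc n) (λ i → g i * e (n ∸ i))
          ≡⟨ cong₂ _+_ (cong₂ _+_ (H′ n) (H n)) (cong (- ι 2 *_) (e-convolution n)) ⟩
        ι 2 * ((1# + x) ^ n * f n) + ι 2 * e n + - ι 2 * ((1# + x) ^ n * f n + e n)
          ≡⟨ solve 2 (λ a b → :# 2 :* a :+ :# 2 :* b :+ :- :# 2 :* (a :+ b) := :# 0) refl ((1# + x) ^ n * f n) (e n) ⟩
        0# ∎
        where open ≡-Reasoning

      vanish : ∀ n k → k ℕ.< n → d k ≡ 0#
      vanish (suc n) k (s≤s k≤n) with ℕ.m≤n⇒m<n∨m≡n k≤n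
      ... | inj₁ k<n  = vanish n k k<n
      -- In the n-th coefficient of the product all d_k with k < n are already zero, so it reduces
      -- to 2 d_n.
      ... | inj₂ refl = *-cancelˡ-unit (trans (cong (_* r 1) (sym g-zero)) (r-unit 1)) (trans (trans (sym (+-identityʳ _))
          (trans (cong (λ y → g 0 * d n + y) (sym (∑-zero n (λ i i<n → trans (cong (g (suc i) *_) (vanish n (n ∸ suc i)
              (ℕ.∸-monoʳ-< z<s i<n))) (zeroʳ _)))))
            (d-convolution n))) (sym (zeroʳ _)))
        where
        g-zero : ι 2 ≡ g 0
        g-zero = trans (solve 0 (:# 2 := :1 :+ :1) refl) (cong (_+ 1#) (sym f-zero))

-- ι p lies in the Jacobson radical and 1, …, p−1 are units.
record IsLocalAt (𝑹 : Ring≡) (p : ℕ) : Set where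
  open RingLemmas 𝑹
  field
    recip      : ℕ → R
    recip-unit : ∀ i → suc i ℕ.< p → ι (suc i) * recip i ≡ 1#
    near-one⁻¹ : R → R
    near-one-unit : ∀ z → (1# + ι p * z) * near-one⁻¹ z ≡ 1#

-- The supercongruence in a ring local at p; here q = p - n - 2 is the last offset in the tail.

module Supercongruence (𝑹 : Ring≡) (p n q : ℕ) (4<p : 4 ℕ.< p)
  (1+n+1+q≡p : suc n ℕ.+ suc q ≡ p) (4n+1≡3p : 4 ℕ.* n ℕ.+ 1 ≡ 3 ℕ.* p) (isLocal : IsLocalAt 𝑹 p) where
  open RingLemmas 𝑹
  open IdentityLemmas 𝑹
  open CongruenceLemmas 𝑹
  open FermatLemmas 𝑹
  open IsLocalAt isLocal renaming (recip to r)

  private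
    n<p : n ℕ.< p
    n<p = subst (n ℕ.<_) 1+n+1+q≡p (ℕ.m≤m+n (suc n) (suc q))

  -- `s` is τ³, written as p times something so that `lift-unit` applies to x³ + τ³ directly.
  P ¼ t τ s : R
  P = ι p
  ¼ = r 3
  t = ι 3 * ¼
  τ = P * t
  s = P * (t * (τ * τ))

  A : ℕ → R
  A i = ¼ + ι i

  4¼ : ι 4 * ¼ ≡ 1#
  4¼ = recip-unit 3 4<p

  2½ : ι 2 * r 1 ≡ 1#
  2½ = recip-unit 1 (ℕ.<-trans (s<s (s<s z<s)) 4<p)

  n+¼≡τ : ι n + ¼ ≡ τ
  n+¼≡τ = *-cancelˡ-unit 4¼ (combination₂ 1# (1# + - (P * ι 3)) (trans (sym (trans (ι-+ (4 ℕ.* n) 1) (cong (_+ ι 1)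
      (ι-* 4 n)))) (trans (cong ι 4n+1≡3p) (ι-* 3 p))) 4¼
    (solve 3 (λ n P a → :# 4 :* (n :+ a) :- :# 4 :* (P :* (:# 3 :* a))
      := :1 :* (:# 4 :* n :+ :# 1 :- :# 3 :* P) :+ (:1 :- P :* :# 3) :* (:# 4 :* a :- :1)) refl (ι n) P ¼))

  -- If y inverts x, then x + Pz = x(1 + P(yz)), and the second factor is a unit by locality.
  lift⁻¹ : R → R → R
  lift⁻¹ y z = y * near-one⁻¹ (y * z)

  lift-unit : ∀ {x y} z → x * y ≡ 1# → (x + P * z) * lift⁻¹ y z ≡ 1#
  lift-unit {x} {y} z xy = combination₂ (near-one⁻¹ (y * z)) 1# xy (near-one-unit (y * z))
    (solve 5 (λ x y P z i → (x :+ P :* z) :* (y :* i) :- :1 := i :* (x :* y :- :1) :+ :1 :* ((:1 :+ P :* (y :* z)) :* i :- :1))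
      refl x y P z (near-one⁻¹ (y * z)))

  runit : ∀ i → i ℕ.< n → ι (suc i) * r i ≡ 1#
  runit i i<n = recip-unit i (ℕ.<-≤-trans (s≤s i<n) n<p)

  cube : R → R
  cube x = x * x * x

  cube-unit : ∀ {x y} → x * y ≡ 1# → cube x * cube y ≡ 1#
  cube-unit {x} {y} xy = trans (solve 2 (λ x y → (x :* x :* x) :* (y :* y :* y) := (x :* y) :* (x :* y) :* (x :* y)) refl x y)
    (trans (cong cube xy) (solve 0 (:1 :* :1 :* :1 := :1) refl))

  square-unit : ∀ {x y} → x * y ≡ 1# → (x * x) * (y * y) ≡ 1#
  square-unit {x} {y} xy = trans (solve 2 (λ x y → (x :* x) :* (y :* y) := (x :* y) :* (x :* y)) refl x y)
    (trans (cong (λ z → z * z) xy) (*-identityˡ 1#))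

  C : ℕ → R
  C i = lift⁻¹ (cube (r i)) (t * (τ * τ))

  C-unit : ∀ i → i ℕ.< n → (cube (ι (suc i)) + s) * C i ≡ 1#
  C-unit i i<n = lift-unit (t * (τ * τ)) (cube-unit (runit i i<n))

  -- C i is the inverse of (i+1)³ + τ³, so T k is the product over ζ³ = 1 of (¼−ζτ)ₖ/(1+ζτ)ₖ.
  T T⁰ : ℕ → R
  T  k = ∏ k (λ i → (s + - cube (A i)) * C i)
  T⁰ k = ∏ k (λ i → - cube (A i) * cube (r i))

  weight : ℕ → R
  weight k = 1# + ι 8 * ι k

  -- The sum and the product of ¼ − ωτ and ¼ − ω²τ, ω a primitive cube root of unity.
  σ π : R
  σ = ι 2 * ¼ + τ
  π = ¼ * ¼ + τ * ¼ + τ * τ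

  I V : ℕ → R
  I i = C i * (ι (suc i) + τ)
  V j = ∏ j (λ i → (ι i + - ι n) * (1# + ¼ + - σ + ι i) * I i)

  I-unit : ∀ i → i ℕ.< n → (ι (suc i) * ι (suc i) + - (τ * ι (suc i)) + τ * τ) * I i ≡ 1#
  I-unit i i<n = trans (solve 4 (λ x P t c →
    (x :* x :- P :* t :* x :+ P :* t :* (P :* t)) :* (c :* (x :+ P :* t)) := (x :* x :* x :+ P :* (t :* (P :* t :*
        (P :* t)))) :* c) refl (ι (suc i)) P t (C i))
    (C-unit i i<n)

  -- Whipple with a = ¼: the terminating parameter -n = ¼ - τ is the one with ζ = 1, while `σ` and
  -- `π` encode the other two. The factorization x³ + τ³ = (x + τ)(x² - τx + τ²) at x = i + 1 turns
  -- `C` into both inverses: `J` inverts x + τ = 1 + ¼ + n + i, and `I` inverts the quadratic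
  -- factor.
  whipple-sum : ∑ (suc n) (λ k → weight k * T k) ≡ ι 4 * τ * ∑ (suc n) V
  whipple-sum = begin
    ∑ (suc n) (λ k → weight k * T k)
      ≡⟨ ∑-cong (suc n) rescale ⟩
    ∑ (suc n) (λ k → ι 4 * ((¼ + ι 2 * ι k) * (ω k * Q k)))
      ≡⟨ ∑-*ˡ (suc n) (ι 4) (λ k → (¼ + ι 2 * ι k) * (ω k * Q k)) ⟩
    ι 4 * ∑ (suc n) (λ k → (¼ + ι 2 * ι k) * (ω k * Q k))
      ≡⟨ cong (ι 4 *_) (whipple σ π n ¼ I J denominator J-unit) ⟩
    ι 4 * ((¼ + ι n) * ∑ (suc n) V)
      ≡⟨ trans (cong (λ x → ι 4 * (x * ∑ (suc n) V)) (trans (+-comm _ _) n+¼≡τ)) (sym (*-assoc _ _ _)) ⟩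
    ι 4 * τ * ∑ (suc n) V ∎
    where
    open ≡-Reasoning
    J ω Q : ℕ → R
    J i = C i * (ι (suc i) * ι (suc i) + - (τ * ι (suc i)) + τ * τ)
    ω = whipple-weight σ π n ¼ I J
    Q = whipple-quotient σ π n ¼ I J
    denominator : ∀ i → i ℕ.< n → whipple-denominator σ π (1# + ¼ + ι i) * I i ≡ 1#
    denominator i i<n = trans (cong (_* I i) (solve 3 (λ a i u → (:1 :+ a :+ i) :* (:1 :+ a :+ i) :- (:# 2 :* a :+ u) :*
        (:1 :+ a :+ i) :+ (a :* a :+ u :* a :+ u :* u)
      := (:1 :+ i) :* (:1 :+ i) :- u :* (:1 :+ i) :+ u :* u) refl ¼ (ι i) τ)) (I-unit i i<n)
    J-unit : ∀ i → i ℕ.< n → (1# + ¼ + ι n + ι i) * J i ≡ 1#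
    J-unit i i<n = combination₂ (J i) 1# n+¼≡τ (C-unit i i<n)
      (solve 6 (λ a n i P t c → let τ = P :* t ; x = :1 :+ i ; j = c :* (x :* x :- τ :* x :+ τ :* τ) in
        (:1 :+ a :+ n :+ i) :* j :- :1 := j :* (n :+ a :- τ) :+ :1 :* ((x :* x :* x :+ P :* (t :*
            (τ :* τ))) :* c :- :1)) refl ¼ (ι n) (ι i) P t (C i))
    factor : ∀ i → i ℕ.< n → (ι n + - ι i) * J i * ((ι i * ι i + σ * ι i + π) * I i) ≡ (s + - cube (A i)) * C i
    factor i i<n = combination₂ (J i * ((ι i * ι i + σ * ι i + π) * I i)) ((s + - cube (A i)) * C i) n+¼≡τ (C-unit i i<n)
      (solve 6 (λ a n i P t c → let τ = P :* t ; x = :1 :+ i ; j = c :* (x :* x :- τ :* x :+ τ :* τ) ; i′ = c :* (x :+ τ)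
                                    b = i :* i :+ (:# 2 :* a :+ τ) :* i :+ (a :* a :+ τ :* a :+ τ :* τ) ; s = P :* (t :*
                                        (τ :* τ)) ; y = a :+ i in
        (n :- i) :* j :* (b :* i′) :- (s :- y :* y :* y) :* c
        := j :* (b :* i′) :* (n :+ a :- τ) :+ (s :- y :* y :* y) :* c :* ((x :* x :* x :+ s) :* c :- :1)) refl ¼ (ι n)
            (ι i) P t (C i))
    rescale : ∀ k → k ℕ.< suc n → weight k * T k ≡ ι 4 * ((¼ + ι 2 * ι k) * (ω k * Q k))
    rescale k (s≤s k≤n) = begin
      weight k * T k
        ≡⟨ cong (weight k *_) (sym (trans (sym (∏-* k _ _)) (∏-cong k (λ i i<k → factor i (ℕ.<-≤-trans i<k k≤n))))) ⟩
      weight k * (ω k * Q k)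
        ≡⟨ combination₁ (- (ω k * Q k)) 4¼ (solve 3 (λ a k x → (:1 :+ :# 8 :* k) :* x :- :# 4 :*
            ((a :+ :# 2 :* k) :* x) := :- x :* (:# 4 :* a :- :1)) refl ¼ (ι k) (ω k * Q k)) ⟩
      ι 4 * ((¼ + ι 2 * ι k) * (ω k * Q k)) ∎

  P² P³ : R
  P² = P * P
  P³ = P² * P

  ι-reflect : ∀ N i → i ℕ.< N → ι (suc (N ∸ suc i)) ≡ ι N + - ι i
  ι-reflect N i i<N = combination₁ 1# (trans (sym (ι-+ (suc (N ∸ suc i)) i)) (cong ι (trans (sym (ℕ.+-suc (N ∸ suc i) i))
      (ℕ.m∸n+n≡m i<N))))
    (solve 3 (λ x y z → x :- (z :- y) := :1 :* (x :+ y :- z)) refl (ι (suc (N ∸ suc i))) (ι i) (ι N))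

  u : ℕ → R
  u i = cube (ι (suc i)) + s

  -- `B⁰ k` is the cube of the binomial coefficient of n over k, and `B` is its deformation by τ³.
  -- Both are exactly symmetric under k ↔ n - k, which `T` and `T⁰` are only modulo p.
  B B⁰ : ℕ → R
  B  = gbinomial u C n C-unit
  B⁰ = gbinomial (λ i → cube (ι (suc i))) (λ i → cube (r i)) n (λ i i<n → cube-unit (runit i i<n))

  -- Since τ - (¼ + i) = n - i, the numerator -(¼ + i)³ is congruent to (n - i)³ modulo p. Adding τ³
  -- = p³t³ moves both by the same amount, and the denominators coincide.
  T-jet : ∀ k → k ℕ.≤ n → SameJet P³ P (T k) (T⁰ k) (B k) (B⁰ k)
  T-jet k k≤n = jet-∏ k (λ i i<k → jet-* (numerator i (ℕ.<-≤-trans i<k k≤n)) (denominator i (ℕ.<-≤-trans i<k k≤n)))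
    where
    numerator : ∀ i → i ℕ.< n → SameJet P³ P (s + - cube (A i)) (- cube (A i)) (u (n ∸ suc i)) (cube (ι (suc (n ∸ suc i))))
    numerator i i<n = jet {a = cube t} {b = t * (ι 3 * A i * τ + - (ι 3 * A i * A i) + - (τ * τ))} {c = 0#}
      (trans (solve 3 (λ x P t → let τ = P :* t ; y = τ :- x in
          :- (x :* x :* x) := y :* y :* y :+ P :* (t :* (:# 3 :* x :* τ :- :# 3 :* x :* x :- τ :* τ))) refl (A i) P t)
        (cong (λ y → cube y + P * (t * (ι 3 * A i * τ + - (ι 3 * A i * A i) + - (τ * τ)))) reflected))
      (solve 3 (λ x P t → P :* (t :* (P :* t :* (P :* t))) :- x := :- x :+ P :* P :* P :* (t :* t :* t)) refl (cube (A i)) P t)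
      (solve 3 (λ x P t → x :+ P :* (t :* (P :* t :* (P :* t))) := x :+ P :* P :* P :* (t :* t :* t :+ P :* :# 0)) refl
          (cube (ι (suc (n ∸ suc i)))) P t)
      where
      reflected : τ + - A i ≡ ι (suc (n ∸ suc i))
      reflected = trans (combination₁ (- 1#) n+¼≡τ (solve 4 (λ a n i τ → τ :- (a :+ i) :- (n :- i) := :- :1 :*
          (n :+ a :- τ)) refl ¼ (ι n) (ι i) τ))
        (sym (ι-reflect n i i<n))
    denominator : ∀ i → i ℕ.< n → SameJet P³ P (C i) (cube (r i)) (C i) (cube (r i))
    denominator i i<n = jet-refl (≈-inverse (C-unit i i<n) (cube-unit (runit i i<n)) (t * t * t ,
      solve 3 (λ x P t → x :+ P :* (t :* (P :* t :* (P :* t))) := x :+ P :* P :* P :* (t :* t :* t)) refl (cube (ι (suc i))) P t))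

  T-sums : ∑ (suc n) (λ k → weight k * T k) ≈ ∑ (suc n) (λ k → weight k * T⁰ k) [ P³ * P ]
  T-sums = ≈-trans (≡⇒≈ rearrange) (≈-trans (≈-+ ≈-refl (≈-trans (≈-∑ (suc n) termwise) (≡⇒≈ vanish))) (≡⇒≈ (+-identityʳ _)))
    where
    D : ℕ → R
    D k = B k + - B⁰ k
    rearrange : ∑ (suc n) (λ k → weight k * T k) ≡ ∑ (suc n) (λ k → weight k * T⁰ k) + ∑ (suc n) (λ k → weight k * (T k + - T⁰ k))
    rearrange = trans (∑-cong (suc n) (λ k _ → solve 3 (λ w x y → w :* x := w :* y :+ w :* (x :- y)) refl (weight k) (T k)
        (T⁰ k)))
      (∑-+ (suc n) (λ k → weight k * T⁰ k) (λ k → weight k * (T k + - T⁰ k)))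
    termwise : ∀ k → k ℕ.< suc n → weight k * (T k + - T⁰ k) ≈ ι 4 * ((ι 2 * ι k + - ι n) * D k) [ P³ * P ]
    termwise k (s≤s k≤n) = ≈-trans (≈-*ˡ (weight k) (jet-difference (T-jet k k≤n))) (reweigh (jet-right (T-jet k k≤n)))
      where
      -- 1 + 8k = 4(2k - n) + 4τ, and the part with 4τ disappears because `D k` is divisible by p³.
      reweigh : B k ≈ B⁰ k [ P³ ] → weight k * D k ≈ ι 4 * ((ι 2 * ι k + - ι n) * D k) [ P³ * P ]
      reweigh (z , B≡) = ι 4 * t * z , combination₃ (weight k + - (ι 4 * (ι 2 * ι k + - ι n))) (ι 4 * (P³ * z))
          (P³ * z) B≡ n+¼≡τ (sym 4¼)
        (solve 8 (λ a n k P t z x y → let d = P :* P :* P ; w = :1 :+ :# 8 :* k ; v = :# 4 :* (:# 2 :* k :- n) in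
          w :* (x :- y) :- (:# 4 :* ((:# 2 :* k :- n) :* (x :- y)) :+ d :* P :* (:# 4 :* t :* z))
          := (w :- v) :* (x :- (y :+ d :* z)) :+ :# 4 :* (d :* z) :* (n :+ a :- P :* t) :+ d :* z :*
              (:1 :- :# 4 :* a)) refl ¼ (ι n) (ι k) P t z (B k) (B⁰ k))
    symmetric : ∀ k l → k ℕ.+ l ≡ n → D k ≡ D l
    symmetric k l k+l≡n = cong₂ (λ x y → x + - y) (gbinomial-symmetric u C n C-unit k l k+l≡n)
      (gbinomial-symmetric _ _ n (λ i i<n → cube-unit (runit i i<n)) k l k+l≡n)
    vanish : ∑ (suc n) (λ k → ι 4 * ((ι 2 * ι k + - ι n) * D k)) ≡ 0#
    vanish = trans (∑-*ˡ (suc n) (ι 4) (λ k → (ι 2 * ι k + - ι n) * D k))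
      (trans (cong (ι 4 *_) (antisymmetric-∑ 2½ n D symmetric)) (zeroʳ _))

  e I⁰ W : ℕ → R
  e  i = lift⁻¹ (r i) (- t)
  I⁰ i = r i * e i
  W  i = lift⁻¹ (r i * r i) (t * τ)

  e-unit : ∀ i → i ℕ.< n → (ι (suc i) + - τ) * e i ≡ 1#
  e-unit i i<n = trans (cong (_* e i) (solve 3 (λ x P t → x :- P :* t := x :+ P :* :- t) refl (ι (suc i)) P t)) (lift-unit
      (- t) (runit i i<n))

  I⁰-unit : ∀ i → i ℕ.< n → (ι (suc i) * ι (suc i) + - (τ * ι (suc i))) * I⁰ i ≡ 1#
  I⁰-unit i i<n = trans (solve 4 (λ x τ r e → (x :* x :- τ :* x) :* (r :* e) := (x :* r) :* ((x :- τ) :* e)) refl (ι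
      (suc i)) τ (r i) (e i))
    (trans (cong₂ _*_ (runit i i<n) (e-unit i i<n)) (*-identityˡ 1#))

  W-unit : ∀ i → i ℕ.< n → (ι (suc i) * ι (suc i) + τ * τ) * W i ≡ 1#
  W-unit i i<n = trans (cong (_* W i) (solve 3 (λ x P t → x :+ P :* t :* (P :* t) := x :+ P :* (t :* (P :* t))) refl (ι
      (suc i) * ι (suc i)) P t))
    (lift-unit (t * τ) (square-unit (runit i i<n)))

  r² V⁰ : ℕ → R
  r² i = r i * r i
  V⁰ j = ∏ j (λ i → (ι i + - ι n) * (1# + ¼ + - σ + ι i) * I⁰ i)

  r²-unit : ∀ i → i ℕ.< n → (ι (suc i) * ι (suc i) + 0#) * r² i ≡ 1#
  r²-unit i i<n = trans (cong (_* r² i) (+-identityʳ _)) (square-unit (runit i i<n))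

  -- The numerators agree modulo p, as 1 + ¼ - σ = 1 + n - 2τ. In the denominators the summand τ² =
  -- p²t² is added to x² - τx on one side and to x² on the other, and these bases agree modulo p.
  V-jet : ∀ j → j ℕ.≤ n → SameJet P² P (V j) (V⁰ j) (legendre-term (τ * τ) W n j) (legendre-term 0# r² n j)
  V-jet j j≤n = jet-∏ j (λ i i<j → jet-* (jet-const (≈-*ˡ (ι i + - ι n) (numerator i)))
      (jet-inverse (I-unit i (ℕ.<-≤-trans i<j j≤n)) (I⁰-unit i (ℕ.<-≤-trans i<j j≤n)) (W-unit i (ℕ.<-≤-trans i<j j≤n))
          (r²-unit i (ℕ.<-≤-trans i<j j≤n)) (denominator i)))
    where
    numerator : ∀ i → 1# + ¼ + - σ + ι i ≈ 1# + ι n + ι i [ P ]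
    numerator i = - (ι 2 * t) , combination₁ (- 1#) n+¼≡τ (solve 5 (λ a n i P t → :1 :+ a :- (:# 2 :* a :+ P :* t) :+ i :-
        (:1 :+ n :+ i :+ P :* :- (:# 2 :* t))
      := :- :1 :* (n :+ a :- P :* t)) refl ¼ (ι n) (ι i) P t)
    denominator : ∀ i → let x = ι (suc i) in SameJet P² P (x * x + - (τ * x) + τ * τ) (x * x + - (τ * x)) (x * x + τ * τ) (x * x + 0#)
    denominator i = jet {a = t * t} {b = - (t * ι (suc i))} {c = 0#}
      (solve 3 (λ x P t → x :* x :- P :* t :* x := x :* x :+ :# 0 :+ P :* :- (t :* x)) refl (ι (suc i)) P t)
      (solve 3 (λ x P t → x :* x :- P :* t :* x :+ P :* t :* (P :* t) := x :* x :- P :* t :* x :+ P :* P :* (t :* t)) refl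
          (ι (suc i)) P t)
      (solve 3 (λ x P t → x :* x :+ P :* t :* (P :* t) := x :* x :+ :# 0 :+ P :* P :* (t :* t :+ P :* :# 0)) refl (ι (suc i)) P t)

  ∏-neg : ∀ k f → ∏ k (λ i → - f i) ≡ sgn k * ∏ k f
  ∏-neg zero    f = sym (*-identityˡ 1#)
  ∏-neg (suc k) f = trans (cong (_* - f k) (∏-neg k f)) (solve 3 (λ s x y → s :* x :* :- y := :- s :* (x :* y)) refl (sgn k)
      (∏ k f) (f k))

  -- Without τ² the denominator is x(x - τ), so this is Chu-Vandermonde with c - b = ¼. In the
  -- resulting product the numerators ¼ + i = -((n - i) - τ) are, up to sign, the denominators in
  -- reverse order.
  ∑-V⁰ : ∑ (suc n) V⁰ ≡ sgn n
  ∑-V⁰ = begin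
    ∑ (suc n) V⁰
      ≡⟨ ∑-cong (suc n) (λ j _ → trans (∏-cong j (λ i _ → solve 4 (λ x y r e → x :* y :* (r :* e) := x :* r :*
          (y :* e)) refl (ι i + - ι n) (b + ι i) (r i) (e i)))
           (∏-* j (λ i → (ι i + - ι n) * r i) (λ i → (b + ι i) * e i))) ⟩
    ∑ (suc n) (λ j → falling-ratio r n j * ∏ j (λ i → (b + ι i) * e i))
      ≡⟨ chu-vandermonde n b c runit (λ i i<n → trans (cong (_* e i) (solve 2 (λ τ i → :1 :- τ :+ i := :1 :+ i :- τ) refl τ
          (ι i))) (e-unit i i<n)) ⟩
    ∏ n (λ i → (c + - b + ι i) * e i)
      ≡⟨ trans (∏-cong n (λ i _ → cong (_* e i) (solve 3 (λ τ a i → :1 :- τ :- (:1 :+ a :-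
          (:# 2 :* a :+ τ)) :+ i := a :+ i) refl τ ¼ (ι i)))) (∏-* n A e) ⟩
    ∏ n A * ∏ n e
      ≡⟨ trans (sym (*-identityˡ _)) (cong (_* (∏ n A * ∏ n e)) (sym (sgn-square n))) ⟩
    sgn n * sgn n * (∏ n A * ∏ n e)
      ≡⟨ solve 3 (λ s x y → s :* s :* (x :* y) := s :* (s :* x :* y)) refl (sgn n) (∏ n A) (∏ n e) ⟩
    sgn n * (sgn n * ∏ n A * ∏ n e)
      ≡⟨ cong (λ x → sgn n * (x * ∏ n e)) (trans (sym (∏-neg n A)) (trans (∏-cong n reflected) reverse)) ⟩
    sgn n * (∏ n g * ∏ n e)
      ≡⟨ trans (cong (sgn n *_) (∏-inverse n e-unit)) (*-identityʳ _) ⟩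
    sgn n ∎
    where
    open ≡-Reasoning
    b c : R
    b = 1# + ¼ + - σ
    c = 1# + - τ
    g : ℕ → R
    g i = ι (suc i) + - τ
    reflected : ∀ i → i ℕ.< n → - A i ≡ g (n ∸ suc i)
    reflected i i<n = trans (combination₁ (- 1#) n+¼≡τ (solve 4 (λ a n i τ → :- (a :+ i) :- (n :- i :- τ) := :- :1 :*
        (n :+ a :- τ)) refl ¼ (ι n) (ι i) τ))
      (cong (_+ - τ) (sym (ι-reflect n i i<n)))
    reverse : ∏ n (λ i → g (n ∸ suc i)) ≡ ∏ n g
    reverse = subst (λ N → ∏ n (λ i → g (N ∸ suc i)) ≡ ∏ N g) (ℕ.+-identityʳ n)
      (trans (sym (*-identityˡ _)) (∏-reverse-top n 0 g))

  ∑-V : ∑ (suc n) V ≈ sgn n + ι 2 * (τ * τ) * alternating-sum n r² [ P² * P ]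
  ∑-V = ≈-trans (≡⇒≈ rearrange) (≈-trans (≈-+ (≡⇒≈ ∑-V⁰) (≈-∑ (suc n) (λ { j (s≤s j≤n) → jet-difference (V-jet j j≤n) })))
    (≈-trans (≡⇒≈ evaluate) (≈-+ ≈-refl reduce)))
    where
    f f⁰ : ℕ → R
    f  = legendre-term (τ * τ) W n
    f⁰ = legendre-term 0# r² n
    rearrange : ∑ (suc n) V ≡ ∑ (suc n) V⁰ + ∑ (suc n) (λ j → V j + - V⁰ j)
    rearrange = trans (∑-cong (suc n) (λ j _ → solve 2 (λ x y → x := y :+ (x :- y)) refl (V j) (V⁰ j)))
      (∑-+ (suc n) V⁰ (λ j → V j + - V⁰ j))
    evaluate : sgn n + ∑ (suc n) (λ j → f j + - f⁰ j) ≡ sgn n + ι 2 * (τ * τ) * alternating-sum n W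
    evaluate = begin
      sgn n + ∑ (suc n) (λ j → f j + - f⁰ j)
        ≡⟨ cong (λ x → sgn n + x) (trans (∑-+ (suc n) f (λ j → - f⁰ j)) (cong (λ x → ∑ (suc n) f + x) (∑-neg (suc n) f⁰))) ⟩
      sgn n + (∑ (suc n) f + - ∑ (suc n) f⁰)
        ≡⟨ cong₂ (λ x y → sgn n + (x + - y)) (legendre-sum-closed (τ * τ) W n runit W-unit)
            (legendre-sum-closed 0# r² n runit r²-unit) ⟩
      sgn n + (sgn n + ι 2 * (τ * τ) * alternating-sum n W + - (sgn n + ι 2 * 0# * alternating-sum n r²))
        ≡⟨ solve 3 (λ s x y → s :+ (s :+ x :- (s :+ :# 2 :* :# 0 :* y)) := s :+ x) refl (sgn n) (ι 2 *
            (τ * τ) * alternating-sum n W) (alternating-sum n r²) ⟩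
      sgn n + ι 2 * (τ * τ) * alternating-sum n W ∎
      where open ≡-Reasoning
    -- τ² already carries p², so the inverses of k² + τ² are needed only modulo p.
    reduce : ι 2 * (τ * τ) * alternating-sum n W ≈ ι 2 * (τ * τ) * alternating-sum n r² [ P² * P ]
    reduce = scale (≈-alternating-sum n (λ i i<n → ≈-inverse (W-unit i i<n) (square-unit (runit i i<n)) (t * τ ,
        solve 3 (λ x P t → x :+ P :* t :* (P :* t) := x :+ P :* (t :* (P :* t))) refl (ι (suc i) * ι (suc i)) P t)))
      where
      scale : ∀ {x y} → x ≈ y [ P ] → ι 2 * (τ * τ) * x ≈ ι 2 * (τ * τ) * y [ P² * P ]
      scale {x} {y} (z , eq) = ι 2 * t * t * z , combination₁ (ι 2 * (τ * τ)) eq (solve 5 (λ x y P t z → let c = :# 2 :* (P :* t :* (P :* t)) in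
        c :* x :- (c :* y :+ P :* P :* P :* (:# 2 :* t :* t :* z)) := c :* (x :- (y :+ P :* z))) refl x y P t z)

  P≡ : P ≡ 1# + (ι n + (1# + ι q))
  P≡ = trans (cong ι (sym 1+n+1+q≡p)) (trans (ι-+ (suc n) (suc q)) (+-assoc _ _ _))

  4n+1≡4τ : ι 4 * ι n + 1# ≡ ι 4 * τ
  4n+1≡4τ = combination₂ (ι 4) (- 1#) n+¼≡τ 4¼ (solve 3 (λ a n τ → :# 4 :* n :+ :1 :- :# 4 :* τ := :# 4 :*
      (n :+ a :- τ) :+ :- :1 :* (:# 4 :* a :- :1)) refl ¼ (ι n) τ)

  -- Modulo p the term of index n + 1 + j is p³ times a constant times the
  -- inverse cube of the binomial coefficient of q over j.
  tail-sum : ∑ p (λ k → weight k * T⁰ k) ≈ ∑ (suc n) (λ k → weight k * T⁰ k) [ P³ * P ]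
  tail-sum = ≈-trans (≡⇒≈ (trans (cong (λ m → ∑ m (λ k → weight k * T⁰ k)) (sym 1+n+1+q≡p)) (∑-split (suc n) (suc q)
      (λ k → weight k * T⁰ k))))
    (≈-trans (≈-+ ≈-refl (≈-trans (≡⇒≈ extract) (≈-trans (≈-weaken c (P³ * P) (subst (λ d → P³ * c * S ≈ P³ * c * 0# [ d ])
        (solve 3 (λ x c P → x :* c :* P := c :* (x :* P)) refl P³ c P) (≈-scale (P³ * c) S≈0)))
      (≡⇒≈ (zeroʳ _))))) (≡⇒≈ (+-identityʳ _)))
    where
    c S : R
    E B′ : ℕ → R
    -- The factor of index n has numerator -(¼ + n)³ = -τ³. It enters every tail term and is the
    -- source of p³; `c` is the rest of the common factor.
    c = T⁰ n * - cube t * cube (r n)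
    E j = ∏ j (λ i → - cube (A (suc n ℕ.+ i)) * cube (r (suc n ℕ.+ i)))
    S = ∑ (suc q) (λ j → weight (suc n ℕ.+ j) * E j)
    extract : ∑ (suc q) (λ j → weight (suc n ℕ.+ j) * T⁰ (suc n ℕ.+ j)) ≡ P³ * c * S
    extract = trans (∑-cong (suc q) (λ j _ → trans (cong (weight (suc n ℕ.+ j) *_) (trans (∏-split (suc n) j _) (cong
        (λ x → T⁰ n * (- cube x * cube (r n)) * E j) (trans (+-comm _ _) n+¼≡τ))))
        (solve 6 (λ w y x z P t → w :* (y :* (:- (P :* t :* (P :* t) :* (P :* t)) :* x) :* z) := P :* P :* P :* (y :* :-
            (t :* t :* t) :* x) :* (w :* z)) refl (weight (suc n ℕ.+ j)) (T⁰ n) (cube (r n)) (E j) P t)))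
      (∑-*ˡ (suc q) (P³ * c) (λ j → weight (suc n ℕ.+ j) * E j))

    q<p : ∀ i → i ℕ.< q → suc i ℕ.< p
    q<p i i<q = ℕ.≤-trans (s≤s i<q) (subst (suc q ℕ.≤_) 1+n+1+q≡p (ℕ.m≤n+m (suc q) (suc n)))
    units : ∀ i → i ℕ.< q → cube (r i) * cube (ι (suc i)) ≡ 1#
    units i i<q = trans (*-comm _ _) (cube-unit (recip-unit i (q<p i i<q)))
    -- The two sequences are swapped relative to `B⁰`, which gives the inverse cube.
    B′ = gbinomial (λ i → cube (r i)) (λ i → cube (ι (suc i))) q units

    -- Modulo p, ¼ + n + 1 + i ≡ i + 1 because ¼ + n = τ, and n + 2 + i ≡ -(q - i) because n + q + 2
    -- = p.
    factor : ∀ i → i ℕ.< q → - cube (A (suc n ℕ.+ i)) * cube (r (suc n ℕ.+ i)) ≈ cube (r (q ∸ suc i)) * cube (ι (suc i)) [ P ]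
    factor i i<q = ≈-trans (≈-* (≈-neg (≈-cube numerator)) (≈-cube reciprocal))
      (≡⇒≈ (solve 2 (λ x y → :- (x :* x :* x) :* (:- y :* :- y :* :- y) := y :* y :* y :* (x :* x :* x)) refl (ι (suc i)) (r
          (q ∸ suc i))))
      where
      ≈-cube : ∀ {x y} → x ≈ y [ P ] → cube x ≈ cube y [ P ]
      ≈-cube x≈y = ≈-* (≈-* x≈y x≈y) x≈y
      numerator : A (suc n ℕ.+ i) ≈ ι (suc i) [ P ]
      numerator = t , combination₂ 1# 1# n+¼≡τ (ι-+ (suc n) i)
        (solve 6 (λ a n i P t x → a :+ x :- (:1 :+ i :+ P :* t) := :1 :* (n :+ a :- P :* t) :+ :1 :* (x :-
            (:1 :+ n :+ i))) refl ¼ (ι n) (ι i) P t (ι (suc n ℕ.+ i)))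
      i′<q : q ∸ suc i ℕ.< q
      i′<q = ℕ.∸-monoʳ-< {q} {suc i} {0} z<s i<q
      reciprocal : r (suc n ℕ.+ i) ≈ - r (q ∸ suc i) [ P ]
      reciprocal = ≈-inverse (recip-unit (suc n ℕ.+ i) (subst (suc (suc n ℕ.+ i) ℕ.<_) 1+n+1+q≡p (subst
          (ℕ._< suc n ℕ.+ suc q) (ℕ.+-suc (suc n) i) (ℕ.+-monoʳ-< (suc n) (s<s i<q)))))
        (trans (solve 2 (λ x y → :- x :* :- y := x :* y) refl _ _) (recip-unit (q ∸ suc i) (q<p _ i′<q)))
        (1# , combination₃ 1# 1# (- 1#) (ι-+ (suc n) i) (ι-reflect q i i<q) P≡
          (solve 6 (λ n q i x y P → :1 :+ x :- (:- y :+ P :* :1) := :1 :* (x :- (:1 :+ n :+ i)) :+ :1 :* (y :-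
              (q :- i)) :+ :- :1 :* (P :- (:1 :+ (n :+ (:1 :+ q))))) refl (ι n) (ι q) (ι i) (ι (suc n ℕ.+ i)) (ι (suc
                  (q ∸ suc i))) P))

    S≈0 : S ≈ 0# [ P ]
    S≈0 = ≈-trans (≈-∑ (suc q) (λ { j (s≤s j≤q) → ≈-* (weight-mod j) (≈-∏ j (λ i i<j → factor i (ℕ.<-≤-trans i<j j≤q))) }))
      (≡⇒≈ (trans (∑-cong (suc q) (λ j _ → *-assoc (ι 4) (ι 2 * ι j + - ι q) (B′ j)))
        (trans (∑-*ˡ (suc q) (ι 4) (λ j → (ι 2 * ι j + - ι q) * B′ j))
        (trans (cong (ι 4 *_) (antisymmetric-∑ 2½ q B′ (gbinomial-symmetric _ _ q units))) (zeroʳ _)))))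
      where
      -- The exact difference of the two sides is (4n + 1) + 4(n + q + 2) = 4τ + 4p.
      weight-mod : ∀ j → weight (suc n ℕ.+ j) ≈ ι 4 * (ι 2 * ι j + - ι q) [ P ]
      weight-mod j = ι 4 + ι 4 * t , combination₃ (ι 8) (- ι 4) 1# (ι-+ (suc n) j) P≡ 4n+1≡4τ
        (solve 6 (λ n q j x P t → :1 :+ :# 8 :* x :- (:# 4 :* (:# 2 :* j :- q) :+ P :* (:# 4 :+ :# 4 :* t))
          := :# 8 :* (x :- (:1 :+ n :+ j)) :+ :- :# 4 :* (P :- (:1 :+ (n :+ (:1 :+ q)))) :+ :1 :*
              (:# 4 :* n :+ :1 :- :# 4 :* (P :* t))) refl (ι n) (ι q) (ι j) (ι (suc n ℕ.+ j)) P t)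

  neg-^-even : ∀ x k → (- x) ^ (k ℕ.+ k) ≡ x ^ (k ℕ.+ k)
  neg-^-even x zero    = refl
  neg-^-even x (suc k) rewrite ℕ.+-suc k k = trans (cong (λ y → - x * (- x * y)) (neg-^-even x k))
    (solve 2 (λ x y → :- x :* (:- x :* y) := x :* (x :* y)) refl x (x ^ (k ℕ.+ k)))

  fermat-local : ∀ p′ → p ≡ suc p′ → ∀ i → suc i ℕ.< p → ι (suc i) ^ p′ ≈ 1# [ P ]
  fermat-local p′ p≡ i i<p = subst (λ m → ι (suc i) ^ p′ ≈ 1# [ ι m ]) (sym p≡)
    (fermat-unit p′ r (λ j j<p → recip-unit j (subst (suc j ℕ.<_) (sym p≡) (s<s j<p))) i (ℕ.s<s⁻¹ (subst (suc i ℕ.<_) p≡ i<p)))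

  module _ (k : ℕ) (p≡3+m : p ≡ 3 ℕ.+ (suc k ℕ.+ suc k))
    (E : R → R) (E-step : ∀ x → E (x + 1#) + E x ≡ ι 2 * x ^ (suc k ℕ.+ suc k))
    (E-cong : ∀ {x y} → x ≈ y [ P ] → E x ≈ E y [ P ]) where

    private
      m : ℕ
      m = suc k ℕ.+ suc k
      power : ℕ → R
      power i = (- ι (suc i)) ^ m

    -- The difference equation solved downwards from 0 in unit steps.
    E-neg : ∀ j → E (- ι j) ≡ sgn j * E 0# + ι 2 * alternating-sum j power
    E-neg zero    = trans (cong E (solve 0 (:- :# 0 := :# 0) refl)) (solve 1 (λ x → x := :1 :* x :+ :# 2 :* :# 0) refl (E 0#))
    E-neg (suc j) = combination₃ 1# (- 1#) (- 1#) (E-step (- ι (suc j))) (E-neg j)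
      (cong E (solve 1 (λ j → :- (:1 :+ j) :+ :1 := :- j) refl (ι j)))
      (solve 7 (λ x y y′ z s a w → x :- (:- s :* z :+ :# 2 :* (:- a :+ w))
        := :1 :* (y′ :+ x :- :# 2 :* w) :+ :- :1 :* (y :- (s :* z :+ :# 2 :* a)) :+ :- :1 :* (y′ :- y)) refl
        (E (- ι (suc j))) (E (- ι j)) (E (- ι (suc j) + 1#)) (E 0#) (sgn j) (alternating-sum j power) (power j))

    sgn-p : sgn p ≡ - 1#
    sgn-p = trans (cong sgn p≡3+m) (trans (cong (λ x → - - - x) (sgn-even (suc k))) (solve 1 (λ x → :- :- :- x := :- x) refl 1#))

    -- The length p - 1 is even, so reversal changes all signs, while i ↦ p - i preserves the even
    -- power modulo p. The sum is congruent to its own negative.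
    palindrome : alternating-sum (2 ℕ.+ m) power ≈ 0# [ P ]
    palindrome = ≈-cancelˡ-unit 2½ (≈-trans (≡⇒≈ (solve 1 (λ x → :# 2 :* x := x :+ x) refl a))
      (≈-trans (≈-+ (≈-trans (≈-alternating-sum (2 ℕ.+ m) reflect) (≡⇒≈ (alternating-sum-reverse (2 ℕ.+ m) power))) ≈-refl)
        (≡⇒≈ (trans (cong (λ x → - (x * a) + a) (trans (solve 1 (λ x → :- :- x := x) refl _) (sgn-even (suc k))))
          (solve 1 (λ a → :- (:1 :* a) :+ a := :# 2 :* :# 0) refl a)))))
      where
      a : R
      a = alternating-sum (2 ℕ.+ m) power
      P≡3+m : P ≡ 1# + ι (2 ℕ.+ m)
      P≡3+m = cong ι p≡3+m
      reflect : ∀ i → i ℕ.< 2 ℕ.+ m → power i ≈ power (2 ℕ.+ m ∸ suc i) [ P ]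
      reflect i i<p = ≈-trans (≡⇒≈ (neg-^-even (ι (suc i)) (suc k))) (≈-^ m (1# , combination₂ (- 1#) 1# P≡3+m (ι-reflect
          (2 ℕ.+ m) i i<p)
        (solve 4 (λ i x P M → :1 :+ i :- (:- x :+ P :* :1) := :- :1 :* (P :- (:1 :+ M)) :+ :1 :* (x :- (M :- i))) refl (ι i)
            (ι (suc (2 ℕ.+ m ∸ suc i))) P (ι (2 ℕ.+ m)))))

    -- E(0) ≡ E(−p) = −E(0) + 2 Σ, where Σ is palindromic modulo p.
    E-0 : E 0# ≈ 0# [ P ]
    E-0 = ≈-cancelˡ-unit 2½ (≈-trans (≡⇒≈ (solve 2 (λ x y → :# 2 :* x := x :- :- x) refl (E 0#) 0#))
      (≈-trans (≈-+ (≈-trans (E-cong (1# , solve 1 (λ P → :# 0 := :- P :+ P :* :1) refl P)) (≡⇒≈ (E-neg p))) ≈-refl)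
        (≈-trans (≡⇒≈ (trans (cong (λ x → x * E 0# + ι 2 * alternating-sum p power + - - E 0#) sgn-p) (solve 2
            (λ x y → :- :1 :* x :+ y :- :- x := y) refl (E 0#) (ι 2 * alternating-sum p power))))
          (≈-*ˡ (ι 2) vanish))))
      where
      vanish : alternating-sum p power ≈ 0# [ P ]
      vanish = subst (λ l → alternating-sum l power ≈ 0# [ P ]) (sym p≡3+m)
        -- The remaining summand of index p is (-p)^m, which vanishes modulo p because the exponent
        -- is positive.
        (≈-trans (≈-+ (≈-neg palindrome) (≈-trans (≈-^ m -p≈0) (≡⇒≈ (zeroˡ _)))) (≡⇒≈ (solve 0 (:- :# 0 :+ :# 0 := :# 0) refl)))
        where
        -p≈0 : - ι (3 ℕ.+ m) ≈ 0# [ P ]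
        -p≈0 = - 1# , trans (cong (λ l → - ι l) (sym p≡3+m)) (solve 1 (λ P → :- P := :# 0 :+ P :* :- :1) refl P)

    -- Multiplied by (i+1)², both sides become 1: the left one by Fermat, as m + 2 = p - 1.
    power≈r² : ∀ i → i ℕ.< n → power i ≈ r² i [ P ]
    power≈r² i i<n = ≈-trans (≡⇒≈ (neg-^-even x (suc k))) (≈-cancelˡ-unit (square-unit (runit i i<n))
      (≈-trans (≡⇒≈ (*-assoc _ _ _)) (≈-trans (fermat-local (2 ℕ.+ m) p≡3+m i (ℕ.<-≤-trans (s<s i<n) n<p)) (≡⇒≈ (sym
          (square-unit (runit i i<n)))))))
      where
      x : R
      x = ι (suc i)

    E-¼ : E ¼ ≈ ι 2 * alternating-sum n r² [ P ]
    E-¼ = ≈-trans (E-cong (t , combination₁ 1# n+¼≡τ (solve 4 (λ a n P t → a :- (:- n :+ P :* t) := :1 :*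
        (n :+ a :- P :* t)) refl ¼ (ι n) P t)))
      (≈-trans (≡⇒≈ (E-neg n)) (≈-trans (≈-+ (≈-*ˡ (sgn n) E-0) (≈-*ˡ (ι 2) (≈-alternating-sum n power≈r²)))
        (≡⇒≈ (solve 2 (λ s y → s :* :# 0 :+ y := y) refl (sgn n) (ι 2 * alternating-sum n r²)))))

    supercongruence : ∑ (suc n) (λ k → weight k * T⁰ k) ≈ ι 3 * P * sgn n + ι 27 * (¼ * ¼) * P³ * E ¼ [ P³ * P ]
    supercongruence = ≈-trans (≈-sym T-sums) (≈-trans (≡⇒≈ whipple-sum) (combine ∑-V E-¼))
      where
      combine : ∀ {v a x} → v ≈ sgn n + ι 2 * (τ * τ) * a [ P² * P ] → x ≈ ι 2 * a [ P ] →
                ι 4 * τ * v ≈ ι 3 * P * sgn n + ι 27 * (¼ * ¼) * P³ * x [ P³ * P ]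
      -- With b = ¼, 4τ · 2τ² = 216 b³p³ = 54 b²p³ · 4b, and 4b = 1 leaves 27 b²p³ · 2: this is
      -- 27/16 p³ times the 2 of `E-¼`.
      combine {v} {a} {x} (y , v≡) (z , x≡) = ι 4 * t * y + - (ι 27 * (¼ * ¼) * z) ,
        combination₃ (ι 4 * τ) (- (ι 27 * (¼ * ¼) * P³)) (ι 3 * P * sgn n + ι 54 * (¼ * ¼) * P³ * a) v≡ x≡ 4¼
          (solve 8 (λ b P s v a x y z → let t = :# 3 :* b ; τ = P :* t ; d = P :* P :* P in
             :# 4 :* τ :* v :- (:# 3 :* P :* s :+ :# 27 :* (b :* b) :* d :* x :+ d :* P :* (:# 4 :* t :* y :- :# 27 :*
                 (b :* b) :* z))
             := :# 4 :* τ :* (v :- (s :+ :# 2 :* (τ :* τ) :* a :+ d :* y))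
                :+ :- (:# 27 :* (b :* b) :* d) :* (x :- (:# 2 :* a :+ P :* z))
                :+ (:# 3 :* P :* s :+ :# 54 :* (b :* b) :* d :* a) :* (:# 4 :* b :- :1)) refl ¼ P (sgn n) v a x y z)

-- Ring identities for use in ℚ and in the localization, solved without unfolding rational
-- arithmetic.

module Rearrangements (𝑹 : Ring≡) where
  open RingLemmas 𝑹

  ι-^ : ∀ m k → ι (m ℕ.^ k) ≡ ι m ^ k
  ι-^ m zero    = +-identityʳ 1#
  ι-^ m (suc k) = trans (ι-* m (m ℕ.^ k)) (cong (ι m *_) (ι-^ m k))

  ι-fourth-power : ∀ m → ι m * ι m * ι m * ι m ≡ ι (m ℕ.^ 4)
  ι-fourth-power m = sym (trans (ι-^ m 4) (solve 1 (λ x → x :^ 4 := x :* x :* x :* x) refl (ι m)))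

  weight-cast : ∀ k → 1# + ι 8 * ι k ≡ ι (8 ℕ.* k ℕ.+ 1)
  weight-cast k = sym (trans (ι-+ (8 ℕ.* k) 1) (trans (cong (_+ ι 1) (ι-* 8 k)) (solve 1
      (λ x → :# 8 :* x :+ :# 1 := :1 :+ :# 8 :* x) refl (ι k))))

  rhs-cast : ∀ m s a x → ι 3 * ι m * s + ι 27 * (a * a) * (ι m * ι m * ι m) * x ≡ ι (3 ℕ.* m) * s + ι (27 ℕ.* m ℕ.^ 3) *
      (a * a) * x
  rhs-cast m s a x = trans (solve 4 (λ m s a x → :# 3 :* m :* s :+ :# 27 :* (a :* a) :*
      (m :* m :* m) :* x := :# 3 :* m :* s :+ :# 27 :* m :^ 3 :* (a :* a) :* x) refl (ι m) s a x)
    (cong₂ (λ y z → y * s + z * (a * a) * x) (sym (ι-* 3 m)) (sym (trans (ι-* 27 (m ℕ.^ 3)) (cong (ι 27 *_) (ι-^ m 3)))))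

  minus-one-* : ∀ x → - x ≡ - 1# * x
  minus-one-* = solve 1 (λ x → :- x := :- :1 :* x) refl

  reorder : ∀ s w x → s * w * x ≡ w * (s * x)
  reorder = solve 3 (λ s w x → s :* w :* x := w :* (s :* x)) refl

  subtract-left : ∀ y z → y + z + - y ≡ z
  subtract-left = solve 2 (λ y z → y :+ z :- y := z) refl

  sum-lemma : ∀ x y a b → (x + y) * (a * b) ≡ x * a * b + y * b * a
  sum-lemma = solve 4 (λ x y a b → (x :+ y) :* (a :* b) := x :* a :* b :+ y :* b :* a) refl

  product-lemma : ∀ x y a b → (x * y) * (a * b) ≡ (x * a) * (y * b)
  product-lemma = solve 4 (λ x y a b → (x :* y) :* (a :* b) := (x :* a) :* (y :* b)) refl

  distribute : ∀ p z d → (1# + p * z) * d ≡ d + p * (z * d)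
  distribute = solve 3 (λ p z d → (:1 :+ p :* z) :* d := d :+ p :* (z :* d)) refl

  swap : ∀ x a b → x * a * b ≡ x * b * a
  swap = solve 3 (λ x a b → x :* a :* b := x :* b :* a) refl

  factor-units : ∀ a b x y → a * x ≡ 1# → b * y ≡ 1# → (a * b) * (y * x) ≡ 1#
  factor-units a b x y ax by = trans (solve 4 (λ a b x y → (a :* b) :* (y :* x) := (a :* x) :* (b :* y)) refl a b x y)
    (trans (cong₂ _*_ ax by) (*-identityˡ 1#))

  term-step : ∀ s P F r x → - 1# * s * ((P * x) ^ 3 * (F * r) ^ 3) ≡ s * (P ^ 3 * F ^ 3) * (- (x * x * x) * (r * r * r))
  term-step s P F r x = solve 5 (λ s P F r x → :- :1 :* s :* ((P :* x) :^ 3 :* (F :* r) :^ 3) := s :* (P :^ 3 :* F :^ 3) :*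
      (:- (x :* x :* x) :* (r :* r :* r))) refl s P F r x

  scale-sum : ∀ F h h′ c e f → F * f ≡ 1# → h′ + h ≡ c * (e * f) → F * h′ + F * h ≡ c * e
  scale-sum F h h′ c e f Ff eq = combination₂ F (c * e) eq Ff
    (solve 6 (λ F h h′ c e f → F :* h′ :+ F :* h :- c :* e := F :* (h′ :+ h :- c :* (e :* f)) :+ c :* e :*
        (F :* f :- :1)) refl F h h′ c e f)

-- Rational numbers, the localization of ℤ at p, and its elements as p-adic integers.

open import Data.Rational.Base using (_+_; _*_; -_; _-_)
open import Defs
open ℤₚ

ℚ-ring : Ring≡
ℚ-ring = record { isCommutativeRing = ℚ.+-*-isCommutativeRing }

fromℚᵘ-+ : ∀ x y → fromℚᵘ (x ℚᵘ.+ y) ≡ fromℚᵘ x ℚ.+ fromℚᵘ y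
fromℚᵘ-+ x y = ℚ.toℚᵘ-injective (ℚᵘ.≃-trans (ℚ.toℚᵘ-fromℚᵘ (x ℚᵘ.+ y)) (ℚᵘ.≃-sym
  (ℚᵘ.≃-trans (ℚ.toℚᵘ-homo-+ (fromℚᵘ x) (fromℚᵘ y)) (ℚᵘ.+-cong (ℚ.toℚᵘ-fromℚᵘ x) (ℚ.toℚᵘ-fromℚᵘ y)))))

fromℚᵘ-* : ∀ x y → fromℚᵘ (x ℚᵘ.* y) ≡ fromℚᵘ x ℚ.* fromℚᵘ y
fromℚᵘ-* x y = ℚ.toℚᵘ-injective (ℚᵘ.≃-trans (ℚ.toℚᵘ-fromℚᵘ (x ℚᵘ.* y)) (ℚᵘ.≃-sym
  (ℚᵘ.≃-trans (ℚ.toℚᵘ-homo-* (fromℚᵘ x) (fromℚᵘ y)) (ℚᵘ.*-cong (ℚ.toℚᵘ-fromℚᵘ x) (ℚ.toℚᵘ-fromℚᵘ y)))))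

-- Abstract, so that i / 1 is never normalised.
abstract
  int : ℤ → ℚ
  int i = i / 1

  int-def : ∀ i → i / 1 ≡ int i
  int-def i = refl

  int-+ : ∀ i j → int (i ℤ.+ j) ≡ int i ℚ.+ int j
  int-+ i j = trans (ℚ.fromℚᵘ-cong {mkℚᵘ (i ℤ.+ j) 0} {mkℚᵘ i 0 ℚᵘ.+ mkℚᵘ j 0} (*≡* (lemma i j))) (fromℚᵘ-+ (mkℚᵘ i 0) (mkℚᵘ j 0))
    where
    lemma : ∀ i j → (i ℤ.+ j) ℤ.* + 1 ≡ (i ℤ.* + 1 ℤ.+ j ℤ.* + 1) ℤ.* + 1
    lemma = ℤSolver.solve-∀

  int-* : ∀ i j → int (i ℤ.* j) ≡ int i ℚ.* int j
  int-* i j = fromℚᵘ-* (mkℚᵘ i 0) (mkℚᵘ j 0)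

  int-injective : ∀ {i j} → int i ≡ int j → i ≡ j
  int-injective {i} {j} eq with ℚ.fromℚᵘ-injective {mkℚᵘ i 0} {mkℚᵘ j 0} eq
  ... | *≡* eq′ = trans (sym (ℤ.*-identityʳ i)) (trans eq′ (ℤ.*-identityʳ j))

  /-clear : ∀ i d .{{_ : ℕ.NonZero d}} → (i / d) ℚ.* int (+ d) ≡ int i
  /-clear i (suc d) = trans (sym (fromℚᵘ-* (mkℚᵘ i d) (mkℚᵘ (+ suc d) 0))) (ℚ.fromℚᵘ-cong {mkℚᵘ i d ℚᵘ.* mkℚᵘ
      (+ suc d) 0} {mkℚᵘ i 0} (*≡* (ℤ.*-assoc i (+ suc d) (+ 1))))

denominator-clear : ∀ x → x ℚ.* int (↧ x) ≡ int (↥ x)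
denominator-clear x = trans (cong (ℚ._* int (↧ x)) (sym (ℚ.↥p/↧p≡p x))) (/-clear (↥ x) (↧ₙ x))

1/-unit : ∀ d .{{_ : ℕ.NonZero d}} → int (+ d) ℚ.* (+ 1 / d) ≡ 1ℚ
1/-unit d = trans (ℚ.*-comm (int (+ d)) (+ 1 / d)) (trans (/-clear (+ 1) d) (sym (int-def (+ 1))))

denominator-divides : ∀ x d a → x ℚ.* int d ≡ int a → ↧ₙ x ℕ.∣ ∣ d ∣
denominator-divides x@(mkℚ _ _ coprime) d a xd≡a = coprime-divisor (ℕ.sym (ℕ.recompute coprime))
  (ℕ.divides ∣ a ∣ (trans (sym (ℤ.abs-* (↥ x) d)) (trans (cong ∣_∣ numerators) (ℤ.abs-* a (↧ x)))))
  where
  open ≡-Reasoning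
  numerators : ↥ x ℤ.* d ≡ a ℤ.* ↧ x
  numerators = int-injective (begin
    int (↥ x ℤ.* d)                   ≡⟨ int-* (↥ x) d ⟩
    int (↥ x) ℚ.* int d               ≡⟨ cong (ℚ._* int d) (sym (denominator-clear x)) ⟩
    x ℚ.* int (↧ x) ℚ.* int d         ≡⟨ ℚ.*-assoc x (int (↧ x)) (int d) ⟩
    x ℚ.* (int (↧ x) ℚ.* int d)       ≡⟨ cong (x ℚ.*_) (ℚ.*-comm (int (↧ x)) (int d)) ⟩
    x ℚ.* (int d ℚ.* int (↧ x))       ≡⟨ sym (ℚ.*-assoc x (int d) (int (↧ x))) ⟩
    x ℚ.* int d ℚ.* int (↧ x)         ≡⟨ cong (ℚ._* int (↧ x)) xd≡a ⟩
    int a ℚ.* int (↧ x)               ≡⟨ sym (int-* a (↧ x)) ⟩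
    int (a ℤ.* ↧ x)                   ∎)

module _ {p : ℕ} (p-prime : Prime p) where

  Integral : ℚ → Set
  Integral x = ¬ p ℕ.∣ ↧ₙ x

  -- Any denominator prime to p suffices: the reduced one divides it. Reduced denominators of sums
  -- and products thus need not be computed.
  clear⇒integral : ∀ x d a → ¬ p ℕ.∣ ∣ d ∣ → x ℚ.* int d ≡ int a → Integral x
  clear⇒integral x d a p∤d eq p∣x = p∤d (ℕ.∣-trans p∣x (denominator-divides x d a eq))

  p∤-* : ∀ {m n} → ¬ p ℕ.∣ m → ¬ p ℕ.∣ n → ¬ p ℕ.∣ m ℕ.* n
  p∤-* {m} {n} p∤m p∤n p∣mn with euclidsLemma m n p-prime p∣mn
  ... | inj₁ p∣m = p∤m p∣m
  ... | inj₂ p∣n = p∤n p∣n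

  p∤-∣*∣ : ∀ {i j} → ¬ p ℕ.∣ ∣ i ∣ → ¬ p ℕ.∣ ∣ j ∣ → ¬ p ℕ.∣ ∣ i ℤ.* j ∣
  p∤-∣*∣ {i} {j} p∤i p∤j = subst (λ k → ¬ p ℕ.∣ k) (sym (ℤ.abs-* i j)) (p∤-* p∤i p∤j)

  p∤1 : ¬ p ℕ.∣ 1
  p∤1 p∣1 = ℕ.nonTrivial⇒≢1 {{prime⇒nonTrivial p-prime}} (ℕ.∣1⇒≡1 p∣1)

  p∤<p : ∀ {k} → suc k ℕ.< p → ¬ p ℕ.∣ suc k
  p∤<p k<p p∣k = ℕ.<⇒≱ k<p (ℕ.∣⇒≤ p∣k)

  private module Q = RingLemmas ℚ-ring

  integral-+ : ∀ x y → Integral x → Integral y → Integral (x ℚ.+ y)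
  integral-+ x y p∤x p∤y = clear⇒integral (x ℚ.+ y) (↧ x ℤ.* ↧ y) (↥ x ℤ.* ↧ y ℤ.+ ↥ y ℤ.* ↧ x) (p∤-∣*∣ {↧ x} {↧ y} p∤x p∤y)
      (begin
    (x ℚ.+ y) ℚ.* int (↧ x ℤ.* ↧ y)
      ≡⟨ cong ((x ℚ.+ y) ℚ.*_) (int-* (↧ x) (↧ y)) ⟩
    (x ℚ.+ y) ℚ.* (int (↧ x) ℚ.* int (↧ y))
      ≡⟨ Rearrangements.sum-lemma ℚ-ring x y (int (↧ x)) (int (↧ y)) ⟩
    x ℚ.* int (↧ x) ℚ.* int (↧ y) ℚ.+ y ℚ.* int (↧ y) ℚ.* int (↧ x)
      ≡⟨ cong₂ (λ u v → u ℚ.* int (↧ y) ℚ.+ v ℚ.* int (↧ x)) (denominator-clear x) (denominator-clear y) ⟩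
    int (↥ x) ℚ.* int (↧ y) ℚ.+ int (↥ y) ℚ.* int (↧ x)
      ≡⟨ cong₂ ℚ._+_ (sym (int-* (↥ x) (↧ y))) (sym (int-* (↥ y) (↧ x))) ⟩
    int (↥ x ℤ.* ↧ y) ℚ.+ int (↥ y ℤ.* ↧ x)
      ≡⟨ sym (int-+ (↥ x ℤ.* ↧ y) (↥ y ℤ.* ↧ x)) ⟩
    int (↥ x ℤ.* ↧ y ℤ.+ ↥ y ℤ.* ↧ x) ∎)
    where open ≡-Reasoning

  integral-* : ∀ x y → Integral x → Integral y → Integral (x ℚ.* y)
  integral-* x y p∤x p∤y = clear⇒integral (x ℚ.* y) (↧ x ℤ.* ↧ y) (↥ x ℤ.* ↥ y) (p∤-∣*∣ {↧ x} {↧ y} p∤x p∤y) (begin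
    (x ℚ.* y) ℚ.* int (↧ x ℤ.* ↧ y)
      ≡⟨ cong ((x ℚ.* y) ℚ.*_) (int-* (↧ x) (↧ y)) ⟩
    (x ℚ.* y) ℚ.* (int (↧ x) ℚ.* int (↧ y))
      ≡⟨ Rearrangements.product-lemma ℚ-ring x y (int (↧ x)) (int (↧ y)) ⟩
    (x ℚ.* int (↧ x)) ℚ.* (y ℚ.* int (↧ y))
      ≡⟨ cong₂ ℚ._*_ (denominator-clear x) (denominator-clear y) ⟩
    int (↥ x) ℚ.* int (↥ y)
      ≡⟨ sym (int-* (↥ x) (↥ y)) ⟩
    int (↥ x ℤ.* ↥ y) ∎)
    where open ≡-Reasoning

  integral-neg : ∀ x → Integral x → Integral (ℚ.- x)
  integral-neg x p∤x = subst (λ d → ¬ p ℕ.∣ ∣ d ∣) (sym (ℚ.↧-neg x)) p∤x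

  integral-int : ∀ i → Integral (int i)
  integral-int i = clear⇒integral (int i) (+ 1) i p∤1 (trans (sym (int-* i (+ 1))) (cong int (ℤ.*-identityʳ i)))

  -- Integrality is irrelevant, so elements with equal values are equal and the ring laws are
  -- inherited from ℚ as propositional equalities.
  record ℤ₍ₚ₎ : Set where
    constructor _#_
    field
      value     : ℚ
      .integral : Integral value
  open ℤ₍ₚ₎

  value-injective : ∀ {x y} → value x ≡ value y → x ≡ y
  value-injective refl = refl

  _⊞_ _⊠_ : ℤ₍ₚ₎ → ℤ₍ₚ₎ → ℤ₍ₚ₎
  (x # i) ⊞ (y # j) = (x ℚ.+ y) # integral-+ x y i j
  (x # i) ⊠ (y # j) = (x ℚ.* y) # integral-* x y i j

  ⊟_ : ℤ₍ₚ₎ → ℤ₍ₚ₎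
  ⊟ (x # i) = (ℚ.- x) # integral-neg x i

  localization : Ring≡
  localization = record
    { Carrier = ℤ₍ₚ₎ ; _+_ = _⊞_ ; _*_ = _⊠_ ; -_ = ⊟_ ; 0# = 0ℚ # p∤1 ; 1# = 1ℚ # p∤1
    ; isCommutativeRing = record
      { isRing = record
        { +-isAbelianGroup = record
          { isGroup = record
            { isMonoid = record
              { isSemigroup = record
                { isMagma = record { isEquivalence = isEquivalence ; ∙-cong = cong₂ _⊞_ }
                ; assoc = λ x y z → value-injective (ℚ.+-assoc (value x) (value y) (value z)) }
              ; identity = (λ x → value-injective (ℚ.+-identityˡ (value x))) , (λ x → value-injective (ℚ.+-identityʳ (value x))) }
            ; inverse = (λ x → value-injective (ℚ.+-inverseˡ (value x))) , (λ x → value-injective (ℚ.+-inverseʳ (value x)))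
            ; ⁻¹-cong = cong ⊟_ }
          ; comm = λ x y → value-injective (ℚ.+-comm (value x) (value y)) }
        ; *-cong = cong₂ _⊠_
        ; *-assoc = λ x y z → value-injective (ℚ.*-assoc (value x) (value y) (value z))
        ; *-identity = (λ x → value-injective (ℚ.*-identityˡ (value x))) , (λ x → value-injective (ℚ.*-identityʳ (value x)))
        ; distrib = (λ x y z → value-injective (ℚ.*-distribˡ-+ (value x) (value y) (value z)))
                  , (λ x y z → value-injective (ℚ.*-distribʳ-+ (value x) (value y) (value z))) }
      ; *-comm = λ x y → value-injective (ℚ.*-comm (value x) (value y)) } }

  private module L = RingLemmas localization

  value-ι : ∀ k → value (L.ι k) ≡ int (+ k)
  value-ι zero    = int-def (+ 0)
  value-ι (suc k) = trans (cong₂ ℚ._+_ (int-def (+ 1)) (value-ι k)) (sym (int-+ (+ 1) (+ k)))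

  reciprocal : ℕ → ℤ₍ₚ₎
  reciprocal i with suc i ℕ.<? p
  ... | yes i<p = (+ 1 / suc i) # clear⇒integral (+ 1 / suc i) (+ suc i) (+ 1) (p∤<p i<p) (/-clear (+ 1) (suc i))
  -- A filler for i + 1 ≥ p, where 1/(i+1) need not be p-integral.
  ... | no  _   = 0ℚ # p∤1

  value-reciprocal : ∀ i → suc i ℕ.< p → value (reciprocal i) ≡ + 1 / suc i
  value-reciprocal i i<p with suc i ℕ.<? p
  ... | yes _   = refl
  ... | no  i≮p = contradiction i<p i≮p

  module _ (z : ℚ) .(z-integral : Integral z) where
    private
      w : ℚ
      w = 1ℚ ℚ.+ int (+ p) ℚ.* z
      D : ℤ
      D = ↧ z ℤ.+ + p ℤ.* ↥ z

      w-clear : w ℚ.* int (↧ z) ≡ int D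
      w-clear = begin
        w ℚ.* int (↧ z)
          ≡⟨ Rearrangements.distribute ℚ-ring (int (+ p)) z (int (↧ z)) ⟩
        int (↧ z) ℚ.+ int (+ p) ℚ.* (z ℚ.* int (↧ z))
          ≡⟨ cong (λ y → int (↧ z) ℚ.+ int (+ p) ℚ.* y) (denominator-clear z) ⟩
        int (↧ z) ℚ.+ int (+ p) ℚ.* int (↥ z)
          ≡⟨ cong (int (↧ z) ℚ.+_) (sym (int-* (+ p) (↥ z))) ⟩
        int (↧ z) ℚ.+ int (+ p ℤ.* ↥ z)
          ≡⟨ sym (int-+ (↧ z) (+ p ℤ.* ↥ z)) ⟩
        int D ∎
        where open ≡-Reasoning

      -- `D` is congruent to the denominator of `z` modulo p. It is the numerator of 1 + pz over
      -- that denominator, hence a denominator for the inverse.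
      p∤D : ¬ p ℕ.∣ ∣ D ∣
      p∤D p∣D = ⊥-elim (z-integral (ℤ.∣⇒∣ᵤ {+ p} {↧ z} (ℤ.∣m+n∣n⇒∣m {+ p} {↧ z} {+ p ℤ.* ↥ z}
        (ℤ.∣ᵤ⇒∣ p∣D) (∣m⇒∣m*n (↥ z) (divides (+ 1) (sym (ℤ.*-identityˡ (+ p))))))))

      w≢0 : w ≢ 0ℚ
      w≢0 w≡0 = p∤D (subst (λ i → p ℕ.∣ ∣ i ∣) (sym D≡0) (p ℕ.∣0))
        where
        D≡0 : D ≡ + 0
        D≡0 = int-injective (trans (sym w-clear) (trans (cong (ℚ._* int (↧ z)) w≡0) (trans (ℚ.*-zeroˡ (int (↧ z))) (int-def
            (+ 0)))))

      instance
        w-nonZero : ℚ.NonZero w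
        w-nonZero = ℚ.≢-nonZero w≢0

    near-one-inverse : ℤ₍ₚ₎
    near-one-inverse = (ℚ.1/ w) # clear⇒integral (ℚ.1/ w) D (↧ z) p∤D (begin
      ℚ.1/ w ℚ.* int D                          ≡⟨ cong (ℚ.1/ w ℚ.*_) (sym w-clear) ⟩
      ℚ.1/ w ℚ.* (w ℚ.* int (↧ z))      ≡⟨ sym (ℚ.*-assoc (ℚ.1/ w) w (int (↧ z))) ⟩
      ℚ.1/ w ℚ.* w ℚ.* int (↧ z)        ≡⟨ cong (ℚ._* int (↧ z)) (ℚ.*-inverseˡ w) ⟩
      1ℚ ℚ.* int (↧ z)                  ≡⟨ ℚ.*-identityˡ (int (↧ z)) ⟩
      int (↧ z)                         ∎)
      where open ≡-Reasoning

    near-one-inverse-unit : (L.1# L.+ L.ι p L.* (z # z-integral)) L.* near-one-inverse ≡ L.1#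
    near-one-inverse-unit = value-injective (trans (cong (λ y → (1ℚ ℚ.+ y ℚ.* z) ℚ.* ℚ.1/ w) (value-ι p)) (ℚ.*-inverseʳ w))

  localization-isLocal : IsLocalAt localization p
  localization-isLocal = record
    { recip         = reciprocal
    ; recip-unit    = λ i i<p → value-injective (trans (cong₂ ℚ._*_ (value-ι (suc i)) (value-reciprocal i i<p))
        (1/-unit (suc i)))
    ; near-one⁻¹    = λ { (z # i) → near-one-inverse z i }
    ; near-one-unit = λ { (z # i) → near-one-inverse-unit z i }
    }

  module _ (d : ℕ) (p∤d : ¬ p ℕ.∣ d) where

    private
      coprime : Coprime p d
      coprime {i} (i∣p , i∣d) with prime⇒irreducible p-prime i∣p
      ... | inj₁ i≡1  = i≡1
      ... | inj₂ refl = contradiction i∣d p∤d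

      inverse-mod-p : ∃ λ e → ∃ λ c → + 1 ℤ.- + d ℤ.* e ≡ c ℤ.* + p
      inverse-mod-p with coprime-Bézout coprime
      ... | Bézout.+- x y eq = ℤ.- + y , + x , trans (sign (+ d) (+ y)) (trans (cong (λ z → + 1 ℤ.+ z) (sym (ℤ.pos-* y d)))
          (trans (cong +_ eq) (ℤ.pos-* x p)))
        where
        sign : ∀ d y → + 1 ℤ.- d ℤ.* (ℤ.- y) ≡ + 1 ℤ.+ y ℤ.* d
        sign = ℤSolver.solve-∀
      ... | Bézout.-+ x y eq = + y , ℤ.- + x , trans (cong (λ z → + 1 ℤ.- z) (trans (ℤ.*-comm (+ d) (+ y)) (trans (sym
          (ℤ.pos-* y d)) (trans (cong +_ (sym eq)) (cong (λ z → + 1 ℤ.+ z) (ℤ.pos-* x p)))))) (sign (+ x) (+ p))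
        where
        sign : ∀ x p → + 1 ℤ.- (+ 1 ℤ.+ x ℤ.* p) ≡ (ℤ.- x) ℤ.* p
        sign = ℤSolver.solve-∀

      e c : ℤ
      e = proj₁ inverse-mod-p
      c = proj₁ (proj₂ inverse-mod-p)

    -- Newton-like iteration: 1 − d·invₖ = (1 − d e)ᵏ.
    p-adic-inverse : ℕ → ℤ
    p-adic-inverse zero    = + 0
    p-adic-inverse (suc k) = p-adic-inverse k ℤ.+ e ℤ.* (+ 1 ℤ.- + d ℤ.* p-adic-inverse k)

    p-adic-inverse-error : ∀ k → + (p ℕ.^ k) ℤ.∣ + 1 ℤ.- + d ℤ.* p-adic-inverse k
    p-adic-inverse-error zero    = divides (+ 1 ℤ.- + d ℤ.* + 0) (sym (ℤ.*-identityʳ _))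
    p-adic-inverse-error (suc k) with p-adic-inverse-error k
    ... | divides b eq = divides (c ℤ.* b) (begin
      + 1 ℤ.- + d ℤ.* (u ℤ.+ e ℤ.* (+ 1 ℤ.- + d ℤ.* u))   ≡⟨ factor (+ d) u e ⟩
      (+ 1 ℤ.- + d ℤ.* e) ℤ.* (+ 1 ℤ.- + d ℤ.* u)         ≡⟨ cong₂ ℤ._*_ (proj₂ (proj₂ inverse-mod-p)) eq ⟩
      (c ℤ.* + p) ℤ.* (b ℤ.* + (p ℕ.^ k))                 ≡⟨ regroup c (+ p) b (+ (p ℕ.^ k)) ⟩
      c ℤ.* b ℤ.* (+ p ℤ.* + (p ℕ.^ k))                   ≡⟨ cong (c ℤ.* b ℤ.*_) (sym (ℤ.pos-* p (p ℕ.^ k))) ⟩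
      c ℤ.* b ℤ.* + (p ℕ.^ suc k)                         ∎)
      where
      open ≡-Reasoning
      u : ℤ
      u = p-adic-inverse k
      factor : ∀ d u e → + 1 ℤ.- d ℤ.* (u ℤ.+ e ℤ.* (+ 1 ℤ.- d ℤ.* u)) ≡ (+ 1 ℤ.- d ℤ.* e) ℤ.* (+ 1 ℤ.- d ℤ.* u)
      factor = ℤSolver.solve-∀
      regroup : ∀ a b c d → (a ℤ.* b) ℤ.* (c ℤ.* d) ≡ a ℤ.* c ℤ.* (b ℤ.* d)
      regroup = ℤSolver.solve-∀

    quotient : ℤ → ℤₚ p
    quotient a .residues k = a ℤ.* p-adic-inverse k
    quotient a .coherent k = subst (+ (p ℕ.^ k) ℤ.∣_) (rearrange a (p-adic-inverse k) e (+ 1 ℤ.- + d ℤ.* p-adic-inverse k))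
      (∣n⇒∣m*n (a ℤ.* e) (p-adic-inverse-error k))
      where
      rearrange : ∀ a u e z → a ℤ.* e ℤ.* z ≡ a ℤ.* (u ℤ.+ e ℤ.* z) ℤ.- a ℤ.* u
      rearrange = ℤSolver.solve-∀

    -- The witness is a/d. As ↧x · pᵐ · a = ↥x · d, replacing 1/d by an approximation u leaves the
    -- error -↥x(1 - d u), which is divisible by the required power of p.
    ∈pᵐℤₚ : ∀ x m a → x ℚ.* int (+ d) ≡ int (+ (p ℕ.^ m)) ℚ.* int a → x ∈ p ^ m ℤₚ
    ∈pᵐℤₚ x m a eq = quotient a , λ k → subst (+ (p ℕ.^ k) ℤ.∣_)
      (rearrange (↧ x) (+ (p ℕ.^ m)) a (p-adic-inverse k) (+ d) (↥ x) numerators)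
      (∣n⇒∣m*n (ℤ.- ↥ x) (p-adic-inverse-error k))
      where
      numerators : ↥ x ℤ.* + d ≡ + (p ℕ.^ m) ℤ.* a ℤ.* ↧ x
      numerators = int-injective (begin
        int (↥ x ℤ.* + d)                                 ≡⟨ int-* (↥ x) (+ d) ⟩
        int (↥ x) ℚ.* int (+ d)                           ≡⟨ cong (ℚ._* int (+ d)) (sym (denominator-clear x)) ⟩
        x ℚ.* int (↧ x) ℚ.* int (+ d)                     ≡⟨ Rearrangements.swap ℚ-ring x (int (↧ x)) (int (+ d)) ⟩
        x ℚ.* int (+ d) ℚ.* int (↧ x)                     ≡⟨ cong (ℚ._* int (↧ x)) (trans eq (sym (int-* (+ (p ℕ.^ m)) a))) ⟩
        int (+ (p ℕ.^ m) ℤ.* a) ℚ.* int (↧ x)             ≡⟨ sym (int-* (+ (p ℕ.^ m) ℤ.* a) (↧ x)) ⟩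
        int (+ (p ℕ.^ m) ℤ.* a ℤ.* ↧ x)                   ∎)
        where open ≡-Reasoning
      rearrange : ∀ b P a u d n → n ℤ.* d ≡ P ℤ.* a ℤ.* b → (ℤ.- n) ℤ.* (+ 1 ℤ.- d ℤ.* u) ≡ b ℤ.* (P ℤ.* (a ℤ.* u)) ℤ.- n
      rearrange b P a u d n eq = trans (expand n d u) (trans (cong (λ z → z ℤ.* u ℤ.- n) eq) (collect P a b u n))
        where
        expand : ∀ n d u → (ℤ.- n) ℤ.* (+ 1 ℤ.- d ℤ.* u) ≡ (n ℤ.* d) ℤ.* u ℤ.- n
        expand = ℤSolver.solve-∀
        collect : ∀ P a b u n → (P ℤ.* a ℤ.* b) ℤ.* u ℤ.- n ≡ b ℤ.* (P ℤ.* (a ℤ.* u)) ℤ.- n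
        collect = ℤSolver.solve-∀

-- Factorials and Euler polynomials over ℚ.

private module Q = RingLemmas ℚ-ring

ι≡int : ∀ k → Q.ι k ≡ int (+ k)
ι≡int zero    = int-def (+ 0)
ι≡int (suc k) = trans (cong₂ ℚ._+_ (int-def (+ 1)) (ι≡int k)) (sym (int-+ (+ 1) (+ k)))

sum≡∑ : ∀ n φ → ∑< n φ ≡ Q.∑ n φ
sum≡∑ zero    φ = refl
sum≡∑ (suc n) φ = cong (φ 0 ℚ.+_) (sum≡∑ n (λ i → φ (suc i)))

1^n≡1 : ∀ n → 1ℚ ^ n ≡ 1ℚ
1^n≡1 zero    = refl
1^n≡1 (suc n) = trans (ℚ.*-identityˡ (1ℚ ^ n)) (1^n≡1 n)

/-as-* : ∀ i d .{{_ : ℕ.NonZero d}} → i / d ≡ int i ℚ.* (+ 1 / d)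
/-as-* i d = trans (sym (trans (cong (i / d ℚ.*_) (1/-unit d)) (ℚ.*-identityʳ (i / d))))
  (trans (sym (ℚ.*-assoc (i / d) (int (+ d)) (+ 1 / d))) (cong (ℚ._* (+ 1 / d)) (/-clear i d)))

fac : ∀ k → int (+ (k !)) ℚ.* k !⁻¹ ≡ 1ℚ
fac k = 1/-unit (k !) {{k ℕ.!≢0}}

!⁻¹-suc : ∀ k → (suc k) !⁻¹ ≡ k !⁻¹ ℚ.* (+ 1 / suc k)
!⁻¹-suc k = Q.*-cancelˡ-unit {int (+ (suc k !))} {suc k !⁻¹} {suc k !⁻¹} {k !⁻¹ ℚ.* (+ 1 / suc k)} (fac (suc k)) (trans (fac
    (suc k)) (sym (trans
  (cong (λ z → z ℚ.* (k !⁻¹ ℚ.* (+ 1 / suc k))) (trans (cong int (ℤ.pos-* (suc k) (k !))) (int-* (+ suc k) (+ (k !)))))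
  (Rearrangements.factor-units ℚ-ring (int (+ suc k)) (int (+ (k !))) (+ 1 / suc k) (k !⁻¹) (1/-unit (suc k)) (fac k)))))

module EulerSeries where

  numerator : ℚ → Series
  numerator x = constant (fromℕ 2) ⊛ exp x

  denominator : Series
  denominator = exp 1ℚ ⊕ constant 1ℚ

  h : ℚ → Series
  h x = numerator x ⊘ denominator

  open ExponentialLemmas ℚ-ring

  recip-unit : ∀ k → Q.ι (suc k) ℚ.* (+ 1 / suc k) ≡ 1ℚ
  recip-unit k = trans (cong (ℚ._* (+ 1 / suc k)) (ι≡int (suc k))) (1/-unit (suc k))

  fac-suc : ∀ k → Q.ι (suc k) ℚ.* (suc k) !⁻¹ ≡ k !⁻¹
  fac-suc k = trans (cong (Q.ι (suc k) ℚ.*_) (trans (!⁻¹-suc k) (ℚ.*-comm (k !⁻¹) (+ 1 / suc k))))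
    (trans (sym (ℚ.*-assoc (Q.ι (suc k)) (+ 1 / suc k) (k !⁻¹))) (trans (cong (ℚ._* k !⁻¹) (recip-unit k)) (ℚ.*-identityˡ
        (k !⁻¹))))

  unit : ℕ → ℚ
  unit = unit-series (λ k → + 1 / suc k) _!⁻¹ recip-unit refl fac-suc

  denominator-coefficient : ∀ i → denominator i ≡ i !⁻¹ ℚ.+ unit i
  denominator-coefficient i = cong₂ ℚ._+_ (trans (cong (ℚ._* i !⁻¹) (1^n≡1 i)) (ℚ.*-identityˡ (i !⁻¹))) (const i)
    where
    const : ∀ i → constant 1ℚ i ≡ unit i
    const zero    = refl
    const (suc i) = refl

  numerator-coefficient : ∀ x n → numerator x n ≡ Q.ι 2 ℚ.* (x ^ n ℚ.* n !⁻¹)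
  numerator-coefficient x n = trans (sum≡∑ (suc n) (λ i → constant (fromℕ 2) i ℚ.* exp x (n ∸ i)))
    (trans (cong (fromℕ 2 ℚ.* exp x n ℚ.+_) (Q.∑-zero n (λ i _ → ℚ.*-zeroˡ (exp x (n ∸ suc i))))) (ℚ.+-identityʳ
        (fromℕ 2 ℚ.* exp x n)))

  recurrence : ∀ x n → Q.∑ (suc n) (λ i → (i !⁻¹ ℚ.+ unit i) ℚ.* h x (n ∸ i)) ≡ Q.ι 2 ℚ.* (x ^ n ℚ.* n !⁻¹)
  recurrence x n = trans (Q.∑-cong (suc n) (λ i _ → cong (ℚ._* h x (n ∸ i)) (sym (denominator-coefficient i))))
    (trans (sym (sum≡∑ (suc n) (λ i → denominator i ℚ.* h x (n ∸ i))))
      (trans (⊛-⊘ (numerator x) denominator n) (numerator-coefficient x n)))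

  Euler-shift : ∀ x n → Euler n (1ℚ ℚ.+ x) ℚ.+ Euler n x ≡ Q.ι 2 ℚ.* x ^ n
  Euler-shift x n = Rearrangements.scale-sum ℚ-ring (fromℕ (n !)) (h x n) (h (1ℚ ℚ.+ x) n) (Q.ι 2) (x ^ n) (n !⁻¹)
    (trans (cong (ℚ._* n !⁻¹) (int-def (+ (n !)))) (fac n))
    (euler-shift (λ k → + 1 / suc k) _!⁻¹ recip-unit refl fac-suc x (h x) (h (1ℚ ℚ.+ x)) (recurrence x) (recurrence (1ℚ ℚ.+ x)) n)

-- Euler polynomials of degree below p: integrality and congruence modulo p.

module _ {p : ℕ} (p-prime : Prime p) (2<p : 2 ℕ.< p) where

  open ℤ₍ₚ₎
  private
    𝒪 : Ring≡
    𝒪 = localization p-prime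
    module L = RingLemmas 𝒪
    open CongruenceLemmas 𝒪

  p∤! : ∀ k → k ℕ.< p → ¬ p ℕ.∣ k !
  p∤! zero    _   = p∤1 p-prime
  p∤! (suc k) k<p = p∤-* p-prime (p∤<p p-prime k<p) (p∤! k (ℕ.<-trans ℕ.≤-refl k<p))

  integral-!⁻¹ : ∀ k → k ℕ.< p → Integral p-prime (k !⁻¹)
  integral-!⁻¹ k k<p = clear⇒integral p-prime (k !⁻¹) (+ (k !)) (+ 1) (p∤! k k<p) (/-clear (+ 1) (k !) {{k ℕ.!≢0}})

  module _ (x y : ℤ₍ₚ₎ p-prime) (x≈y : x ≈ y [ L.ι p ]) where

    -- The pairs of p-integral rationals that are congruent modulo p: a subring of ℚ × ℚ.
    Congruent : ℚ → ℚ → Set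
    Congruent a b = ∃ λ u → ∃ λ v → value u ≡ a × value v ≡ b × u ≈ v [ L.ι p ]

    congruent-const : ∀ a → Integral p-prime a → Congruent a a
    congruent-const a i = (a # i) , (a # i) , refl , refl , ≈-refl

    congruent-+ : ∀ {a b c d} → Congruent a b → Congruent c d → Congruent (a ℚ.+ c) (b ℚ.+ d)
    congruent-+ (u , v , u≡ , v≡ , u≈v) (u′ , v′ , u′≡ , v′≡ , u′≈v′) =
      u L.+ u′ , v L.+ v′ , cong₂ ℚ._+_ u≡ u′≡ , cong₂ ℚ._+_ v≡ v′≡ , ≈-+ u≈v u′≈v′

    congruent-* : ∀ {a b c d} → Congruent a b → Congruent c d → Congruent (a ℚ.* c) (b ℚ.* d)
    congruent-* (u , v , u≡ , v≡ , u≈v) (u′ , v′ , u′≡ , v′≡ , u′≈v′) =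
      u L.* u′ , v L.* v′ , cong₂ ℚ._*_ u≡ u′≡ , cong₂ ℚ._*_ v≡ v′≡ , ≈-* u≈v u′≈v′

    congruent-neg : ∀ {a b} → Congruent a b → Congruent (ℚ.- a) (ℚ.- b)
    congruent-neg (u , v , u≡ , v≡ , u≈v) = L.- u , L.- v , cong ℚ.-_ u≡ , cong ℚ.-_ v≡ , ≈-neg u≈v

    congruent-sum : ∀ n {a b : Fin n → ℚ} → (∀ i → Congruent (a i) (b i)) → Congruent (sum a) (sum b)
    congruent-sum zero    eq = congruent-const 0ℚ (p∤1 p-prime)
    congruent-sum (suc n) eq = congruent-+ (eq Fin.zero) (congruent-sum n (λ i → eq (Fin.suc i)))

    congruent-^ : ∀ k → Congruent (value x ^ k) (value y ^ k)
    congruent-^ zero    = congruent-const 1ℚ (p∤1 p-prime)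
    congruent-^ (suc k) = congruent-* (x , y , refl , refl , x≈y) (congruent-^ k)

    congruent-exp : ∀ k → k ℕ.< p → Congruent (exp (value x) k) (exp (value y) k)
    congruent-exp k k<p = congruent-* (congruent-^ k) (congruent-const (k !⁻¹) (integral-!⁻¹ k k<p))

    congruent-constant : ∀ i k → Congruent (constant (fromℕ i) k) (constant (fromℕ i) k)
    congruent-constant i zero    = congruent-const (fromℕ i) (subst (Integral p-prime) (sym (int-def (+ i)))
        (integral-int p-prime (+ i)))
    congruent-constant i (suc k) = congruent-const 0ℚ (p∤1 p-prime)

    open EulerSeries

    congruent-numerator : ∀ n → n ℕ.< p → Congruent (numerator (value x) n) (numerator (value y) n)
    congruent-numerator n n<p = congruent-sum (suc n) (λ i → congruent-* (congruent-constant 2 (toℕ i))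
      (congruent-exp (n ∸ toℕ i) (ℕ.≤-<-trans (ℕ.m∸n≤m n (toℕ i)) n<p)))

    congruent-denominator : ∀ n → n ℕ.< p → Congruent (denominator n) (denominator n)
    congruent-denominator n n<p = congruent-+ (subst (λ a → Congruent (a ℚ.* n !⁻¹) (a ℚ.* n !⁻¹)) (sym (1^n≡1 n))
      (congruent-* (congruent-const 1ℚ (p∤1 p-prime)) (congruent-const (n !⁻¹) (integral-!⁻¹ n n<p)))) (congruent-constant 1 n)

    -- The recursion for the first `n` coefficients uses only ring operations, inverse factorials
    -- below p!, and division by the constant coefficient.
    congruent-quotient : ∀ n → n ℕ.≤ p → ∀ i →
      Congruent (lookup (quotientCoeffs (numerator (value x)) denominator n) i) (lookup (quotientCoeffs (numerator
          (value y)) denominator n) i)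
    congruent-quotient (suc n) n<p Fin.zero    = congruent-* (congruent-+ (congruent-numerator n n<p)
        (congruent-neg (congruent-sum n (λ i → congruent-* (congruent-denominator (suc (toℕ i)) (ℕ.≤-<-trans (Fin.toℕ<n i) n<p))
          (congruent-quotient n (ℕ.<⇒≤ n<p) i)))))
      -- The constant coefficient of e^t + 1 is 2, which is prime to p because 2 < p.
      (congruent-const (+ 1 / 2) (clear⇒integral p-prime (+ 1 / 2) (+ 2) (+ 1) (p∤<p p-prime 2<p) (/-clear (+ 1) 2)))
    congruent-quotient (suc n) n<p (Fin.suc i) = congruent-quotient n (ℕ.<⇒≤ n<p) i

    congruent-Euler : ∀ n → n ℕ.< p → Congruent (Euler n (value x)) (Euler n (value y))
    congruent-Euler n n<p = congruent-* (congruent-constant (n !) 0) (congruent-quotient (suc n) n<p Fin.zero)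

  -- The diagonal case x = y: a `Congruent` pair consists of p-integral numbers.
  integral-Euler : ∀ n → n ℕ.< p → ∀ x → .(Integral p-prime x) → Integral p-prime (Euler n x)
  integral-Euler n n<p x i = integral-left (congruent-Euler (x # i) (x # i) ≈-refl n n<p)
    where
    integral-left : ∀ {a b} → Congruent (x # i) (x # i) ≈-refl a b → Integral p-prime a
    integral-left ((_ # j) , _ , refl , _) p∣d = ⊥-elim (j p∣d)

  EulerValue : ∀ n → n ℕ.< p → ℤ₍ₚ₎ p-prime → ℤ₍ₚ₎ p-prime
  EulerValue n n<p (x # i) = Euler n x # integral-Euler n n<p x i

  EulerValue-cong : ∀ n n<p {x y} → x ≈ y [ L.ι p ] → EulerValue n n<p x ≈ EulerValue n n<p y [ L.ι p ]
  EulerValue-cong n n<p {x} {y} x≈y = transport (congruent-Euler x y x≈y n n<p)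
    where
    transport : ∀ {u v} → Congruent x y x≈y (value u) (value v) → u ≈ v [ L.ι p ]
    transport (u , v , refl , refl , u≈v) = u≈v

  value-^ : ∀ x k → value (x L.^ k) ≡ value x ^ k
  value-^ x zero    = refl
  value-^ x (suc k) = cong (value x ℚ.*_) (value-^ x k)

  EulerValue-step : ∀ n n<p x → EulerValue n n<p (x L.+ L.1#) L.+ EulerValue n n<p x ≡ L.ι 2 L.* x L.^ n
  EulerValue-step n n<p x = value-injective p-prime (trans
    (cong (λ y → Euler n y ℚ.+ Euler n (value x)) (ℚ.+-comm (value x) 1ℚ))
    (trans (EulerSeries.Euler-shift (value x) n) (cong (Q.ι 2 ℚ.*_) (sym (value-^ x n)))))

-- Transfer of the supercongruence to rational numbers.

term : ℕ → ℚ
term k = (- 1ℚ) ^ k * fromℕ (8 ℕ.* k ℕ.+ 1) * (pochhammer (+ 1 / 4) k ^ 3 * (k !⁻¹) ^ 3)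

module _ {p : ℕ} (p-prime : Prime p) where

  open ℤ₍ₚ₎
  private
    𝒪 : Ring≡
    𝒪 = localization p-prime
    module L = RingLemmas 𝒪
  open CongruenceLemmas 𝒪

  ≈⇒≡mod : ∀ m (x y : ℤ₍ₚ₎ p-prime) → x ≈ y [ L.ι (p ℕ.^ m) ] → value x ≡ value y [mod p ^ m ]
  ≈⇒≡mod m x y ((z # i) , eq) = ∈pᵐℤₚ p-prime (↧ₙ z) (λ p∣d → ⊥-elim (i p∣d)) (value x - value y) m (↥ z) (begin
    (value x - value y) * int (↧ z)
      ≡⟨ cong (_* int (↧ z)) (trans (cong (λ u → value u - value y) eq) (Rearrangements.subtract-left ℚ-ring (value y)
          (value (L.ι (p ℕ.^ m)) * z))) ⟩
    value (L.ι (p ℕ.^ m)) * z * int (↧ z)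
      ≡⟨ trans (ℚ.*-assoc (value (L.ι (p ℕ.^ m))) z (int (↧ z))) (cong₂ _*_ (value-ι p-prime (p ℕ.^ m)) (denominator-clear z)) ⟩
    int (+ (p ℕ.^ m)) * int (↥ z) ∎)
    where open ≡-Reasoning

  value-∑ : ∀ n {f : ℕ → ℤ₍ₚ₎ p-prime} {φ : ℕ → ℚ} → (∀ i → i ℕ.< n → value (f i) ≡ φ i) → value (L.∑ n f) ≡ ∑< n φ
  value-∑ zero    eq = refl
  value-∑ (suc n) eq = cong₂ _+_ (eq 0 z<s) (value-∑ n (λ i i<n → eq (suc i) (s<s i<n)))

  value-fromℕ : ∀ k → value (L.ι k) ≡ fromℕ k
  value-fromℕ k = trans (value-ι p-prime k) (sym (int-def (+ k)))

  value-sgn : ∀ n → value (L.sgn n) ≡ (- 1ℚ) ^ n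
  value-sgn zero    = refl
  value-sgn (suc n) = trans (cong -_ (value-sgn n)) (Rearrangements.minus-one-* ℚ-ring ((- 1ℚ) ^ n))

  module _ (n q k : ℕ) (4<p : 4 ℕ.< p)
    (1+n+1+q≡p : suc n ℕ.+ suc q ≡ p) (4n+1≡3p : 4 ℕ.* n ℕ.+ 1 ≡ 3 ℕ.* p) (p≡3+m : p ≡ 3 ℕ.+ (suc k ℕ.+ suc k)) where

    private
      module S = Supercongruence 𝒪 p n q 4<p 1+n+1+q≡p 4n+1≡3p (localization-isLocal p-prime)

      m : ℕ
      m = suc k ℕ.+ suc k
      2<p : 2 ℕ.< p
      2<p = ℕ.<-trans (s<s (s<s z<s)) 4<p
      m<p : m ℕ.< p
      m<p = subst (m ℕ.<_) (sym p≡3+m) (ℕ.m≤n+m (suc m) 2)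

    value-¼ : value S.¼ ≡ + 1 / 4
    value-¼ = value-reciprocal p-prime 3 4<p

    value-T⁰ : ∀ j → j ℕ.< p → value (S.T⁰ j) ≡ (- 1ℚ) ^ j * (pochhammer (+ 1 / 4) j ^ 3 * (j !⁻¹) ^ 3)
    value-T⁰ zero    _   = refl
    value-T⁰ (suc j) j<p = begin
      value (S.T⁰ j) * (- (a * a * a) * (ρ * ρ * ρ))
        ≡⟨ cong₂ _*_ (value-T⁰ j (ℕ.<-trans ℕ.≤-refl j<p)) (cong₂ (λ x y → - (x * x * x) * (y * y * y)) (cong₂ _+_ value-¼
            (value-fromℕ j)) (value-reciprocal p-prime j j<p)) ⟩
      (- 1ℚ) ^ j * (pochhammer (+ 1 / 4) j ^ 3 * (j !⁻¹) ^ 3) * (- (b * b * b) * ((+ 1 / suc j) * (+ 1 / suc j) * (+ 1 / suc j)))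
        ≡⟨ sym (Rearrangements.term-step ℚ-ring ((- 1ℚ) ^ j) (pochhammer (+ 1 / 4) j) (j !⁻¹) (+ 1 / suc j) b) ⟩
      (- 1ℚ) ^ suc j * (pochhammer (+ 1 / 4) (suc j) ^ 3 * (j !⁻¹ * (+ 1 / suc j)) ^ 3)
        ≡⟨ cong (λ x → (- 1ℚ) ^ suc j * (pochhammer (+ 1 / 4) (suc j) ^ 3 * x ^ 3)) (sym (!⁻¹-suc j)) ⟩
      (- 1ℚ) ^ suc j * (pochhammer (+ 1 / 4) (suc j) ^ 3 * (suc j !⁻¹) ^ 3) ∎
      where
      open ≡-Reasoning
      a ρ b : ℚ
      a = value (S.A j)
      ρ = value (reciprocal p-prime j)
      b = + 1 / 4 + fromℕ j

    value-term : ∀ j → j ℕ.< p → value (S.weight j L.* S.T⁰ j) ≡ term j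
    value-term j j<p = trans (cong₂ _*_ (trans (cong value (Rearrangements.weight-cast 𝒪 j)) (value-fromℕ (8 ℕ.* j ℕ.+ 1)))
        (value-T⁰ j j<p))
      (sym (Rearrangements.reorder ℚ-ring ((- 1ℚ) ^ j) (fromℕ (8 ℕ.* j ℕ.+ 1)) (pochhammer (+ 1 / 4) j ^ 3 * (j !⁻¹) ^ 3)))

    rhs : ℚ
    rhs = fromℕ (3 ℕ.* p) * (- 1ℚ) ^ n + (+ (27 ℕ.* p ℕ.^ 3) / 16) * Euler m (+ 1 / 4)

    private
      E : ℤ₍ₚ₎ p-prime → ℤ₍ₚ₎ p-prime
      E = EulerValue p-prime 2<p m m<p
      sums : ℕ → ℤ₍ₚ₎ p-prime
      sums N = L.∑ N (λ j → S.weight j L.* S.T⁰ j)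
      rhs-𝒪 : ℤ₍ₚ₎ p-prime
      rhs-𝒪 = L.ι 3 L.* S.P L.* L.sgn n L.+ L.ι 27 L.* (S.¼ L.* S.¼) L.* S.P³ L.* E S.¼

    value-rhs : value rhs-𝒪 ≡ rhs
    value-rhs = trans (cong value (Rearrangements.rhs-cast 𝒪 p (L.sgn n) S.¼ (E S.¼)))
      (cong₂ _+_ (cong₂ _*_ (value-fromℕ (3 ℕ.* p)) (value-sgn n))
        (cong₂ _*_ (trans (cong₂ (λ x y → x * (y * y)) (value-ι p-prime (27 ℕ.* p ℕ.^ 3)) value-¼) (sym (/-as-* (+
            (27 ℕ.* p ℕ.^ 3)) 16)))
          (cong (Euler m) value-¼)))

    short-sum : sums (suc n) ≈ rhs-𝒪 [ S.P³ L.* S.P ]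
    short-sum = S.supercongruence k p≡3+m E (EulerValue-step p-prime 2<p m m<p) (EulerValue-cong p-prime 2<p m m<p)

    -- With N ≤ p only indices j < p occur. In that range every `reciprocal` inside `T⁰ j` is a true
    -- reciprocal, so its value is the rational term.
    supercongruence-ℚ : ∀ N → N ℕ.≤ p → sums N ≈ rhs-𝒪 [ S.P³ L.* S.P ] → ∑< N term ≡ rhs [mod p ^ 4 ]
    supercongruence-ℚ N N≤p eq = subst₂ (λ x y → x ≡ y [mod p ^ 4 ])
      (value-∑ N (λ j j<N → value-term j (ℕ.<-≤-trans j<N N≤p))) value-rhs
      (≈⇒≡mod 4 (sums N) rhs-𝒪 (subst (λ d → sums N ≈ rhs-𝒪 [ d ]) (Rearrangements.ι-fourth-power 𝒪 p) eq))

    supercongruence-short : ∑< (suc n) term ≡ rhs [mod p ^ 4 ]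
    supercongruence-short = supercongruence-ℚ (suc n) (subst (suc n ℕ.≤_) 1+n+1+q≡p (ℕ.m≤m+n (suc n) (suc q))) short-sum

    supercongruence-long : ∑< p term ≡ rhs [mod p ^ 4 ]
    supercongruence-long = supercongruence-ℚ p ℕ.≤-refl (≈-trans S.tail-sum short-sum)

-- Primes congruent to 3 modulo 4: p = 3, and p = 7 + 4q.

private
  Claim : ℕ → ℕ → Set
  Claim p M = ∑≤ M term ≡ fromℕ (3 ℕ.* p) * (- 1ℚ) ^ ((3 ℕ.* p ∸ 1) ℕ./ 4) + (+ (27 ℕ.* p ℕ.^ 3) / 16) * Euler (p ∸ 3)
      (+ 1 / 4) [mod p ^ 4 ]

  -- E₀(0) = 1 does not vanish modulo p, so p = 3 needs a separate computation.
  claim-3 : Prime 3 → Claim 3 2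
  -- The sum is 30285/32768 and the right side is 9 + 729/16; their difference is 81 ·
  -- (-21699)/32768, where 32768 = 2¹⁵.
  claim-3 3-prime = ∈pᵐℤₚ 3-prime 32768 (λ 3∣d → contradiction (ℕ.n∣m⇒m%n≡0 32768 3 3∣d) λ ()) d 4 (ℤ.- + 21699)
    (subst₂ (λ x y → d * x ≡ y) (int-def (+ 32768)) (cong₂ _*_ (int-def (+ 81)) (int-def (ℤ.- + 21699))) refl)
    where
    d : ℚ
    d = ∑≤ 2 term - (fromℕ 9 * (- 1ℚ) ^ 2 + (+ 729 / 16) * Euler 0 (+ 1 / 4))

  claim-7+4q : ∀ q {p} → Prime p → p ≡ 7 ℕ.+ 4 ℕ.* q → ∀ M → M ≡ (3 ℕ.* p ∸ 1) ℕ./ 4 ⊎ M ≡ p ∸ 1 → Claim p M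
  claim-7+4q q {p} p-prime refl M M≡ = subst₂
    (λ i j → ∑≤ M term ≡ fromℕ (3 ℕ.* p) * (- 1ℚ) ^ i + (+ (27 ℕ.* p ℕ.^ 3) / 16) * Euler j (+ 1 / 4) [mod p ^ 4 ])
    (sym index) (sym degree) (both M≡)
    where
    n k : ℕ
    n = 5 ℕ.+ 3 ℕ.* q
    k = 1 ℕ.+ 2 ℕ.* q
    4<p : 4 ℕ.< p
    4<p = s<s (s<s (s<s (s<s z<s)))
    1+n+1+q≡p : suc n ℕ.+ suc q ≡ p
    1+n+1+q≡p = lemma q
      where
      lemma : ∀ q → 6 ℕ.+ 3 ℕ.* q ℕ.+ suc q ≡ 7 ℕ.+ 4 ℕ.* q
      lemma = ℕSolver.solve-∀
    4n+1≡3p : 4 ℕ.* n ℕ.+ 1 ≡ 3 ℕ.* p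
    4n+1≡3p = lemma q
      where
      lemma : ∀ q → 4 ℕ.* (5 ℕ.+ 3 ℕ.* q) ℕ.+ 1 ≡ 3 ℕ.* (7 ℕ.+ 4 ℕ.* q)
      lemma = ℕSolver.solve-∀
    p≡3+m : p ≡ 3 ℕ.+ (suc k ℕ.+ suc k)
    p≡3+m = lemma q
      where
      lemma : ∀ q → 7 ℕ.+ 4 ℕ.* q ≡ 3 ℕ.+ (suc (1 ℕ.+ 2 ℕ.* q) ℕ.+ suc (1 ℕ.+ 2 ℕ.* q))
      lemma = ℕSolver.solve-∀
    index : (3 ℕ.* p ∸ 1) ℕ./ 4 ≡ n
    index = trans (cong (λ x → (x ∸ 1) ℕ./ 4) (sym 4n+1≡3p))
      (trans (cong (ℕ._/ 4) (trans (ℕ.m+n∸n≡m (4 ℕ.* n) 1) (ℕ.*-comm 4 n))) (ℕ.m*n/n≡m n 4))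
    degree : p ∸ 3 ≡ suc k ℕ.+ suc k
    degree = cong (_∸ 3) p≡3+m
    both : ∀ {M} → M ≡ (3 ℕ.* p ∸ 1) ℕ./ 4 ⊎ M ≡ p ∸ 1 →
           ∑≤ M term ≡ rhs p-prime n q k 4<p 1+n+1+q≡p 4n+1≡3p p≡3+m [mod p ^ 4 ]
    both (inj₁ M≡n) = subst (λ M → ∑≤ M term ≡ rhs p-prime n q k 4<p 1+n+1+q≡p 4n+1≡3p p≡3+m [mod p ^ 4 ]) (sym (trans M≡n index))
      (supercongruence-short p-prime n q k 4<p 1+n+1+q≡p 4n+1≡3p p≡3+m)
    both (inj₂ refl) = supercongruence-long p-prime n q k 4<p 1+n+1+q≡p 4n+1≡3p p≡3+m

  claim : ∀ q {p} → Prime p → p ≡ 3 ℕ.+ q ℕ.* 4 → ∀ M → M ≡ (3 ℕ.* p ∸ 1) ℕ./ 4 ⊎ M ≡ p ∸ 1 → Claim p M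
  -- For p = 3 both upper limits are 2.
  claim zero    p-prime refl M (inj₁ refl) = claim-3 p-prime
  claim zero    p-prime refl M (inj₂ refl) = claim-3 p-prime
  claim (suc q) p-prime p≡   M M≡          = claim-7+4q q p-prime (trans p≡ (cong (7 ℕ.+_) (ℕ.*-comm q 4))) M M≡

theorem1p4 : ∀ (p : ℕ) → Prime p → p % 4 ≡ 3 →
    ∀ (M : ℕ) → M ≡ (3 ℕ.* p ∸ 1) ℕ./ 4 ⊎ M ≡ p ∸ 1 →
    ∑≤ M (λ k → (- 1ℚ) ^ k * fromℕ (8 ℕ.* k ℕ.+ 1) * (pochhammer (+ 1 / 4) k ^ 3 * (k !⁻¹) ^ 3))
    ≡ fromℕ (3 ℕ.* p) * (- 1ℚ) ^ ((3 ℕ.* p ∸ 1) ℕ./ 4) + (+ (27 ℕ.* p ℕ.^ 3) / 16) * Euler (p ∸ 3) (+ 1 / 4)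
    [mod p ^ 4 ]
theorem1p4 p p-prime p%4≡3 = claim (p ℕ./ 4) p-prime (trans (ℕ.m≡m%n+[m/n]*n p 4) (cong (ℕ._+ p ℕ./ 4 ℕ.* 4) p%4≡3))
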